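{- The first-order theory of the upper semilattice $\mathbf{C}^{pr}_m$ is hereditarily undecidable.
   Context: For $A,B\subseteq\omega$, $A$ is primitively recursively $m$-reducible to $B$ (written $A\leq^{pr}_m B$) if there is a primitive recursive function $f$ with $\forall x\,(x\in A\Leftrightarrow f(x)\in B)$. Write $A\equiv^{pr}_m B$ if $A\leq^{pr}_m B$ and $B\leq^{pr}_m A$; the equivalence classes are the $pr$-$m$-degrees $\deg^{pr}_m(A)$, partially ordered by $\deg^{pr}_m(A)\leq\deg^{pr}_m(B)$ iff $A\leq^{pr}_m B$, with join $\deg^{pr}_m(A)\vee\deg^{pr}_m(B)=\deg^{pr}_m(A\oplus B)$, where $A\oplus B=\{2x:x\in A\}\cup\{2x+1:x\in B\}$. $\mathbf{C}^{pr}_m$ denotes the upper semilattice of the $pr$-$m$-degrees of all computable sets, excluding the degrees $\deg^{pr}_m(\emptyset)$ and $\deg^{pr}_m(\omega)$. -}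

module Defs where

open import Data.Nat using (ℕ; zero; suc; _+_; _*_; _<_; _≡ᵇ_)
open import Data.Nat.Properties using (*-suc)
open import Data.Bool using (Bool; true; false; if_then_else_)
open import Data.Fin using (Fin) renaming (zero to fz; suc to fs)
open import Data.Vec using (Vec; []; _∷_; lookup)
open import Data.Product using (Σ; _×_; _,_; proj₁; proj₂)
open import Data.Empty using (⊥)
open import Relation.Nullary using (¬_)
open import Relation.Binary.PropositionalEquality
  using (_≡_; refl; sym; trans; cong; subst)

data PR : ℕ → Set where
  zeroᵖ : ∀ {n} → PR n
  succᵖ : PR 1
  projᵖ : ∀ {n} → Fin n → PR n
  compᵖ : ∀ {n m} → PR m → Vec (PR n) m → PR n
  precᵖ : ∀ {n} → PR n → PR (suc (suc n)) → PR (suc n)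

mutual
  evalPR : ∀ {n} → PR n → Vec ℕ n → ℕ
  evalPR zeroᵖ xs = 0
  evalPR succᵖ (x ∷ []) = suc x
  evalPR (projᵖ i) xs = lookup xs i
  evalPR (compᵖ f gs) xs = evalPR f (evalPRs gs xs)
  evalPR (precᵖ g h) (k ∷ xs) = evalPrec g h k xs

  evalPRs : ∀ {n m} → Vec (PR n) m → Vec ℕ n → Vec ℕ m
  evalPRs [] xs = []
  evalPRs (g ∷ gs) xs = evalPR g xs ∷ evalPRs gs xs

  evalPrec : ∀ {n} → PR n → PR (suc (suc n)) → ℕ → Vec ℕ n → ℕ
  evalPrec g h zero xs = evalPR g xs
  evalPrec g h (suc k) xs = evalPR h (k ∷ evalPrec g h k xs ∷ xs)

data Rec : ℕ → Set where
  zeroʳ : ∀ {n} → Rec n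
  succʳ : Rec 1
  projʳ : ∀ {n} → Fin n → Rec n
  compʳ : ∀ {n m} → Rec m → Vec (Rec n) m → Rec n
  precʳ : ∀ {n} → Rec n → Rec (suc (suc n)) → Rec (suc n)
  muʳ   : ∀ {n} → Rec (suc n) → Rec n

mutual
  data _[_]⇓_ : ∀ {n} → Rec n → Vec ℕ n → ℕ → Set where
    ⇓zero : ∀ {n} {xs : Vec ℕ n} → zeroʳ [ xs ]⇓ 0
    ⇓succ : ∀ {x} → succʳ [ x ∷ [] ]⇓ suc x
    ⇓proj : ∀ {n} {xs : Vec ℕ n} (i : Fin n) → projʳ i [ xs ]⇓ lookup xs i
    ⇓comp : ∀ {n m} {f : Rec m} {gs : Vec (Rec n) m} {xs ys y} →
            gs [ xs ]⇓* ys → f [ ys ]⇓ y → compʳ f gs [ xs ]⇓ y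
    ⇓prec0 : ∀ {n} {g : Rec n} {h xs y} →
             g [ xs ]⇓ y → precʳ g h [ 0 ∷ xs ]⇓ y
    ⇓precS : ∀ {n} {g : Rec n} {h xs k r y} →
             precʳ g h [ k ∷ xs ]⇓ r → h [ k ∷ r ∷ xs ]⇓ y →
             precʳ g h [ suc k ∷ xs ]⇓ y
    ⇓mu : ∀ {n} {f : Rec (suc n)} {xs y} →
          f [ y ∷ xs ]⇓ 0 →
          (∀ z → z < y → Σ ℕ λ w → f [ z ∷ xs ]⇓ suc w) →
          muʳ f [ xs ]⇓ y

  data _[_]⇓*_ : ∀ {n m} → Vec (Rec n) m → Vec ℕ n → Vec ℕ m → Set where
    ⇓[] : ∀ {n} {xs : Vec ℕ n} → [] [ xs ]⇓* []
    ⇓∷  : ∀ {n m} {g : Rec n} {gs : Vec (Rec n) m} {xs y ys} →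
          g [ xs ]⇓ y → gs [ xs ]⇓* ys → (g ∷ gs) [ xs ]⇓* (y ∷ ys)

χ : Bool → ℕ
χ true = 1
χ false = 0

Computable : (ℕ → Bool) → Set
Computable A = Σ (Rec 1) λ e → ∀ x → e [ x ∷ [] ]⇓ χ (A x)

_≤ᵖʳₘ_ : (ℕ → Bool) → (ℕ → Bool) → Set
A ≤ᵖʳₘ B = Σ (PR 1) λ f → ∀ x → A x ≡ B (evalPR f (x ∷ []))

_≡ᵖʳₘ_ : (ℕ → Bool) → (ℕ → Bool) → Set
A ≡ᵖʳₘ B = (A ≤ᵖʳₘ B) × (B ≤ᵖʳₘ A)

∅ˢ : ℕ → Bool
∅ˢ _ = false

ωˢ : ℕ → Bool
ωˢ _ = true

isZᴺ : ℕ → ℕ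
isZᴺ zero = 1
isZᴺ (suc _) = 0

parᴺ : ℕ → ℕ
parᴺ zero = 0
parᴺ (suc k) = isZᴺ (parᴺ k)

halfᴺ : ℕ → ℕ
halfᴺ zero = 0
halfᴺ (suc k) = parᴺ k + halfᴺ k

condB : ℕ → Bool → Bool → Bool
condB zero b a = a
condB (suc _) b a = b

-- A ⊕ B = {2x : x ∈ A} ∪ {2x+1 : x ∈ B}  (see ⊕-even / ⊕-odd below)
_⊕_ : (ℕ → Bool) → (ℕ → Bool) → (ℕ → Bool)
(A ⊕ B) n = condB (parᴺ n) (B (halfᴺ n)) (A (halfᴺ n))

private
  dbl : ℕ → ℕ
  dbl zero = zero
  dbl (suc x) = suc (suc (dbl x))

  par-dbl : ∀ x → parᴺ (dbl x) ≡ 0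
  par-dbl zero = refl
  par-dbl (suc x) rewrite par-dbl x = refl

  half-dbl : ∀ x → halfᴺ (dbl x) ≡ x
  half-dbl zero = refl
  half-dbl (suc x) rewrite par-dbl x | half-dbl x = refl

  half-sdbl : ∀ x → halfᴺ (suc (dbl x)) ≡ x
  half-sdbl x rewrite par-dbl x | half-dbl x = refl

  dbl≡ : ∀ x → dbl x ≡ 2 * x
  dbl≡ zero = refl
  dbl≡ (suc x) = trans (cong (λ y → suc (suc y)) (dbl≡ x)) (sym (*-suc 2 x))

⊕-even : ∀ A B x → (A ⊕ B) (2 * x) ≡ A x
⊕-even A B x rewrite sym (dbl≡ x) | par-dbl x | half-dbl x = refl

⊕-odd : ∀ A B x → (A ⊕ B) (suc (2 * x)) ≡ B x
⊕-odd A B x rewrite sym (dbl≡ x) | par-dbl x | half-dbl x = refl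

private
  P0 : ∀ {n} → Fin (suc n)
  P0 = fz
  P1 : ∀ {n} → Fin (suc (suc n))
  P1 = fs fz
  P2 : ∀ {n} → Fin (suc (suc (suc n)))
  P2 = fs (fs fz)

  isZʳ : Rec 1
  isZʳ = precʳ (compʳ succʳ (zeroʳ ∷ [])) zeroʳ

  isZ-ok : ∀ k → isZʳ [ k ∷ [] ]⇓ isZᴺ k
  isZ-ok zero = ⇓prec0 (⇓comp (⇓∷ ⇓zero ⇓[]) ⇓succ)
  isZ-ok (suc k) = ⇓precS (isZ-ok k) ⇓zero

  parʳ : Rec 1
  parʳ = precʳ zeroʳ (compʳ isZʳ (projʳ P1 ∷ []))

  par-ok : ∀ k → parʳ [ k ∷ [] ]⇓ parᴺ k
  par-ok zero = ⇓prec0 ⇓zero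
  par-ok (suc k) = ⇓precS (par-ok k) (⇓comp (⇓∷ (⇓proj P1) ⇓[]) (isZ-ok (parᴺ k)))

  addʳ : Rec 2
  addʳ = precʳ (projʳ P0) (compʳ succʳ (projʳ P1 ∷ []))

  add-ok : ∀ y x → addʳ [ y ∷ x ∷ [] ]⇓ (y + x)
  add-ok zero x = ⇓prec0 (⇓proj P0)
  add-ok (suc y) x = ⇓precS (add-ok y x) (⇓comp (⇓∷ (⇓proj P1) ⇓[]) ⇓succ)

  halfʳ : Rec 1
  halfʳ = precʳ zeroʳ (compʳ addʳ (compʳ parʳ (projʳ P0 ∷ []) ∷ projʳ P1 ∷ []))

  half-ok : ∀ k → halfʳ [ k ∷ [] ]⇓ halfᴺ k
  half-ok zero = ⇓prec0 ⇓zero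
  half-ok (suc k) = ⇓precS (half-ok k)
    (⇓comp (⇓∷ (⇓comp (⇓∷ (⇓proj P0) ⇓[]) (par-ok k)) (⇓∷ (⇓proj P1) ⇓[]))
           (add-ok (parᴺ k) (halfᴺ k)))

  condʳ : Rec 3
  condʳ = precʳ (projʳ P1) (projʳ P2)

  condᴺ : ℕ → ℕ → ℕ → ℕ
  condᴺ zero b a = a
  condᴺ (suc _) b a = b

  cond-ok : ∀ p b a → condʳ [ p ∷ b ∷ a ∷ [] ]⇓ condᴺ p b a
  cond-ok zero b a = ⇓prec0 (⇓proj P1)
  cond-ok (suc p) b a = ⇓precS (cond-ok p b a) (⇓proj P2)

  χcond : ∀ p b a → condᴺ p (χ b) (χ a) ≡ χ (condB p b a)
  χcond zero b a = refl
  χcond (suc p) b a = refl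

  under-half : ∀ {A : ℕ → Bool} (e : Rec 1) → (∀ x → e [ x ∷ [] ]⇓ χ (A x)) → ∀ n →
               compʳ e (compʳ halfʳ (projʳ P0 ∷ []) ∷ []) [ n ∷ [] ]⇓ χ (A (halfᴺ n))
  under-half e ok n = ⇓comp (⇓∷ (⇓comp (⇓∷ (⇓proj P0) ⇓[]) (half-ok n)) ⇓[]) (ok (halfᴺ n))

⊕-computable : ∀ {A B} → Computable A → Computable B → Computable (A ⊕ B)
⊕-computable {A} {B} (eA , okA) (eB , okB) =
  compʳ condʳ (compʳ parʳ (projʳ P0 ∷ []) ∷ compʳ eB (compʳ halfʳ (projʳ P0 ∷ []) ∷ [])
               ∷ compʳ eA (compʳ halfʳ (projʳ P0 ∷ []) ∷ []) ∷ [])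
  , λ n → subst (λ v → _ [ n ∷ [] ]⇓ v)
      (χcond (parᴺ n) (B (halfᴺ n)) (A (halfᴺ n)))
      (⇓comp (⇓∷ (⇓comp (⇓∷ (⇓proj P0) ⇓[]) (par-ok n))
              (⇓∷ (under-half {B} eB okB n) (⇓∷ (under-half {A} eA okA n) ⇓[])))
             (cond-ok (parᴺ n) (χ (B (halfᴺ n))) (χ (A (halfᴺ n)))))

-- The structure C^pr_m (presented as a setoid: elements are computable
-- sets whose pr-m-degree is neither deg(∅) nor deg(ω); equality in the
-- structure is ≡ᵖʳₘ, order ≤ᵖʳₘ, join ⊕)

CElt : Set
CElt = Σ (ℕ → Bool) λ A → Computable A × ¬ (A ≡ᵖʳₘ ∅ˢ) × ¬ (A ≡ᵖʳₘ ωˢ)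

private
  idᵖ : PR 1
  idᵖ = projᵖ fz

  constant-left : ∀ (c : Bool) A B → (∀ n → (A ⊕ B) n ≡ c) → A ≡ᵖʳₘ (λ _ → c)
  constant-left c A B h =
    (idᵖ , λ x → trans (sym (⊕-even A B x)) (h (2 * x)))
    , (idᵖ , λ x → sym (trans (sym (⊕-even A B x)) (h (2 * x))))

  ⊕-not∅ : ∀ A B → ¬ (A ≡ᵖʳₘ ∅ˢ) → ¬ ((A ⊕ B) ≡ᵖʳₘ ∅ˢ)
  ⊕-not∅ A B nA ((f , pf) , _) = nA (constant-left false A B pf')
    where pf' : ∀ n → (A ⊕ B) n ≡ false
          pf' n = pf n

  ⊕-notω : ∀ A B → ¬ (A ≡ᵖʳₘ ωˢ) → ¬ ((A ⊕ B) ≡ᵖʳₘ ωˢ)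
  ⊕-notω A B nA ((f , pf) , _) = nA (constant-left true A B pf')
    where pf' : ∀ n → (A ⊕ B) n ≡ true
          pf' n = pf n

_≈C_ : CElt → CElt → Set
(A , _) ≈C (B , _) = A ≡ᵖʳₘ B

_≤C_ : CElt → CElt → Set
(A , _) ≤C (B , _) = A ≤ᵖʳₘ B

_∨C_ : CElt → CElt → CElt
(A , cA , nA , mA) ∨C (B , cB , _ , _) =
  (A ⊕ B) , ⊕-computable cA cB , ⊕-not∅ A B nA , ⊕-notω A B mA

data Term : Set where
  var  : ℕ → Term
  _∨ₜ_ : Term → Term → Term

data Formula : Set where
  _≐_  : Term → Term → Formula
  _≼_  : Term → Term → Formula
  ⊥ᶠ   : Formula
  _⇒_  : Formula → Formula → Formula
  ∀ᶠ   : ℕ → Formula → Formula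
-- (¬, ∧, ∨, ∃ are the usual classical abbreviations in terms of ⊥, ⇒, ∀)

_||_ : Bool → Bool → Bool
true || b = true
false || b = b

freeₜ : ℕ → Term → Bool
freeₜ x (var y) = x ≡ᵇ y
freeₜ x (t ∨ₜ s) = freeₜ x t || freeₜ x s

free : ℕ → Formula → Bool
free x (t ≐ s) = freeₜ x t || freeₜ x s
free x (t ≼ s) = freeₜ x t || freeₜ x s
free x ⊥ᶠ = false
free x (φ ⇒ ψ) = free x φ || free x ψ
free x (∀ᶠ y φ) = if x ≡ᵇ y then false else free x φ

Sentence : Formula → Set
Sentence φ = ∀ x → free x φ ≡ false

tri : ℕ → ℕ
tri zero = 0
tri (suc n) = suc n + tri n

pair : ℕ → ℕ → ℕ
pair a b = tri (a + b) + b

codeₜ : Term → ℕ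
codeₜ (var x) = pair 0 x
codeₜ (t ∨ₜ s) = pair 1 (pair (codeₜ t) (codeₜ s))

code : Formula → ℕ
code (t ≐ s) = pair 0 (pair (codeₜ t) (codeₜ s))
code (t ≼ s) = pair 1 (pair (codeₜ t) (codeₜ s))
code ⊥ᶠ = pair 2 0
code (φ ⇒ ψ) = pair 3 (pair (code φ) (code ψ))
code (∀ᶠ x φ) = pair 4 (pair x (code φ))

-- Tarskian (classical, via double negation of atoms) satisfaction in a
-- structure given by a carrier, an interpretation of =, of ≤ and of ∨.
module Semantics {D : Set} (_≈_ _≤_ : D → D → Set) (_∨_ : D → D → D) where
  ⟦_⟧ₜ : Term → (ℕ → D) → D
  ⟦ var x ⟧ₜ ρ = ρ x
  ⟦ t ∨ₜ s ⟧ₜ ρ = ⟦ t ⟧ₜ ρ ∨ ⟦ s ⟧ₜ ρ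

  _[_↦_] : (ℕ → D) → ℕ → D → (ℕ → D)
  (ρ [ x ↦ a ]) y = if y ≡ᵇ x then a else ρ y

  Sat : (ℕ → D) → Formula → Set
  Sat ρ (t ≐ s) = ¬ ¬ (⟦ t ⟧ₜ ρ ≈ ⟦ s ⟧ₜ ρ)
  Sat ρ (t ≼ s) = ¬ ¬ (⟦ t ⟧ₜ ρ ≤ ⟦ s ⟧ₜ ρ)
  Sat ρ ⊥ᶠ = ⊥
  Sat ρ (φ ⇒ ψ) = Sat ρ φ → Sat ρ ψ
  Sat ρ (∀ᶠ x φ) = (a : D) → Sat (ρ [ x ↦ a ]) φ

  Valid : Formula → Set
  Valid φ = ∀ ρ → Sat ρ φ

C⊨_ : Formula → Set
C⊨ φ = Semantics.Valid _≈C_ _≤C_ _∨C_ φ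

-- Arbitrary (nonempty) structures for the language {=, ≤, ∨}, with = as
-- true equality; used for logical consequence.
record Structure : Set₁ where
  field
    Carrier : Set
    point   : Carrier
    _≤ₛ_    : Carrier → Carrier → Set
    _∨ₛ_    : Carrier → Carrier → Carrier

_⊨_ : Structure → Formula → Set
M ⊨ φ = Semantics.Valid {Structure.Carrier M} _≡_ (Structure._≤ₛ_ M) (Structure._∨ₛ_ M) φ

IsSubtheoryOfThC : (Formula → Set) → Set₁
IsSubtheoryOfThC T =
  (∀ φ → T φ → Sentence φ × C⊨ φ)
  × (∀ φ → Sentence φ → (∀ M → (∀ ψ → T ψ → M ⊨ ψ) → M ⊨ φ) → T φ)

-- T is decidable: the set of Gödel numbers of its sentences is computable
-- (equivalently, membership of sentences in T is decided by a computable set).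
DecidableTheory : (Formula → Set) → Set
DecidableTheory T =
  Σ (ℕ → Bool) λ R → Computable R ×
    (∀ φ → Sentence φ → (T φ → R (code φ) ≡ true) × (R (code φ) ≡ true → T φ))

HereditarilyUndecidableThC : Set₁
HereditarilyUndecidableThC = ∀ T → IsSubtheoryOfThC T → ¬ DecidableTheory T

{-# OPTIONS --safe #-}

{- We build a computable sequence of bits that is generic for primitive recursive
prediction: a primitive recursive procedure that infinitely often predicts the n-th bit
from the history before stage n is right at least once.  Histories carry the running times
of the construction, so that being a history is a primitive recursive property.

The element p lists the bits h n.  Given a partition of ω into classes, q lists at n the
bit h (c n), where c n is n or the next member of the class of n, as decided by another
bit; and r lists the same bits as q, but at locations from which c n can be computed while
h (c n) cannot.  If p, q and r split compatibly into disjoint parts, then by genericity the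
splitting of p puts n and its successor on the same side, for almost all n; so it cannot
separate two members of one class, whereas it can separate different classes.  Taking
unions of residue classes modulo k, the triples (p, q, r) with one common p define
arbitrary equivalence relations on k points, by a formula that does not depend on k.

Hence a finite computation tree can be coded by parameters whose number depends on the
program only.  The sentence for a program g and an argument v says that no parameters code
a computation of g at v with a nonzero output.  If g v = 0 it holds in all structures,
since determinism is proved along the true computation; if g v = 1 it fails in the
semilattice, since the true computation tree can be coded.  A decision procedure for the
theory gives a program g that decides such sentences, and g is run on the code of its own
axioms. -}

module Submission where

open import Defs
open import Data.Nat
open import Data.Nat.Induction using (<-rec)
open import Data.Nat.Properties
open import Data.Bool using (Bool; true; false) renaming (T to True)
open import Data.Empty using (⊥; ⊥-elim)
open import Data.Fin using (Fin; toℕ) renaming (zero to fz; suc to fs)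
open import Data.List using (List; []; _∷_; _++_; length)
open import Data.List.Membership.Propositional using (_∈_)
open import Data.List.Membership.Propositional.Properties using (∈-++⁺ˡ; ∈-++⁺ʳ; ∈-++⁻)
open import Data.List.Relation.Unary.Any using (here; there)
open import Data.Product using (Σ; ∃; _×_; _,_; proj₁; proj₂)
open import Data.Sum using (_⊎_; inj₁; inj₂)
open import Data.Unit using (⊤; tt)
open import Data.Vec using (Vec; []; _∷_; lookup; toList)
open import Function using (_∘_; id; const)
open import Relation.Binary.Definitions using (tri<; tri≈; tri>)
open import Relation.Binary.PropositionalEquality
  using (_≡_; _≢_; refl; sym; trans; cong; cong₂; subst; subst₂; module ≡-Reasoning)
open import Relation.Nullary using (¬_; yes; no)

-- Genericity enters three times (`r-hard`, `linked`, `pieces-disjoint`), always in the same way: a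
-- reduction that should not exist is turned into a prediction of bits, and the prediction is
-- inverted, so that it is wrong whenever it is made. It is then made at finitely many stages only.
-- Choices and listed bits come from one sequence, staggered by one stage: a location reveals the
-- choice made at `n` but not the bit which that choice selects. Thresholds, colours and reductions
-- cannot be found effectively, so their existence is asserted under a double negation. Nothing is
-- lost: satisfaction is stable under double negation. In an arbitrary structure the parameters may
-- be meaningless, and a slot may hold no value or several. What is proved there is therefore
-- universal: each value in the slot is the right number. Self-reference takes no diagonal lemma.
-- The sentence for `g` and `v` contains the axioms of `g` as a mere antecedent, so its code is a
-- primitive recursive function of their code; and this code also bounds their variables, hence the
-- number of quantifiers that close the sentence.

module PrimitiveRecursion where

  -- Primitive recursive functions, Cantor pairing, bounded search.

  PR₁ : (ℕ → ℕ) → Set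
  PR₁ f = Σ (PR 1) λ t → ∀ x → evalPR t (x ∷ []) ≡ f x

  PR₁-ext : ∀ {f g} → PR₁ f → (∀ x → f x ≡ g x) → PR₁ g
  PR₁-ext (t , p) eq = t , λ x → trans (p x) (eq x)

  PR₁-eval : (t : PR 1) → PR₁ (λ x → evalPR t (x ∷ []))
  PR₁-eval t = t , λ _ → refl

  PR₁-id : PR₁ id
  PR₁-id = projᵖ fz , λ _ → refl

  constᵖ : ℕ → PR 1
  constᵖ zero = zeroᵖ
  constᵖ (suc c) = compᵖ succᵖ (constᵖ c ∷ [])

  PR₁-const : ∀ c → PR₁ (const c)
  PR₁-const c = constᵖ c , go c
    where
    go : ∀ c x → evalPR (constᵖ c) (x ∷ []) ≡ c
    go zero x = refl
    go (suc c) x = cong suc (go c x)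

  PR₁-∘ : ∀ {f g} → PR₁ f → PR₁ g → PR₁ (λ x → f (g x))
  PR₁-∘ {f} {g} (s , p) (t , q) =
    compᵖ s (t ∷ []) , λ x → trans (p (evalPR t (x ∷ []))) (cong f (q x))

  PR₁-suc : ∀ {f} → PR₁ f → PR₁ (λ x → suc (f x))
  PR₁-suc (t , p) = compᵖ succᵖ (t ∷ []) , λ x → cong suc (p x)

  lift₂ : ∀ {f g} (_∙_ : ℕ → ℕ → ℕ) (t : PR 2) →
          (∀ x y → evalPR t (x ∷ y ∷ []) ≡ x ∙ y) →
          PR₁ f → PR₁ g → PR₁ (λ x → f x ∙ g x)
  lift₂ _∙_ t ok (a , p) (b , q) =
    compᵖ t (a ∷ b ∷ []) , λ x → trans (ok _ _) (cong₂ _∙_ (p x) (q x))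

  addᵖ : PR 2
  addᵖ = precᵖ (projᵖ fz) (compᵖ succᵖ (projᵖ (fs fz) ∷ []))

  addᵖ-ok : ∀ x y → evalPR addᵖ (x ∷ y ∷ []) ≡ x + y
  addᵖ-ok zero y = refl
  addᵖ-ok (suc x) y = cong suc (addᵖ-ok x y)

  PR₁-+ : ∀ {f g} → PR₁ f → PR₁ g → PR₁ (λ x → f x + g x)
  PR₁-+ = lift₂ _+_ addᵖ addᵖ-ok

  natrec : ℕ → (ℕ → ℕ → ℕ) → ℕ → ℕ
  natrec a h zero = a
  natrec a h (suc k) = h k (natrec a h k)

  natrec-cong : ∀ {a h h′} → (∀ k r → h k r ≡ h′ k r) → ∀ n → natrec a h n ≡ natrec a h′ n
  natrec-cong eq zero = refl
  natrec-cong {h′ = h′} eq (suc n) = trans (eq n _) (cong (h′ n) (natrec-cong eq n))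

  predᵖ : PR 1
  predᵖ = precᵖ zeroᵖ (projᵖ fz)

  predᵖ-ok : ∀ x → evalPR predᵖ (x ∷ []) ≡ pred x
  predᵖ-ok zero = refl
  predᵖ-ok (suc x) = refl

  PR₁-pred : ∀ {f} → PR₁ f → PR₁ (λ x → pred (f x))
  PR₁-pred = PR₁-∘ {pred} (predᵖ , predᵖ-ok)

  monusᵖ : PR 2
  monusᵖ = precᵖ (projᵖ fz) (compᵖ predᵖ (projᵖ (fs fz) ∷ []))

  monusᵖ-ok : ∀ y x → evalPR monusᵖ (y ∷ x ∷ []) ≡ x ∸ y
  monusᵖ-ok zero x = refl
  monusᵖ-ok (suc y) x =
    trans (predᵖ-ok (evalPR monusᵖ (y ∷ x ∷ [])))
          (trans (cong pred (monusᵖ-ok y x)) (pred[m∸n]≡m∸[1+n] x y))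

  PR₁-∸ : ∀ {f g} → PR₁ f → PR₁ g → PR₁ (λ x → f x ∸ g x)
  PR₁-∸ F G = lift₂ (λ y x → x ∸ y) monusᵖ monusᵖ-ok G F

  triᵖ : PR 1
  triᵖ = precᵖ zeroᵖ (compᵖ addᵖ (compᵖ succᵖ (projᵖ fz ∷ []) ∷ projᵖ (fs fz) ∷ []))

  triᵖ-ok : ∀ x → evalPR triᵖ (x ∷ []) ≡ tri x
  triᵖ-ok zero = refl
  triᵖ-ok (suc x) = trans (addᵖ-ok (suc x) _) (cong (suc x +_) (triᵖ-ok x))

  PR₁-tri : ∀ {f} → PR₁ f → PR₁ (λ x → tri (f x))
  PR₁-tri = PR₁-∘ {tri} (triᵖ , triᵖ-ok)

  PR₁-pair : ∀ {f g} → PR₁ f → PR₁ g → PR₁ (λ x → pair (f x) (g x))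
  PR₁-pair F G = PR₁-+ (PR₁-tri (PR₁-+ F G)) G

  ifz : ℕ → ℕ → ℕ → ℕ
  ifz zero a b = a
  ifz (suc _) a b = b

  ifzᵖ : PR 3
  ifzᵖ = precᵖ (projᵖ fz) (projᵖ (fs (fs (fs fz))))

  PR₁-ifz : ∀ {c f g} → PR₁ c → PR₁ f → PR₁ g → PR₁ (λ x → ifz (c x) (f x) (g x))
  PR₁-ifz {c} {f} {g} (r , o) (s , p) (t , q) =
    compᵖ ifzᵖ (r ∷ s ∷ t ∷ []) , λ x →
      trans (ok (evalPR r (x ∷ [])) _ _) (trans (cong₂ (ifz (evalPR r (x ∷ []))) (p x) (q x))
        (cong (λ c → ifz c (f x) (g x)) (o x)))
    where
    ok : ∀ c a b → evalPR ifzᵖ (c ∷ a ∷ b ∷ []) ≡ ifz c a b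
    ok zero a b = refl
    ok (suc c) a b = refl

  -- The diagonal on which `n` lies in the Cantor pairing, that is the largest `w` with `tri w ≤ n`.
  -- It grows by at most one from `n` to `suc n`, which makes it a primitive recursion.
  root : ℕ → ℕ
  root = natrec 0 λ n w → ifz (tri (suc w) ∸ suc n) (suc w) w

  ifz-zero : ∀ {c} a b → c ≡ 0 → ifz c a b ≡ a
  ifz-zero a b refl = refl

  ifz-nonzero : ∀ {c} a b → c ≢ 0 → ifz c a b ≡ b
  ifz-nonzero {zero} a b c≢0 = ⊥-elim (c≢0 refl)
  ifz-nonzero {suc c} a b _ = refl

  root-bounds : ∀ n → tri (root n) ≤ n × n < tri (suc (root n))
  root-bounds zero = z≤n , s≤s z≤n
  root-bounds (suc n) with root-bounds n | tri (suc (root n)) ≤? suc n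
  ... | lo , hi | yes p rewrite ifz-zero (suc (root n)) (root n) (m≤n⇒m∸n≡0 p) =
    p , s≤s (≤-trans hi (m≤n+m (suc (root n) + tri (root n)) (suc (root n))))
  ... | lo , hi | no ¬p rewrite ifz-nonzero (suc (root n)) (root n) (m>n⇒m∸n≢0 (≰⇒> ¬p)) =
    m≤n⇒m≤1+n lo , ≰⇒> ¬p

  tri-mono : ∀ {a b} → a ≤ b → tri a ≤ tri b
  tri-mono z≤n = z≤n
  tri-mono (s≤s p) = +-mono-≤ (s≤s p) (tri-mono p)

  root-unique : ∀ {n w} → tri w ≤ n → n < tri (suc w) → root n ≡ w
  root-unique {n} {w} lo hi with root-bounds n
  ... | lo′ , hi′ = ≤-antisym
    (≮⇒≥ λ w<r → <-irrefl refl (<-≤-trans hi (≤-trans (tri-mono w<r) lo′)))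
    (≮⇒≥ λ r<w → <-irrefl refl (<-≤-trans hi′ (≤-trans (tri-mono r<w) lo)))

  root-pair : ∀ a b → root (pair a b) ≡ a + b
  root-pair a b = root-unique (m≤m+n _ b)
    (subst (suc (tri (a + b) + b) ≤_) (+-comm (tri (a + b)) (suc (a + b)))
      (subst (_≤ tri (a + b) + suc (a + b)) (+-suc (tri (a + b)) b)
        (+-monoʳ-≤ (tri (a + b)) (s≤s (m≤n+m b a)))))

  π₂-of-pair : ∀ a b → pair a b ∸ tri (root (pair a b)) ≡ b
  π₂-of-pair a b rewrite root-pair a b = m+n∸m≡n (tri (a + b)) b

  tri-≥ : ∀ n → n ≤ tri n
  tri-≥ zero = z≤n
  tri-≥ (suc n) = m≤m+n (suc n) (tri n)

  remainder≤root : ∀ n → n ∸ tri (root n) ≤ root n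
  remainder≤root n = ≤-pred (+-cancelˡ-≤ (tri (root n)) _ _
    (subst (tri (root n) + suc (n ∸ tri (root n)) ≤_) (+-comm (suc (root n)) (tri (root n)))
      (subst (_≤ tri (suc (root n))) (sym (trans (+-suc (tri (root n)) (n ∸ tri (root n)))
        (cong suc (m+[n∸m]≡n (proj₁ (root-bounds n)))))) (proj₂ (root-bounds n)))))

  -- The pairing is made opaque: unfolding pair on numerals blows up.
  abstract
    cantor : ℕ → ℕ → ℕ
    cantor a b = pair a b

    cantor≡pair : ∀ a b → cantor a b ≡ pair a b
    cantor≡pair a b = refl

    π₂ : ℕ → ℕ
    π₂ n = n ∸ tri (root n)

    π₁ : ℕ → ℕ
    π₁ n = root n ∸ π₂ n

    π₂-pair : ∀ a b → π₂ (cantor a b) ≡ b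
    π₂-pair = π₂-of-pair

    π₁-pair : ∀ a b → π₁ (cantor a b) ≡ a
    π₁-pair a b = trans (cong₂ _∸_ (root-pair a b) (π₂-pair a b)) (m+n∸n≡m a b)

    pair-≥ˡ : ∀ a b → a ≤ (cantor a b)
    pair-≥ˡ a b = ≤-trans (m≤m+n a b) (≤-trans (tri-≥ (a + b)) (m≤m+n _ b))

    pair-<ʳ : ∀ a b → b < (cantor (suc a) b)
    pair-<ʳ a b = s≤s (m≤n+m b _)

    π₂-≤ : ∀ n → π₂ n ≤ n
    π₂-≤ n = m∸n≤m n (tri (root n))

    π₁-≤ : ∀ n → π₁ n ≤ n
    π₁-≤ n = ≤-trans (m∸n≤m (root n) (π₂ n)) (≤-trans (tri-≥ (root n)) (proj₁ (root-bounds n)))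

    pair-π : ∀ n → (cantor (π₁ n) (π₂ n)) ≡ n
    pair-π n = trans (cong (λ w → tri w + π₂ n) (m∸n+n≡m (remainder≤root n)))
                     (m+[n∸m]≡n (proj₁ (root-bounds n)))

  rootᵖ-step : PR 2
  rootᵖ-step =
    compᵖ ifzᵖ (compᵖ monusᵖ (compᵖ succᵖ (projᵖ fz ∷ [])
                             ∷ compᵖ triᵖ (compᵖ succᵖ (projᵖ (fs fz) ∷ []) ∷ []) ∷ [])
               ∷ compᵖ succᵖ (projᵖ (fs fz) ∷ []) ∷ projᵖ (fs fz) ∷ [])

  PR₁-root : PR₁ root
  PR₁-root = precᵖ zeroᵖ rootᵖ-step , ok
    where
    step-ok : ∀ n w → evalPR rootᵖ-step (n ∷ w ∷ []) ≡ ifz (tri (suc w) ∸ suc n) (suc w) w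
    step-ok n w rewrite triᵖ-ok (suc w) | monusᵖ-ok (suc n) (tri (suc w))
      with tri (suc w) ∸ suc n
    ... | zero = refl
    ... | suc _ = refl
    ok : ∀ n → evalPrec zeroᵖ rootᵖ-step n [] ≡ root n
    ok zero = refl
    ok (suc n) = trans (step-ok n _) (cong (λ w → ifz (tri (suc w) ∸ suc n) (suc w) w) (ok n))

  abstract
    PR₁-cantor : ∀ {f g} → PR₁ f → PR₁ g → PR₁ (λ x → (cantor (f x) (g x)))
    PR₁-cantor = PR₁-pair

    PR₁-π₂ : ∀ {f} → PR₁ f → PR₁ (λ x → π₂ (f x))
    PR₁-π₂ = PR₁-∘ {π₂} (PR₁-∸ PR₁-id (PR₁-tri PR₁-root))

    PR₁-π₁ : ∀ {f} → PR₁ f → PR₁ (λ x → π₁ (f x))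
    PR₁-π₁ = PR₁-∘ {π₁} (PR₁-∸ PR₁-root (PR₁-π₂ PR₁-id))

  pairᵖ : PR 2
  pairᵖ = compᵖ addᵖ (compᵖ triᵖ (addᵖ ∷ []) ∷ projᵖ (fs fz) ∷ [])

  pairᵖ-ok : ∀ x y → evalPR pairᵖ (x ∷ y ∷ []) ≡ (cantor x y)
  pairᵖ-ok x y = trans (addᵖ-ok (evalPR triᵖ (evalPR addᵖ (x ∷ y ∷ []) ∷ [])) y)
    (trans (cong (_+ y) (trans (triᵖ-ok (evalPR addᵖ (x ∷ y ∷ []))) (cong tri (addᵖ-ok x y))))
           (sym (cantor≡pair x y)))

  fstᴾ : PR₁ π₁
  fstᴾ = PR₁-π₁ PR₁-id

  sndᴾ : PR₁ π₂
  sndᴾ = PR₁-π₂ PR₁-id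

  PR₂ : (ℕ → ℕ → ℕ) → Set
  PR₂ f = PR₁ (λ z → f (π₁ z) (π₂ z))

  PR₂-app : ∀ {f a b} → PR₂ f → PR₁ a → PR₁ b → PR₁ (λ x → f (a x) (b x))
  PR₂-app {f} {a} {b} F A B = PR₁-ext (PR₁-∘ F (PR₁-cantor A B))
    λ x → cong₂ f (π₁-pair (a x) (b x)) (π₂-pair (a x) (b x))

  -- The step may depend on the outer argument `x`; since only unary functions are handled, it
  -- receives its three arguments as `cantor (cantor k r) x`.
  PR₁-natrec : ∀ {a n} {h : ℕ → ℕ → ℕ → ℕ} → PR₁ a → PR₁ n →
               PR₁ (λ z → h (π₁ (π₁ z)) (π₂ (π₁ z)) (π₂ z)) →
               PR₁ (λ x → natrec (a x) (λ k r → h k r x) (n x))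
  PR₁-natrec {a} {n} {h} (s , p) (t , q) H@(u , o) =
    compᵖ rec′ (t ∷ projᵖ fz ∷ []) ,
    λ x → trans (ok (evalPR t (x ∷ [])) x) (cong (natrec (a x) (λ k r → h k r x)) (q x))
    where
    step : PR 3
    step = compᵖ u (compᵖ pairᵖ (compᵖ pairᵖ (projᵖ fz ∷ projᵖ (fs fz) ∷ []) ∷ projᵖ (fs (fs fz)) ∷ []) ∷ [])
    step-ok : ∀ k r x → evalPR step (k ∷ r ∷ x ∷ []) ≡ h k r x
    step-ok k r x
      rewrite pairᵖ-ok k r | pairᵖ-ok (cantor k r) x | o (cantor (cantor k r) x)
            | π₁-pair (cantor k r) x | π₂-pair (cantor k r) x | π₁-pair k r | π₂-pair k r = refl
    rec′ : PR 2
    rec′ = precᵖ s step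
    ok : ∀ m x → evalPR rec′ (m ∷ x ∷ []) ≡ natrec (a x) (λ k r → h k r x) m
    ok zero x = p x
    ok (suc m) x = trans (step-ok m (evalPrec s step m (x ∷ [])) x) (cong (λ r → h m r x) (ok m x))

  iter : (ℕ → ℕ) → ℕ → ℕ → ℕ
  iter f zero x = x
  iter f (suc n) x = f (iter f n x)

  iter-+ : ∀ f m n x → iter f (m + n) x ≡ iter f m (iter f n x)
  iter-+ f zero n x = refl
  iter-+ f (suc m) n x = cong f (iter-+ f m n x)

  iter-comm : ∀ f n x → iter f n (f x) ≡ f (iter f n x)
  iter-comm f zero x = refl
  iter-comm f (suc n) x = cong f (iter-comm f n x)

  PR₁-iter : ∀ {f n a} → PR₁ f → PR₁ n → PR₁ a → PR₁ (λ x → iter f (n x) (a x))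
  PR₁-iter {f} {n} {a} F N A =
    PR₁-ext (PR₁-natrec {h = λ _ r _ → f r} A N (PR₁-∘ F (PR₁-π₂ (PR₁-π₁ PR₁-id)))) λ x → go x (n x)
    where
    go : ∀ x m → natrec (a x) (λ _ → f) m ≡ iter f m (a x)
    go x zero = refl
    go x (suc m) = cong f (go x m)

  -- Failure is 0 and the least witness `e` is reported as `suc e`, so that the result can itself be
  -- used as a truth value.
  data Search (f : ℕ → ℕ) (n : ℕ) : ℕ → Set where
    none  : (∀ e → e < n → f e ≡ 0) → Search f n 0
    found : ∀ e → e < n → f e ≢ 0 → (∀ e′ → e′ < e → f e′ ≡ 0) → Search f n (suc e)

  abstract
    search : (ℕ → ℕ) → ℕ → ℕ
    search f = natrec 0 λ k r → ifz r (ifz (f k) 0 (suc k)) r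

    PR₁-search : ∀ {n} {f : ℕ → ℕ → ℕ} → PR₁ n → PR₂ f → PR₁ (λ x → search (λ e → f e x) (n x))
    PR₁-search {n} {f} N F =
      PR₁-natrec {h = λ k r x → ifz r (ifz (f k x) 0 (suc k)) r} (PR₁-const 0) N
        (PR₁-ifz R (PR₁-ifz (PR₂-app {f} F K (PR₁-π₂ PR₁-id)) (PR₁-const 0) (PR₁-suc K)) R)
      where
      K : PR₁ (λ z → π₁ (π₁ z))
      K = PR₁-π₁ fstᴾ
      R : PR₁ (λ z → π₂ (π₁ z))
      R = PR₁-π₂ fstᴾ

    search-spec : ∀ f n → Search f n (search f n)
    search-spec f zero = none λ _ ()
    search-spec f (suc n) with search f n | search-spec f n
    ... | .(suc e) | found e e<n fe min = found e (m≤n⇒m≤1+n e<n) fe min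
    ... | .0 | none p with f n in eq
    ...   | suc m = found n ≤-refl (λ fn → 1+n≢0 (trans (sym eq) fn)) p
    ...   | zero = none λ e e<sn → go e (m≤n⇒m<n∨m≡n (≤-pred e<sn))
      where
      go : ∀ e → e < n ⊎ e ≡ n → f e ≡ 0
      go e (inj₁ e<n) = p e e<n
      go .n (inj₂ refl) = eq

  search-found : ∀ f n e → e < n → f e ≢ 0 → (∀ e′ → e′ < e → f e′ ≡ 0) → search f n ≡ suc e
  search-found f n e e<n fe min with search f n | search-spec f n
  ... | _ | none p = ⊥-elim (fe (p e e<n))
  ... | _ | found d d<n fd min′ with <-cmp d e
  ...   | tri< d<e _ _ = ⊥-elim (fd (min d d<e))
  ...   | tri≈ _ refl _ = refl
  ...   | tri> _ _ e<d = ⊥-elim (fe (min′ e e<d))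

  search-none : ∀ f n → search f n ≡ 0 → ∀ e → e < n → f e ≡ 0
  search-none f n eq with search f n | search-spec f n
  search-none f n refl | _ | none p = p

  search-some : ∀ f n {e} → search f n ≡ suc e → e < n × f e ≢ 0 × (∀ e′ → e′ < e → f e′ ≡ 0)
  search-some f n eq with search f n | search-spec f n
  search-some f n refl | _ | found e a b c = a , b , c

  search-hit : ∀ f n {e} → e < n → f e ≢ 0 → search f n ≢ 0
  search-hit f n e<n fe eq = fe (search-none f n eq _ e<n)

  -- Characteristic functions: a number stands for "true" iff it is nonzero

  neq : ℕ → ℕ → ℕ
  neq a b = (a ∸ b) + (b ∸ a)

  not : ℕ → ℕ
  not a = ifz a 1 0

  eq : ℕ → ℕ → ℕ
  eq a b = not (neq a b)

  PR₁-neq : ∀ {f g} → PR₁ f → PR₁ g → PR₁ (λ x → neq (f x) (g x))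
  PR₁-neq F G = PR₁-+ (PR₁-∸ F G) (PR₁-∸ G F)

  PR₁-not : ∀ {f} → PR₁ f → PR₁ (λ x → not (f x))
  PR₁-not F = PR₁-ifz F (PR₁-const 1) (PR₁-const 0)

  not-zero : ∀ {a} → a ≡ 0 → not a ≢ 0
  not-zero refl ()

  not-true : ∀ {a} → not a ≢ 0 → a ≡ 0
  not-true {zero} _ = refl
  not-true {suc a} p = ⊥-elim (p refl)

  PR₁-eq : ∀ {f g} → PR₁ f → PR₁ g → PR₁ (λ x → eq (f x) (g x))
  PR₁-eq F G = PR₁-not (PR₁-neq F G)

  and : ℕ → ℕ → ℕ
  and a b = ifz a 0 b

  PR₁-and : ∀ {f g} → PR₁ f → PR₁ g → PR₁ (λ x → and (f x) (g x))
  PR₁-and F G = PR₁-ifz F (PR₁-const 0) G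

  neq-refl : ∀ a → neq a a ≡ 0
  neq-refl a = cong₂ _+_ (n∸n≡0 a) (n∸n≡0 a)

  neq-zero : ∀ {a b} → neq a b ≡ 0 → a ≡ b
  neq-zero {a} {b} p = ≤-antisym (m∸n≡0⇒m≤n (m+n≡0⇒m≡0 (a ∸ b) p)) (m∸n≡0⇒m≤n (m+n≡0⇒n≡0 (a ∸ b) p))

  eq-refl : ∀ a → eq a a ≡ 1
  eq-refl a rewrite neq-refl a = refl

  eq-true : ∀ {a b} → eq a b ≢ 0 → a ≡ b
  eq-true {a} {b} p with neq a b in q
  ... | zero = neq-zero q
  ... | suc _ = ⊥-elim (p refl)

  eq-false : ∀ {a b} → a ≢ b → eq a b ≡ 0
  eq-false {a} {b} p with neq a b in q
  ... | zero = ⊥-elim (p (neq-zero q))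
  ... | suc _ = refl

  and-true : ∀ {a b} → and a b ≢ 0 → a ≢ 0 × b ≢ 0
  and-true {zero} p = ⊥-elim (p refl)
  and-true {suc a} p = (λ ()) , p

  and-intro : ∀ {a b} → a ≢ 0 → b ≢ 0 → and a b ≢ 0
  and-intro {zero} p q = ⊥-elim (p refl)
  and-intro {suc a} p q = q

  nz : ℕ → Bool
  nz zero = false
  nz (suc _) = true

  true-nz : ∀ {a} → a ≢ 0 → nz a ≡ true
  true-nz {zero} p = ⊥-elim (p refl)
  true-nz {suc a} _ = refl

  zero? : ∀ a → (a ≡ 0) ⊎ (a ≢ 0)
  zero? zero = inj₁ refl
  zero? (suc a) = inj₂ λ ()

  not-nz : ∀ a → nz (not a) ≢ nz a
  not-nz zero ()
  not-nz (suc a) ()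

  table : ℕ → (ℕ → ℕ) → ℕ → ℕ
  table zero t n = 0
  table (suc k) t n = ifz n (t 0) (table k (t ∘ suc) (pred n))

  -- Finitely many values can be written into a program, whatever `t` is. This later makes every
  -- function of the colours primitive recursive.
  PR₁-table : ∀ k t → PR₁ (table k t)
  PR₁-table zero t = PR₁-const 0
  PR₁-table (suc k) t =
    PR₁-ifz PR₁-id (PR₁-const (t 0)) (PR₁-∘ (PR₁-table k (t ∘ suc)) (PR₁-pred PR₁-id))

  table-< : ∀ k t {n} → n < k → table k t n ≡ t n
  table-< (suc k) t {zero} _ = refl
  table-< (suc k) t {suc n} (s≤s p) = table-< k (t ∘ suc) p

-- Computable functions and a universal machine for primitive recursion.

module Machine where

  open PrimitiveRecursion

  mutual
    emb : ∀ {n} → PR n → Rec n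
    emb zeroᵖ = zeroʳ
    emb succᵖ = succʳ
    emb (projᵖ i) = projʳ i
    emb (compᵖ f gs) = compʳ (emb f) (embs gs)
    emb (precᵖ g h) = precʳ (emb g) (emb h)

    embs : ∀ {n m} → Vec (PR n) m → Vec (Rec n) m
    embs [] = []
    embs (g ∷ gs) = emb g ∷ embs gs

  mutual
    emb-⇓ : ∀ {n} (f : PR n) xs → emb f [ xs ]⇓ evalPR f xs
    emb-⇓ zeroᵖ xs = ⇓zero
    emb-⇓ succᵖ (x ∷ []) = ⇓succ
    emb-⇓ (projᵖ i) xs = ⇓proj i
    emb-⇓ (compᵖ f gs) xs = ⇓comp (embs-⇓ gs xs) (emb-⇓ f (evalPRs gs xs))
    emb-⇓ (precᵖ g h) (k ∷ xs) = emb-prec-⇓ g h k xs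

    embs-⇓ : ∀ {n m} (gs : Vec (PR n) m) xs → embs gs [ xs ]⇓* evalPRs gs xs
    embs-⇓ [] xs = ⇓[]
    embs-⇓ (g ∷ gs) xs = ⇓∷ (emb-⇓ g xs) (embs-⇓ gs xs)

    emb-prec-⇓ : ∀ {n} (g : PR n) h k xs → precʳ (emb g) (emb h) [ k ∷ xs ]⇓ evalPrec g h k xs
    emb-prec-⇓ g h zero xs = ⇓prec0 (emb-⇓ g xs)
    emb-prec-⇓ g h (suc k) xs = ⇓precS (emb-prec-⇓ g h k xs) (emb-⇓ h (k ∷ evalPrec g h k xs ∷ xs))

  Rec₁ : (ℕ → ℕ) → Set
  Rec₁ f = Σ (Rec 1) λ e → ∀ x → e [ x ∷ [] ]⇓ f x

  Rec₁-PR : ∀ {f} → PR₁ f → Rec₁ f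
  Rec₁-PR (t , ok) = emb t , λ x → subst (emb t [ x ∷ [] ]⇓_) (ok x) (emb-⇓ t (x ∷ []))

  Rec₁-∘ : ∀ {f g} → Rec₁ f → Rec₁ g → Rec₁ (λ x → f (g x))
  Rec₁-∘ {f} {g} (s , p) (t , q) = compʳ s (t ∷ []) , λ x → ⇓comp (⇓∷ (q x) ⇓[]) (p (g x))

  pair-⇓ : ∀ x y → emb pairᵖ [ x ∷ y ∷ [] ]⇓ cantor x y
  pair-⇓ x y = subst (emb pairᵖ [ x ∷ y ∷ [] ]⇓_) (pairᵖ-ok x y) (emb-⇓ pairᵖ (x ∷ y ∷ []))

  Rec₁-cantor : ∀ {f g} → Rec₁ f → Rec₁ g → Rec₁ (λ x → cantor (f x) (g x))
  Rec₁-cantor {f} {g} (s , p) (t , q) =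
    compʳ (emb pairᵖ) (s ∷ t ∷ []) , λ x → ⇓comp (⇓∷ (p x) (⇓∷ (q x) ⇓[])) (pair-⇓ (f x) (g x))

  Rec₁-ext : ∀ {f g} → Rec₁ f → (∀ x → f x ≡ g x) → Rec₁ g
  Rec₁-ext (e , p) eq = e , λ x → subst (e [ x ∷ [] ]⇓_) (eq x) (p x)

  Rec₁-PR₂ : ∀ {f a b} → PR₂ f → Rec₁ a → Rec₁ b → Rec₁ (λ x → f (a x) (b x))
  Rec₁-PR₂ {f} {a} {b} F A B = Rec₁-ext (Rec₁-∘ (Rec₁-PR F) (Rec₁-cantor A B))
    λ x → cong₂ f (π₁-pair (a x) (b x)) (π₂-pair (a x) (b x))

  Rec₁-iter : ∀ {f} → Rec₁ f → Rec₁ (λ n → iter f n 0)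
  Rec₁-iter {f} (s , p) = precʳ zeroʳ (compʳ s (projʳ (fs fz) ∷ [])) , go
    where
    go : ∀ n → precʳ zeroʳ (compʳ s (projʳ (fs fz) ∷ [])) [ n ∷ [] ]⇓ iter f n 0
    go zero = ⇓prec0 ⇓zero
    go (suc n) = ⇓precS (go n) (⇓comp (⇓∷ (⇓proj (fs fz)) ⇓[]) (p (iter f n 0)))

  -- Here computability goes beyond primitive recursion; the search will be for the halting times of
  -- the construction.
  Rec₁-mu : ∀ {c : ℕ → ℕ → ℕ} {f} → PR₂ c → (∀ x → c (f x) x ≡ 0) →
            (∀ x z → z < f x → c z x ≢ 0) → Rec₁ f
  Rec₁-mu {c} {f} (t , ok) zer min =
    muʳ (compʳ (emb t) (emb pairᵖ ∷ [])) , λ x →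
      ⇓mu (subst (_ [ f x ∷ x ∷ [] ]⇓_) (zer x) (run (f x) x))
          (λ z z< → pred (c z x) , subst (_ [ z ∷ x ∷ [] ]⇓_) (sym (suc-pred (c z x) {{≢-nonZero (min x z z<)}})) (run z x))
    where
    run : ∀ z x → compʳ (emb t) (emb pairᵖ ∷ []) [ z ∷ x ∷ [] ]⇓ c z x
    run z x = ⇓comp (⇓∷ (pair-⇓ z x) ⇓[])
      (subst (emb t [ cantor z x ∷ [] ]⇓_) (trans (ok (cantor z x)) (cong₂ c (π₁-pair z x) (π₂-pair z x)))
        (emb-⇓ t (cantor z x ∷ [])))

  -- A universal machine for primitive recursion: a configuration is a pair of a
  -- stack of instructions and a register.  Instruction cantor t p has operand p and
  --   t = 0 zero, 1 successor, 2 and 3 projections, 4 composition, 5 pairing,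
  --   6 and 7 the two continuations of a pairing, t ≥ 8 iteration.

  push : ℕ → ℕ → ℕ
  push i S = suc (cantor i S)

  exec : ℕ → ℕ → ℕ → ℕ → ℕ
  exec t p S x =
    ifz t (cantor S 0)
    (ifz (pred t) (cantor S (suc x))
    (ifz (pred (pred t)) (cantor S (π₁ x))
    (ifz (pred (pred (pred t))) (cantor S (π₂ x))
    (ifz (pred (pred (pred (pred t)))) (cantor (push (π₂ p) (push (π₁ p) S)) x)
    (ifz (pred (pred (pred (pred (pred t))))) (cantor (push (π₁ p) (push (cantor 6 (cantor (π₂ p) x)) S)) x)
    (ifz (pred (pred (pred (pred (pred (pred t)))))) (cantor (push (π₁ p) (push (cantor 7 x) S)) (π₂ p))
    (ifz (pred (pred (pred (pred (pred (pred (pred t))))))) (cantor S (cantor p x))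
    (ifz (π₁ x) (cantor S (π₂ x))
         (cantor (push p (push (cantor 7 (pred (π₁ x))) (push (cantor 8 p) S))) (π₂ x))))))))))

  top rest : ℕ → ℕ
  top c = π₁ (pred (π₁ c))
  rest c = π₂ (pred (π₁ c))

  step : ℕ → ℕ
  step c = ifz (π₁ c) c (exec (π₁ (top c)) (π₂ (top c)) (rest c) (π₂ c))

  PR₁-push : ∀ {f g} → PR₁ f → PR₁ g → PR₁ (λ x → push (f x) (g x))
  PR₁-push F G = PR₁-suc (PR₁-cantor F G)

  PR₁-exec : ∀ {t p S x} → PR₁ t → PR₁ p → PR₁ S → PR₁ x → PR₁ (λ c → exec (t c) (p c) (S c) (x c))
  PR₁-exec T P S X =
    PR₁-ifz T (PR₁-cantor S (PR₁-const 0))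
    (PR₁-ifz T₁ (PR₁-cantor S (PR₁-suc X))
    (PR₁-ifz T₂ (PR₁-cantor S (PR₁-π₁ X))
    (PR₁-ifz T₃ (PR₁-cantor S (PR₁-π₂ X))
    (PR₁-ifz T₄ (PR₁-cantor (PR₁-push (PR₁-π₂ P) (PR₁-push (PR₁-π₁ P) S)) X)
    (PR₁-ifz T₅ (PR₁-cantor (PR₁-push (PR₁-π₁ P) (PR₁-push (PR₁-cantor (PR₁-const 6) (PR₁-cantor (PR₁-π₂ P) X)) S)) X)
    (PR₁-ifz T₆ (PR₁-cantor (PR₁-push (PR₁-π₁ P) (PR₁-push (PR₁-cantor (PR₁-const 7) X) S)) (PR₁-π₂ P))
    (PR₁-ifz T₇ (PR₁-cantor S (PR₁-cantor P X))
    (PR₁-ifz (PR₁-π₁ X) (PR₁-cantor S (PR₁-π₂ X))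
      (PR₁-cantor (PR₁-push P (PR₁-push (PR₁-cantor (PR₁-const 7) (PR₁-pred (PR₁-π₁ X)))
                            (PR₁-push (PR₁-cantor (PR₁-const 8) P) S))) (PR₁-π₂ X))))))))))
    where
    T₁ = PR₁-pred T
    T₂ = PR₁-pred T₁
    T₃ = PR₁-pred T₂
    T₄ = PR₁-pred T₃
    T₅ = PR₁-pred T₄
    T₆ = PR₁-pred T₅
    T₇ = PR₁-pred T₆

  PR₁-step : PR₁ step
  PR₁-step = PR₁-ifz Stack PR₁-id
    (PR₁-exec (PR₁-π₁ Top) (PR₁-π₂ Top) (PR₁-π₂ (PR₁-pred Stack)) (PR₁-π₂ PR₁-id))
    where
    Stack = PR₁-π₁ PR₁-id
    Top = PR₁-π₁ (PR₁-pred Stack)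

  step-push : ∀ t p S x → step (cantor (push (cantor t p) S) x) ≡ exec t p S x
  step-push t p S x
    rewrite π₁-pair (push (cantor t p) S) x | π₂-pair (push (cantor t p) S) x
          | π₁-pair (cantor t p) S | π₂-pair (cantor t p) S | π₁-pair t p | π₂-pair t p = refl

  _⟿_ : ℕ → ℕ → Set
  c ⟿ d = Σ ℕ λ T → iter step T c ≡ d

  ⟿-trans : ∀ {a b c} → a ⟿ b → b ⟿ c → a ⟿ c
  ⟿-trans (m , refl) (n , refl) = n + m , iter-+ step n m _

  ⟿-refl : ∀ {a b} → a ≡ b → a ⟿ b
  ⟿-refl eq = 0 , eq

  -- The stack `S` below the instruction is arbitrary and comes back untouched, which is what lets
  -- runs be composed.
  Runs : ℕ → ℕ → ℕ → Set
  Runs i x y = ∀ S → cantor (push i S) x ⟿ cantor S y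

  runs-step : ∀ {t p x y} → (∀ S → exec t p S x ⟿ cantor S y) → Runs (cantor t p) x y
  runs-step {t} {p} {x} r S = ⟿-trans (1 , step-push t p S x) (r S)

  compⁱ pairⁱ : ℕ → ℕ → ℕ
  compⁱ f g = cantor 4 (cantor f g)
  pairⁱ f g = cantor 5 (cantor f g)

  zeroⁱ sucⁱ π₁ⁱ π₂ⁱ : ℕ
  zeroⁱ = cantor 0 0
  sucⁱ = cantor 1 0
  π₁ⁱ = cantor 2 0
  π₂ⁱ = cantor 3 0

  runs-zero : ∀ {x} → Runs zeroⁱ x 0
  runs-zero {x} = runs-step {0} {0} λ S → ⟿-refl refl

  runs-suc : ∀ {x} → Runs sucⁱ x (suc x)
  runs-suc {x} = runs-step {1} {0} λ S → ⟿-refl refl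

  runs-π₁ : ∀ {x} → Runs π₁ⁱ x (π₁ x)
  runs-π₁ {x} = runs-step {2} {0} λ S → ⟿-refl refl

  runs-π₂ : ∀ {x} → Runs π₂ⁱ x (π₂ x)
  runs-π₂ {x} = runs-step {3} {0} λ S → ⟿-refl refl

  runs-4 : ∀ {p x y z} → Runs (π₂ p) x y → Runs (π₁ p) y z → Runs (cantor 4 p) x z
  runs-4 {p} G F = runs-step {4} {p} λ S → ⟿-trans (G (push (π₁ p) S)) (F S)

  runs-6 : ∀ {p x y} → Runs (π₁ p) (π₂ p) y → Runs (cantor 6 p) x (cantor x y)
  runs-6 {p} {x} G = runs-step {6} {p} λ S → ⟿-trans (G (push (cantor 7 x) S)) (1 , step-push 7 x S _)

  runs-5 : ∀ {p x y z} → Runs (π₁ p) x y → Runs (π₂ p) x z → Runs (cantor 5 p) x (cantor y z)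
  runs-5 {p} {x} {y} {z} F G = runs-step {5} {p} λ S →
    ⟿-trans (F (push (cantor 6 (cantor (π₂ p) x)) S))
      (runs-6 {cantor (π₂ p) x} (subst₂ (λ g a → Runs g a z) (sym (π₁-pair (π₂ p) x)) (sym (π₂-pair (π₂ p) x)) G) S)

  runs-comp : ∀ {f g x y z} → Runs g x y → Runs f y z → Runs (compⁱ f g) x z
  runs-comp {f} {g} {x} {y} {z} G F =
    runs-4 (subst (λ g → Runs g x y) (sym (π₂-pair f g)) G) (subst (λ f → Runs f y z) (sym (π₁-pair f g)) F)

  runs-pair : ∀ {f g x y z} → Runs f x y → Runs g x z → Runs (pairⁱ f g) x (cantor y z)
  runs-pair {f} {g} {x} {y} {z} F G =
    runs-5 (subst (λ f → Runs f x y) (sym (π₁-pair f g)) F) (subst (λ g → Runs g x z) (sym (π₂-pair f g)) G)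

  -- The body need only be understood along one orbit, the trace `s`. So the lemma serves both for
  -- compiled programs and for `runs-total`, where the orbit is found step by step.
  runs-iter : ∀ {f t} (s : ℕ → ℕ) → (∀ j → Runs f (s j) (s (suc j))) →
              ∀ k j → Runs (cantor (8 + t) f) (cantor k (s j)) (s (k + j))
  runs-iter {f} {t} s F zero j = runs-step {8 + t} {f} λ S → ⟿-refl done
    where
    done : ∀ {S} → exec (8 + t) f S (cantor 0 (s j)) ≡ cantor S (s j)
    done rewrite π₁-pair 0 (s j) | π₂-pair 0 (s j) = refl
  runs-iter {f} {t} s F (suc k) j = runs-step {8 + t} {f} λ S →
    ⟿-trans (⟿-refl unfold) (⟿-trans (F j (push (cantor 7 k) (push (cantor 8 f) S)))
      (⟿-trans (1 , step-push 7 k (push (cantor 8 f) S) _)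
        (subst (λ m → cantor (push (cantor 8 f) S) (cantor k (s (suc j))) ⟿ cantor S (s m)) (+-suc k j) (runs-iter {f} {0} s F k (suc j) S))))
    where
    unfold : ∀ {S} → exec (8 + t) f S (cantor (suc k) (s j))
                     ≡ cantor (push f (push (cantor 7 k) (push (cantor 8 f) S))) (s j)
    unfold rewrite π₁-pair (suc k) (s j) | π₂-pair (suc k) (s j) = refl

  -- Every number is an instruction, and the instructions inside its operand have smaller codes.
  -- Hence all programs halt on all inputs, and no stage of the construction waits forever.
  runs-total : ∀ i x → ∃ (Runs i x)
  runs-total = <-rec _ λ i ih x → subst (λ i → ∃ (Runs i x)) (pair-π i) (by-tag (π₁ i) (π₂ i)
    (λ {j} j<  → ih (subst (j <_) (pair-π i) j<)) x)
    where
    by-tag : ∀ t p → (∀ {j} → j < cantor t p → ∀ x → ∃ (Runs j x)) → ∀ x → ∃ (Runs (cantor t p) x)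
    by-tag 0 p ih x = 0 , runs-step {0} {p} λ S → ⟿-refl refl
    by-tag 1 p ih x = suc x , runs-step {1} {p} λ S → ⟿-refl refl
    by-tag 2 p ih x = π₁ x , runs-step {2} {p} λ S → ⟿-refl refl
    by-tag 3 p ih x = π₂ x , runs-step {3} {p} λ S → ⟿-refl refl
    by-tag 4 p ih x with ih (≤-<-trans (π₂-≤ p) (pair-<ʳ 3 p)) x
    ... | y , G with ih (≤-<-trans (π₁-≤ p) (pair-<ʳ 3 p)) y
    ... | z , F = z , runs-4 G F
    by-tag 5 p ih x with ih (≤-<-trans (π₁-≤ p) (pair-<ʳ 4 p)) x | ih (≤-<-trans (π₂-≤ p) (pair-<ʳ 4 p)) x
    ... | y , F | z , G = cantor y z , runs-5 F G
    by-tag 6 p ih x with ih (≤-<-trans (π₁-≤ p) (pair-<ʳ 5 p)) (π₂ p)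
    ... | y , F = cantor x y , runs-6 F
    by-tag 7 p ih x = cantor p x , runs-step {7} {p} λ S → ⟿-refl refl
    by-tag (suc (suc (suc (suc (suc (suc (suc (suc t)))))))) p ih x =
      s (π₁ x + 0) , subst (λ x′ → Runs _ x′ (s (π₁ x + 0))) (pair-π x)
        (runs-iter {p} {t} s (λ j → proj₂ (ih (pair-<ʳ (7 + t) p) (s j))) (π₁ x) 0)
      where
      s : ℕ → ℕ
      s zero = π₂ x
      s (suc j) = proj₁ (ih (pair-<ʳ (7 + t) p) (s j))

  enc : ∀ {n} → Vec ℕ n → ℕ
  enc [] = 0
  enc (x ∷ xs) = cantor x (enc xs)

  projⁱ : ∀ {n} → Fin n → ℕ
  projⁱ fz = π₁ⁱ
  projⁱ (fs i) = compⁱ (projⁱ i) π₂ⁱ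

  mutual
    instr : ∀ {n} → PR n → ℕ
    instr zeroᵖ = zeroⁱ
    instr succᵖ = compⁱ sucⁱ π₁ⁱ
    instr (projᵖ i) = projⁱ i
    instr (compᵖ f gs) = compⁱ (instr f) (instrs gs)
    -- The loop works on states ⟨j , ⟨value at j , parameters⟩⟩, starting at j = 0 and repeated k
    -- times; the outer composition extracts the value.
    instr (precᵖ g h) =
      compⁱ (compⁱ π₁ⁱ π₂ⁱ)
        (compⁱ (cantor 8 (prec-step (instr h))) (pairⁱ π₁ⁱ (pairⁱ zeroⁱ (pairⁱ (compⁱ (instr g) π₂ⁱ) π₂ⁱ))))

    instrs : ∀ {n m} → Vec (PR n) m → ℕ
    instrs [] = zeroⁱ
    instrs (g ∷ gs) = pairⁱ (instr g) (instrs gs)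

    prec-step : ℕ → ℕ
    prec-step h = pairⁱ (compⁱ sucⁱ π₁ⁱ) (pairⁱ h (compⁱ π₂ⁱ π₂ⁱ))

  runs-≡ : ∀ {f x y z} → Runs f x y → y ≡ z → Runs f x z
  runs-≡ r refl = r

  runs-π₁′ : ∀ {a b} → Runs π₁ⁱ (cantor a b) a
  runs-π₁′ {a} {b} = runs-≡ runs-π₁ (π₁-pair a b)

  runs-π₂′ : ∀ {a b} → Runs π₂ⁱ (cantor a b) b
  runs-π₂′ {a} {b} = runs-≡ runs-π₂ (π₂-pair a b)

  runs-proj : ∀ {n} (i : Fin n) xs → Runs (projⁱ i) (enc xs) (lookup xs i)
  runs-proj fz (x ∷ xs) = runs-π₁′
  runs-proj (fs i) (x ∷ xs) = runs-comp {projⁱ i} runs-π₂′ (runs-proj i xs)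

  mutual
    runs-instr : ∀ {n} (f : PR n) xs → Runs (instr f) (enc xs) (evalPR f xs)
    runs-instr zeroᵖ xs = runs-zero
    runs-instr succᵖ (x ∷ []) = runs-comp {sucⁱ} {π₁ⁱ} runs-π₁′ runs-suc
    runs-instr (projᵖ i) xs = runs-proj i xs
    runs-instr (compᵖ f gs) xs =
      runs-comp {instr f} {instrs gs} (runs-instrs gs xs) (runs-instr f (evalPRs gs xs))
    runs-instr (precᵖ g h) (k ∷ xs) =
      runs-comp (runs-comp {cantor 8 (prec-step (instr h))}
                  (runs-pair runs-π₁′ (runs-pair runs-zero
                    (runs-pair (runs-comp {instr g} runs-π₂′ (runs-instr g xs)) runs-π₂′)))
                  (runs-≡ (runs-iter {prec-step (instr h)} {0} state (state-step g h xs) k 0) (cong state (+-identityʳ k))))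
                (runs-comp {π₁ⁱ} {π₂ⁱ} runs-π₂′ runs-π₁′)
      where
      state : ℕ → ℕ
      state j = cantor j (cantor (evalPrec g h j xs) (enc xs))

    state-step : ∀ {n} (g : PR n) h xs j →
      Runs (prec-step (instr h)) (cantor j (cantor (evalPrec g h j xs) (enc xs)))
           (cantor (suc j) (cantor (evalPrec g h (suc j) xs) (enc xs)))
    state-step g h xs j =
      runs-pair (runs-comp {sucⁱ} {π₁ⁱ} runs-π₁′ runs-suc)
        (runs-pair (runs-instr h (j ∷ evalPrec g h j xs ∷ xs)) (runs-comp {π₂ⁱ} {π₂ⁱ} runs-π₂′ runs-π₂′))

    runs-instrs : ∀ {n m} (gs : Vec (PR n) m) xs → Runs (instrs gs) (enc xs) (enc (evalPRs gs xs))
    runs-instrs [] xs = runs-zero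
    runs-instrs (g ∷ gs) xs = runs-pair (runs-instr g xs) (runs-instrs gs xs)

  PR₁-instr : ∀ {f} → PR₁ f → Σ ℕ λ e → ∀ x → Runs e x (f x)
  PR₁-instr {f} (t , ok) =
    -- The argument is rebuilt from its two projections, which does duty for an identity
    -- instruction; pairing it with 0 encodes a vector of length one.
    compⁱ (instr t) (pairⁱ (pairⁱ π₁ⁱ π₂ⁱ) zeroⁱ) , λ x →
      runs-comp {instr t} (runs-pair (runs-≡ (runs-pair runs-π₁ runs-π₂) (pair-π x)) runs-zero)
        (runs-≡ (runs-instr t (x ∷ [])) (ok x))

-- The generic sequence and its histories.

module Histories where

  open PrimitiveRecursion
  open Machine

  _>>=_ : ∀ {a b} {A : Set a} {B : Set b} → ¬ ¬ A → (A → ¬ ¬ B) → ¬ ¬ B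
  (m >>= f) k = m λ a → f a k

  return : ∀ {a} {A : Set a} → A → ¬ ¬ A
  return a k = k a

  excluded-middle : ∀ {a} {A : Set a} → ¬ ¬ (A ⊎ ¬ A)
  excluded-middle k = k (inj₂ λ a → k (inj₁ a))

  abstract
    -- hist 0 = 0 and hist (n + 1) = suc ⟨hist n , T , a⟩, where T is the least time
    -- at which the machine has halted on the input hist n for all programs e ≤ n, and
    -- a = suc e if program e acts at stage n, a = 0 if no program does.  Program e
    -- wants the next bit to be  pred (its output)  if its output is nonzero, and the
    -- least e ≤ n with a wish that has not acted before is served.

    run : ℕ → ℕ → ℕ → ℕ
    run e H T = iter step T (cantor (push e 0) H)

    down time actor : ℕ → ℕ
    down k = π₁ (pred k)
    time k = π₁ (π₂ (pred k))
    actor k = π₂ (π₂ (pred k))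

    len : ℕ → ℕ
    len k = pred (search (λ i → not (iter down i k)) (suc k))

    pending : ℕ → ℕ → ℕ
    pending H T = search (λ e → π₁ (run e H T)) (suc (len H))

    acted : ℕ → ℕ → ℕ
    acted e k = search (λ i → eq (actor (iter down i k)) (suc e)) (len k)

    choose : ℕ → ℕ → ℕ
    choose H T = search (λ e → and (π₂ (run e H T)) (not (acted e H))) (suc (len H))

    extend : ℕ → ℕ → ℕ
    extend H T = suc (cantor H (cantor T (choose H T)))

    -- The history names the program that acted; its output is recovered by running it again for the
    -- recorded time. A "bit" may be any number, and elements only record whether it is zero.
    lastbit : ℕ → ℕ
    lastbit k = ifz (actor k) 0 (pred (π₂ (run (pred (actor k)) (down k) (time k))))

    PR₁-run : ∀ {e H T} → PR₁ e → PR₁ H → PR₁ T → PR₁ (λ x → run (e x) (H x) (T x))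
    PR₁-run E H T = PR₁-iter PR₁-step T (PR₁-cantor (PR₁-push E (PR₁-const 0)) H)

    PR₁-down : ∀ {f} → PR₁ f → PR₁ (λ x → down (f x))
    PR₁-down F = PR₁-π₁ (PR₁-pred F)

    PR₁-time : ∀ {f} → PR₁ f → PR₁ (λ x → time (f x))
    PR₁-time F = PR₁-π₁ (PR₁-π₂ (PR₁-pred F))

    PR₁-actor : ∀ {f} → PR₁ f → PR₁ (λ x → actor (f x))
    PR₁-actor F = PR₁-π₂ (PR₁-π₂ (PR₁-pred F))

    PR₁-downs : ∀ {n f} → PR₁ n → PR₁ f → PR₁ (λ x → iter down (n x) (f x))
    PR₁-downs = PR₁-iter (PR₁-down PR₁-id)

    PR₁-len : ∀ {f} → PR₁ f → PR₁ (λ x → len (f x))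
    PR₁-len = PR₁-∘ {len} (PR₁-pred (PR₁-search {f = λ i k → not (iter down i k)} (PR₁-suc PR₁-id)
      (PR₁-not (PR₁-downs fstᴾ sndᴾ))))

    PR₂-pending : PR₂ pending
    PR₂-pending = PR₁-search {f = λ e z → π₁ (run e (π₁ z) (π₂ z))} (PR₁-suc (PR₁-len fstᴾ))
      (PR₁-π₁ (PR₁-run fstᴾ (PR₁-π₁ sndᴾ) (PR₁-π₂ sndᴾ)))

    PR₂-acted : PR₂ acted
    PR₂-acted = PR₁-search {f = λ i z → eq (actor (iter down i (π₂ z))) (suc (π₁ z))} (PR₁-len sndᴾ)
      (PR₁-eq (PR₁-actor (PR₁-downs fstᴾ (PR₁-π₂ sndᴾ))) (PR₁-suc (PR₁-π₁ sndᴾ)))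

    PR₂-choose : PR₂ choose
    PR₂-choose = PR₁-search {f = λ e z → and (π₂ (run e (π₁ z) (π₂ z))) (not (acted e (π₁ z)))}
      (PR₁-suc (PR₁-len fstᴾ))
      (PR₁-and (PR₁-π₂ (PR₁-run fstᴾ (PR₁-π₁ sndᴾ) (PR₁-π₂ sndᴾ)))
               (PR₁-not (PR₂-app {acted} PR₂-acted fstᴾ (PR₁-π₁ sndᴾ))))

    PR₂-extend : PR₂ extend
    PR₂-extend = PR₁-suc (PR₁-cantor fstᴾ (PR₁-cantor sndᴾ PR₂-choose))

    PR₁-lastbit : ∀ {f} → PR₁ f → PR₁ (λ x → lastbit (f x))
    PR₁-lastbit = PR₁-∘ {lastbit} (PR₁-ifz A (PR₁-const 0)
      (PR₁-pred (PR₁-π₂ (PR₁-run (PR₁-pred A) (PR₁-down PR₁-id) (PR₁-time PR₁-id)))))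
      where
      A : PR₁ actor
      A = PR₁-actor PR₁-id

    run-halted-+ : ∀ e H T d → π₁ (run e H T) ≡ 0 → run e H (d + T) ≡ run e H T
    run-halted-+ e H T zero h = refl
    run-halted-+ e H T (suc d) h rewrite run-halted-+ e H T d h = ifz-zero _ _ h

    run-halted : ∀ e H {T T′} → T ≤ T′ → π₁ (run e H T) ≡ 0 → run e H T′ ≡ run e H T
    run-halted e H {T} {T′} le h =
      trans (cong (run e H) (sym (m∸n+n≡m le))) (run-halted-+ e H T (T′ ∸ T) h)

    run-unique : ∀ e H T T′ → π₁ (run e H T) ≡ 0 → π₁ (run e H T′) ≡ 0 → run e H T ≡ run e H T′
    run-unique e H T T′ h h′ with ≤-total T T′
    ... | inj₁ le = sym (run-halted e H le h)
    ... | inj₂ le = run-halted e H le h′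

    run-output : ∀ {e H T y} → Runs e H y → π₁ (run e H T) ≡ 0 → π₂ (run e H T) ≡ y
    run-output {e} {H} {T} {y} r h with r 0
    ... | T′ , eq = trans (cong π₂ (trans (run-unique e H T T′ h
      (trans (cong π₁ eq) (π₁-pair 0 y))) eq)) (π₂-pair 0 y)

    all-halt : ∀ H n → Σ ℕ λ T → ∀ e → e < n → π₁ (run e H T) ≡ 0
    all-halt H zero = 0 , λ _ ()
    all-halt H (suc n) with all-halt H n | runs-total n H
    ... | T , p | y , r with r 0
    ... | T′ , eq = T + T′ , λ e e<sn → go e (m≤n⇒m<n∨m≡n (≤-pred e<sn))
      where
      go : ∀ e → e < n ⊎ e ≡ n → π₁ (run e H (T + T′)) ≡ 0
      go e (inj₁ e<n) = trans (cong π₁ (run-halted e H (m≤m+n T T′) (p e e<n))) (p e e<n)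
      go .n (inj₂ refl) = trans (cong π₁ (run-halted n H (m≤n+m T′ T) done)) done
        where
        done : π₁ (run n H T′) ≡ 0
        done = trans (cong π₁ eq) (π₁-pair 0 y)

    search-zero : ∀ f n → (∀ e → e < n → f e ≡ 0) → search f n ≡ 0
    search-zero f n p with search f n | search-spec f n
    ... | _ | none _ = refl
    ... | _ | found e e<n fe _ = ⊥-elim (fe (p e e<n))

    least : (f : ℕ → ℕ) → ∀ n → f n ≡ 0 → Σ ℕ λ m → f m ≡ 0 × (∀ j → j < m → f j ≢ 0)
    least f n fn = go (search-spec (λ i → not (f i)) (suc n))
      where
      go : ∀ {r} → Search (λ i → not (f i)) (suc n) r → Σ ℕ λ m → f m ≡ 0 × (∀ j → j < m → f j ≢ 0)
      go (none p) = ⊥-elim (1+n≢0 (trans (cong not (sym fn)) (p n ≤-refl)))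
      go (found m _ fm min) = m , not-true fm , λ j j<m fj → 1+n≢0 (trans (cong not (sym fj)) (min j j<m))

  -- In a module of its own the halting time stays opaque below; unfolding it blows up.
  module Halting where
    abstract
      halting-time : ∀ H → Σ ℕ λ T → pending H T ≡ 0 × (∀ j → j < T → pending H j ≢ 0)
      halting-time H with all-halt H (suc (len H))
      ... | T , p = least (pending H) T (search-zero _ (suc (len H)) p)

  open Halting

  abstract
    next : ℕ → ℕ
    next H = extend H (proj₁ (halting-time H))

    hist : ℕ → ℕ
    hist n = iter next n 0

    Rec₁-hist : Rec₁ hist
    Rec₁-hist = Rec₁-iter (Rec₁-PR₂ {extend} PR₂-extend (Rec₁-PR PR₁-id)
      (Rec₁-mu {c = λ T H → pending H T} (PR₂-app {pending} PR₂-pending sndᴾ fstᴾ)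
        (λ H → proj₁ (proj₂ (halting-time H))) (λ H → proj₂ (proj₂ (halting-time H)))))

    π₁-0 : π₁ 0 ≡ 0
    π₁-0 = n≤0⇒n≡0 (π₁-≤ 0)

    haltᵗ : ℕ → ℕ
    haltᵗ n = proj₁ (halting-time (hist n))

    down-hist : ∀ n → down (hist n) ≡ hist (pred n)
    down-hist zero = π₁-0
    down-hist (suc n) = π₁-pair (hist n) _

    time-hist : ∀ n → time (hist (suc n)) ≡ haltᵗ n
    time-hist n = trans (cong π₁ (π₂-pair (hist n) _)) (π₁-pair (haltᵗ n) _)

    actor-hist : ∀ n → actor (hist (suc n)) ≡ choose (hist n) (haltᵗ n)
    actor-hist n = trans (cong π₂ (π₂-pair (hist n) _)) (π₂-pair (haltᵗ n) _)

    downs-hist : ∀ i n → iter down i (hist n) ≡ hist (n ∸ i)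
    downs-hist zero n = refl
    downs-hist (suc i) n = trans (cong down (downs-hist i n))
      (trans (down-hist (n ∸ i)) (cong hist (pred[m∸n]≡m∸[1+n] n i)))

    hist-< : ∀ n → hist n < hist (suc n)
    hist-< n = s≤s (pair-≥ˡ (hist n) _)

    hist-mono : ∀ {m n} → m ≤ n → hist m ≤ hist n
    hist-mono {m} {n} m≤n = subst (λ k → hist m ≤ hist k) (m∸n+n≡m m≤n) (go (n ∸ m))
      where
      go : ∀ d → hist m ≤ hist (d + m)
      go zero = ≤-refl
      go (suc d) = ≤-trans (go d) (<⇒≤ (hist-< (d + m)))

    n≤hist : ∀ n → n ≤ hist n
    n≤hist zero = z≤n
    n≤hist (suc n) = ≤-trans (s≤s (n≤hist n)) (hist-< n)

    len-hist : ∀ n → len (hist n) ≡ n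
    len-hist n = cong pred (search-found (λ i → not (iter down i (hist n))) (suc (hist n)) n (s≤s (n≤hist n))
      (λ z → 1+n≢0 (trans (cong not (sym (trans (downs-hist n n) (cong hist (n∸n≡0 n))))) z))
      λ e e<n → not-pos (≤-trans (m<n⇒0<n∸m e<n)
        (subst (n ∸ e ≤_) (sym (downs-hist e n)) (n≤hist (n ∸ e)))))
      where
      not-pos : ∀ {m} → 0 < m → not m ≡ 0
      not-pos (s≤s _) = refl

    Acts : ℕ → ℕ → Set
    Acts n e = actor (hist (suc n)) ≡ suc e

    halted : ∀ n {e} → e ≤ n → π₁ (run e (hist n) (haltᵗ n)) ≡ 0
    halted n {e} e≤n = search-none (λ e → π₁ (run e (hist n) (haltᵗ n))) (suc (len (hist n)))
      (proj₁ (proj₂ (halting-time (hist n)))) e (s≤s (subst (e ≤_) (sym (len-hist n)) e≤n))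

    acted-true : ∀ {m n e} → m < n → Acts m e → acted e (hist n) ≢ 0
    acted-true {m} {n} {e} m<n act =
      search-hit (λ i → eq (actor (iter down i (hist n))) (suc e)) (len (hist n)) {n ∸ suc m}
        (subst (n ∸ suc m <_) (sym (len-hist n)) (∸-monoʳ-< {n} {suc m} {0} (s≤s z≤n) m<n))
        λ z → 1+n≢0 (trans (sym (eq-refl (suc e))) (trans (cong (λ a → eq a (suc e)) (sym acted-then)) z))
      where
      acted-then : actor (iter down (n ∸ suc m) (hist n)) ≡ suc e
      acted-then = trans (cong actor (trans (downs-hist (n ∸ suc m) n) (cong hist (m∸[m∸n]≡n m<n)))) act

    acted-sound : ∀ {n e} → acted e (hist n) ≢ 0 → Σ ℕ λ m → m < n × Acts m e
    acted-sound {n} {e} a with acted e (hist n) in q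
    ... | zero = ⊥-elim (a refl)
    ... | suc i with search-some (λ i → eq (actor (iter down i (hist n))) (suc e)) (len (hist n)) q
    ... | i<len , hit , _ = go (n ∸ i) refl
      where
      i<n : i < n
      i<n = subst (i <_) (len-hist n) i<len
      go : ∀ d → n ∸ i ≡ d → Σ ℕ λ m → m < n × Acts m e
      go zero p = ⊥-elim (<⇒≢ (m<n⇒0<n∸m i<n) (sym p))
      go (suc d) p = d , ≤-trans (≤-reflexive (sym p)) (m∸n≤m n i) ,
        trans (cong actor (trans (cong hist (sym p)) (sym (downs-hist i n)))) (eq-true hit)

    acts-spec : ∀ {n e} → Acts n e →
      e ≤ n × acted e (hist n) ≡ 0 × π₂ (run e (hist n) (haltᵗ n)) ≢ 0
    acts-spec {n} {e} act with search-some _ _ (trans (sym (actor-hist n)) act)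
    ... | e<len , w , _ with and-true {π₂ (run e (hist n) (haltᵗ n))} w
    ... | w₁ , w₂ = ≤-pred (subst (λ l → e < suc l) (len-hist n) e<len) , not-true w₂ , w₁

    acts-once : ∀ {m n e} → m < n → Acts m e → ¬ Acts n e
    acts-once {m} {n} {e} m<n a b = acted-true m<n a (proj₁ (proj₂ (acts-spec {n} {e} b)))

    -- A program acts at most once, so the programs below `e` eventually fall quiet. Whether one of
    -- them ever acts is not decidable, hence the double negation.
    settle : ∀ e → ¬ ¬ (Σ ℕ λ B → ∀ n → B ≤ n → ∀ d → d < e → ¬ Acts n d)
    settle zero = return (0 , λ _ _ _ ())
    settle (suc e) =
      settle e >>= λ { (B , quiet) → excluded-middle {A = Σ ℕ λ m → Acts m e} >>= λ
        { (inj₁ (m , act)) → return (B + suc m , λ n le d d<se → case (m≤n⇒m<n∨m≡n (≤-pred d<se))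
            (quiet n (≤-trans (m≤m+n B (suc m)) le) d)
            λ { refl → acts-once {m} {n} {e} (≤-trans (m≤n+m (suc m) B) le) act })
        ; (inj₂ never) → return (B , λ n le d d<se → case (m≤n⇒m<n∨m≡n (≤-pred d<se))
            (quiet n le d) λ { refl a → never (n , a) }) } }
      where
      case : ∀ {P Q R : Set} → P ⊎ Q → (P → R) → (Q → R) → R
      case (inj₁ p) f g = f p
      case (inj₂ q) f g = g q

    bit : ℕ → ℕ
    bit n = lastbit (hist (suc n))

    -- The sequence  bit  is generic: a prediction of  bit n  from  hist n  that is never
    -- confirmed is eventually not made.
    silent : ∀ {F} → PR₁ F → (∀ n → F (hist n) ≢ 0 → bit n ≢ pred (F (hist n))) →
             ¬ ¬ (Σ ℕ λ B → ∀ n → B ≤ n → F (hist n) ≡ 0)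
    silent {F} Fᴾ wrong with PR₁-instr Fᴾ
    ... | e , runs = settle e >>= λ { (B , quiet) → return (B + e , λ n le →
          quiet⇒0 n (≤-trans (m≤n+m e B) le) (quiet n (≤-trans (m≤m+n B e) le))) }
      where
      value : ∀ n → e ≤ n → π₂ (run e (hist n) (haltᵗ n)) ≡ F (hist n)
      value n e≤n = run-output {T = haltᵗ n} (runs (hist n)) (halted n e≤n)
      never : ∀ n → ¬ Acts n e
      never n act with acts-spec {n} {e} act
      ... | e≤n , _ , wish = wrong n (λ z → wish (trans (value n e≤n) z)) (trans served (cong pred (value n e≤n)))
        where
        served : bit n ≡ pred (π₂ (run e (hist n) (haltᵗ n)))
        served = trans (cong (λ a → ifz a 0 (pred (π₂ (run (pred a) (down (hist (suc n))) (time (hist (suc n))))))) act)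
          (cong₂ (λ H T → pred (π₂ (run e H T))) (down-hist (suc n)) (time-hist n))
      unacted : ∀ n → acted e (hist n) ≡ 0
      unacted n with zero? (acted e (hist n))
      ... | inj₁ z = z
      ... | inj₂ a with acted-sound {n} {e} a
      ...   | m , _ , act = ⊥-elim (never m act)
      -- A wish of `e` at such a stage would have some least program `d` served: `d < e` is quiet,
      -- `d = e` never acts, and `d > e` is not least.
      quiet⇒0 : ∀ n → e ≤ n → (∀ d → d < e → ¬ Acts n d) → F (hist n) ≡ 0
      quiet⇒0 n e≤n quiet with zero? (F (hist n))
      ... | inj₁ z = z
      ... | inj₂ wish = ⊥-elim (go (search-spec want (suc (len (hist n)))) refl)
        where
        want : ℕ → ℕ
        want d = and (π₂ (run d (hist n) (haltᵗ n))) (not (acted d (hist n)))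
        wants : want e ≢ 0
        wants = and-intro (λ z → wish (trans (sym (value n e≤n)) z)) (not-zero (unacted n))
        go : ∀ {r} → Search want (suc (len (hist n))) r → search want (suc (len (hist n))) ≡ r → ⊥
        go (none p) q = wants (p e (s≤s (subst (e ≤_) (sym (len-hist n)) e≤n)))
        go (found d _ wd min) q with <-cmp d e
        ... | tri< d<e _ _ = quiet d d<e (trans (actor-hist n) q)
        ... | tri≈ _ refl _ = never n (trans (actor-hist n) q)
        ... | tri> _ _ e<d = wants (min e e<d)

    histAt : ℕ → ℕ → ℕ
    histAt k m = iter down (len k ∸ m) k

    bitAt : ℕ → ℕ → ℕ
    bitAt k m = lastbit (histAt k (suc m))

    PR₁-histAt : ∀ {k m} → PR₁ k → PR₁ m → PR₁ (λ x → histAt (k x) (m x))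
    PR₁-histAt K M = PR₁-downs (PR₁-∸ (PR₁-len K) M) K

    PR₁-bitAt : ∀ {k m} → PR₁ k → PR₁ m → PR₁ (λ x → bitAt (k x) (m x))
    PR₁-bitAt K M = PR₁-lastbit (PR₁-histAt K (PR₁-suc M))

    histAt-hist : ∀ {m n} → m ≤ n → histAt (hist n) m ≡ hist m
    histAt-hist {m} {n} m≤n rewrite len-hist n =
      trans (downs-hist (n ∸ m) n) (cong hist (m∸[m∸n]≡n m≤n))

    bitAt-hist : ∀ {m n} → m < n → bitAt (hist n) m ≡ bit m
    bitAt-hist m<n = cong lastbit (histAt-hist m<n)

    well-timed : ℕ → ℕ
    well-timed k = and (eq (search (λ T → not (pending (down k) T)) (suc (time k))) (suc (time k)))
                       (eq k (extend (down k) (time k)))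

    -- The empty history is 0 and counts as sound; applying `down` too often stays at 0 and does no
    -- harm.
    flawed : ℕ → ℕ
    flawed y = ifz y 0 (not (well-timed y))

    valid : ℕ → ℕ
    valid x = not (search (λ i → flawed (iter down i x)) x)

    PR₁-well-timed : PR₁ well-timed
    PR₁-well-timed = PR₁-and
      (PR₁-eq (PR₁-search {f = λ T k → not (pending (down k) T)} (PR₁-suc (PR₁-time PR₁-id))
                (PR₁-not (PR₂-app {pending} PR₂-pending (PR₁-down sndᴾ) fstᴾ)))
              (PR₁-suc (PR₁-time PR₁-id)))
      (PR₁-eq PR₁-id (PR₂-app {extend} PR₂-extend (PR₁-down PR₁-id) (PR₁-time PR₁-id)))

    PR₁-flawed : ∀ {f} → PR₁ f → PR₁ (λ x → flawed (f x))
    PR₁-flawed = PR₁-∘ {flawed} (PR₁-ifz PR₁-id (PR₁-const 0) (PR₁-not PR₁-well-timed))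

    PR₁-valid : ∀ {f} → PR₁ f → PR₁ (λ x → valid (f x))
    PR₁-valid = PR₁-∘ {valid} (PR₁-not (PR₁-search {f = λ i x → flawed (iter down i x)} PR₁-id
      (PR₁-flawed (PR₁-downs fstᴾ sndᴾ))))

    unflawed : ∀ {k} → k ≢ 0 → flawed k ≡ 0 → k ≡ next (down k)
    unflawed {zero} k≢0 _ = ⊥-elim (k≢0 refl)
    unflawed {suc k} k≢0 z with zero? (well-timed (suc k))
    ... | inj₁ w = ⊥-elim (not-zero w z)
    ... | inj₂ w with and-true {eq (search (λ T → not (pending (down (suc k)) T)) (suc (time (suc k)))) (suc (time (suc k)))} w
    ... | w₁ , w₂ with search-some (λ T → not (pending (down (suc k)) T)) (suc (time (suc k))) (eq-true w₁)
    ... | _ , halts , first = trans (eq-true w₂) (cong (extend H) same)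
      where
      H : ℕ
      H = down (suc k)
      T : ℕ
      T = time (suc k)
      same : T ≡ proj₁ (halting-time H)
      same with halting-time H
      ... | T′ , p , min with <-cmp T T′
      ... | tri< T<T′ _ _ = ⊥-elim (min T T<T′ (not-true halts))
      ... | tri≈ _ q _ = q
      ... | tri> _ _ T′<T = ⊥-elim (not-zero p (first T′ T′<T))

    hist-unflawed : ∀ n → flawed (hist n) ≡ 0
    hist-unflawed zero = refl
    hist-unflawed (suc n) = cong not (and-intro-1 first (trans (cong (eq k) (cong₂ extend (down-hist (suc n)) (time-hist n))) (eq-refl k)))
      where
      k : ℕ
      k = hist (suc n)
      and-intro-1 : ∀ {a b} → a ≡ 1 → b ≡ 1 → and a b ≡ 1
      and-intro-1 refl refl = refl
      first : eq (search (λ T → not (pending (down k) T)) (suc (time k))) (suc (time k)) ≡ 1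
      first rewrite down-hist (suc n) | time-hist n =
        trans (cong (λ s → eq s (suc (haltᵗ n))) (search-found (λ T → not (pending (hist n) T)) (suc (haltᵗ n)) (haltᵗ n) ≤-refl
          (not-zero (proj₁ (proj₂ (halting-time (hist n)))))
          (λ j j< → not-nonzero (proj₂ (proj₂ (halting-time (hist n))) j j<)))) (eq-refl (suc (haltᵗ n)))
        where
        not-nonzero : ∀ {a} → a ≢ 0 → not a ≡ 0
        not-nonzero {zero} p = ⊥-elim (p refl)
        not-nonzero {suc a} _ = refl

    valid-hist : ∀ n → valid (hist n) ≢ 0
    valid-hist n = not-zero (search-zero _ _ λ i _ → trans (cong flawed (downs-hist i n)) (hist-unflawed (n ∸ i)))

    down-< : ∀ x → down (suc x) < suc x
    down-< x = s≤s (π₁-≤ x)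

    valid-sound : ∀ x → valid x ≢ 0 → Σ ℕ λ n → x ≡ hist n
    valid-sound = <-rec _ go
      where
      go : ∀ x → (∀ {y} → y < x → valid y ≢ 0 → Σ ℕ λ n → y ≡ hist n) → valid x ≢ 0 → Σ ℕ λ n → x ≡ hist n
      go zero ih v = 0 , refl
      go (suc x) ih v with ih (down-< x) (not-zero (search-zero _ _ λ i i<y →
          trans (cong flawed (iter-comm down i (suc x)))
                (ok (suc i) (≤-trans (s≤s i<y) (down-< x)))))
        where
        ok : ∀ i → i < suc x → flawed (iter down i (suc x)) ≡ 0
        ok = search-none _ (suc x) (not-true v)
      ... | n , eq = suc n , trans (unflawed {suc x} (λ ()) (search-none _ (suc x) (not-true v) 0 (s≤s z≤n))) (cong next eq)

    hist-0 : hist 0 ≡ 0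
    hist-0 = refl

    hist≢0 : ∀ n → hist (suc n) ≢ 0
    hist≢0 n ()

    -- The longest history not exceeding `x`: what a primitive recursive procedure can learn about
    -- the construction from the mere size of its input.
    latest : ℕ → ℕ
    latest x = x ∸ pred (search (λ i → valid (x ∸ i)) (suc x))

    PR₁-latest : ∀ {f} → PR₁ f → PR₁ (λ x → latest (f x))
    PR₁-latest = PR₁-∘ {latest} (PR₁-∸ PR₁-id (PR₁-pred (PR₁-search {f = λ i x → valid (x ∸ i)} (PR₁-suc PR₁-id)
      (PR₁-valid (PR₁-∸ sndᴾ fstᴾ)))))

    latest-spec : ∀ x → Σ ℕ λ n → latest x ≡ hist n × (∀ m → hist m ≤ x → m ≤ n)
    latest-spec x with search (λ i → valid (x ∸ i)) (suc x) | search-spec (λ i → valid (x ∸ i)) (suc x)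
    ... | _ | none p = ⊥-elim (valid-hist 0 (trans (cong valid (sym (n∸n≡0 x))) (p x ≤-refl)))
    ... | _ | found i _ v min with valid-sound (x ∸ i) v
    ... | n , eq = n , eq , λ m hm≤x → ≮⇒≥ λ n<m →
      valid-hist m (subst (λ h → valid h ≡ 0) (m∸[m∸n]≡n hm≤x)
        (min (x ∸ hist m) (≮⇒≥′ m hm≤x n<m)))
      where
      ≮⇒≥′ : ∀ m → hist m ≤ x → n < m → x ∸ hist m < i
      ≮⇒≥′ m hm≤x n<m = ≰⇒> λ i≤ → <-irrefl refl (<-≤-trans (hist-< n)
        (≤-trans (hist-mono n<m) (≤-trans (≤-reflexive (sym (m∸[m∸n]≡n hm≤x)))
          (≤-trans (∸-monoʳ-≤ x i≤) (≤-reflexive eq)))))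

-- Elements given by number functions; the sets behind p, q and r.

module Elements where

  open PrimitiveRecursion
  open Machine
  open Histories

  -- A characteristic function a gives the element
  -- {0} ∪ {n + 2 : a n ≠ 0}, which is neither empty nor everything.

  _⁺ : (ℕ → ℕ) → ℕ → Bool
  (a ⁺) 0 = true
  (a ⁺) 1 = false
  (a ⁺) (suc (suc n)) = nz (a n)

  cases : ℕ → ℕ → (ℕ → ℕ) → ℕ → ℕ
  cases y n g x = ifz x y (ifz (pred x) n (g (pred (pred x))))

  PR₁-cases : ∀ y n {g} → PR₁ g → PR₁ (cases y n g)
  PR₁-cases y n G = PR₁-ifz PR₁-id (PR₁-const y) (PR₁-ifz (PR₁-pred PR₁-id) (PR₁-const n)
    (PR₁-∘ G (PR₁-pred (PR₁-pred PR₁-id))))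

  ⁺-computable : ∀ {a} → Rec₁ a → Computable (a ⁺)
  ⁺-computable {a} A = Rec₁-ext (Rec₁-PR₂ {f} F (Rec₁-PR PR₁-id)
      (Rec₁-∘ A (Rec₁-PR (PR₁-pred (PR₁-pred PR₁-id))))) ok
    where
    f : ℕ → ℕ → ℕ
    f x b = ifz x 1 (ifz (pred x) 0 (ifz b 0 1))
    F : PR₂ f
    F = PR₁-ifz fstᴾ (PR₁-const 1) (PR₁-ifz (PR₁-pred fstᴾ) (PR₁-const 0)
          (PR₁-ifz sndᴾ (PR₁-const 0) (PR₁-const 1)))
    ok : ∀ x → f x (a (pred (pred x))) ≡ χ ((a ⁺) x)
    ok 0 = refl
    ok 1 = refl
    ok (suc (suc n)) with a n
    ... | zero = refl
    ... | suc _ = refl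

  abstract
    ⁺-proper : ∀ {a} → Rec₁ a → Computable (a ⁺) × ¬ ((a ⁺) ≡ᵖʳₘ ∅ˢ) × ¬ ((a ⁺) ≡ᵖʳₘ ωˢ)
    ⁺-proper A = ⁺-computable A ,
      (λ { ((_ , p) , _) → true≢false (p 0) }) ,
      (λ { ((_ , p) , _) → true≢false (sym (p 1)) })
      where
      true≢false : true ≢ false
      true≢false ()

  el : (a : ℕ → ℕ) → Rec₁ a → CElt
  el a A = (a ⁺) , ⁺-proper A

  reduce : ∀ A B f → PR₁ f → (∀ x → A x ≡ B (f x)) → A ≤ᵖʳₘ B
  reduce A B f (t , ok) p = t , λ x → trans (p x) (cong B (sym (ok x)))

  reduction : ∀ A B → A ≤ᵖʳₘ B → Σ (ℕ → ℕ) λ f → PR₁ f × (∀ x → A x ≡ B (f x))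
  reduction A B (t , p) = (λ x → evalPR t (x ∷ [])) , PR₁-eval t , p

  ≤-transᵖʳ : ∀ A B C → A ≤ᵖʳₘ B → B ≤ᵖʳₘ C → A ≤ᵖʳₘ C
  ≤-transᵖʳ A B C A≤B B≤C with reduction A B A≤B | reduction B C B≤C
  ... | f , F , p | g , G , q = reduce A C (λ x → g (f x)) (PR₁-∘ G F) λ x → trans (p x) (q (f x))

  ≤-reflᵖʳ : ∀ A → A ≤ᵖʳₘ A
  ≤-reflᵖʳ A = reduce A A id PR₁-id λ _ → refl

  ⁺-≤ : ∀ a B {y n} → B y ≡ true → B n ≡ false →
        ∀ g → PR₁ g → (∀ m → nz (a m) ≡ B (g m)) → (a ⁺) ≤ᵖʳₘ B
  ⁺-≤ a B {y} {n} By Bn g G p = reduce (a ⁺) B (cases y n g) (PR₁-cases y n G) ok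
    where
    ok : ∀ x → (a ⁺) x ≡ B (cases y n g x)
    ok 0 = sym By
    ok 1 = sym Bn
    ok (suc (suc m)) = p m

  inhabited : (X : CElt) → ¬ ¬ (Σ ℕ λ y → proj₁ X y ≡ true)
  inhabited (A , _ , A≢∅ , _) k = A≢∅ (reduce A ∅ˢ id PR₁-id empty , reduce ∅ˢ A id PR₁-id λ x → sym (empty x))
    where
    empty : ∀ x → A x ≡ false
    empty x with A x in eq
    ... | false = refl
    ... | true = ⊥-elim (k (x , eq))

  coinhabited : (X : CElt) → ¬ ¬ (Σ ℕ λ n → proj₁ X n ≡ false)
  coinhabited (A , _ , _ , A≢ω) k = A≢ω (reduce A ωˢ id PR₁-id full , reduce ωˢ A id PR₁-id λ x → sym (full x))
    where
    full : ∀ x → A x ≡ true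
    full x with A x in eq
    ... | true = refl
    ... | false = ⊥-elim (k (x , eq))

  -- The degree of the primitive recursive sets, by `decide` and `decidable`; an element below it is
  -- called trivial.
  𝟘 : CElt
  𝟘 = el (const 0) (Rec₁-PR (PR₁-const 0))

  𝟘-value : ∀ m → (const 0 ⁺) m ≡ nz (not m)
  𝟘-value 0 = refl
  𝟘-value 1 = refl
  𝟘-value (suc (suc m)) = refl

  decide : ∀ A → A ≤ᵖʳₘ (const 0 ⁺) → Σ (ℕ → ℕ) λ d → PR₁ d × (∀ x → A x ≡ nz (d x))
  decide A A≤0 with reduction A (const 0 ⁺) A≤0
  ... | f , F , p = (λ x → not (f x)) , PR₁-not F , λ x → trans (p x) (𝟘-value (f x))

  decidable : ∀ A {d} → PR₁ d → (∀ x → A x ≡ nz (d x)) → A ≤ᵖʳₘ (const 0 ⁺)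
  decidable A {d} D p = reduce A (const 0 ⁺) (λ x → not (d x)) (PR₁-not D) λ x →
    trans (p x) (trans (not-not (d x)) (sym (𝟘-value (not (d x)))))
    where
    not-not : ∀ m → nz m ≡ nz (not (not m))
    not-not zero = refl
    not-not (suc m) = refl

  xor : ℕ → ℕ → ℕ
  xor a b = ifz a b (not b)

  PR₁-xor : ∀ {f g} → PR₁ f → PR₁ g → PR₁ (λ x → xor (f x) (g x))
  PR₁-xor F G = PR₁-ifz F G (PR₁-not G)

  xor-zero : ∀ {a b} → xor a b ≡ 0 → nz a ≡ nz b
  xor-zero {zero} {zero} _ = refl
  xor-zero {suc a} {suc b} _ = refl

  xor-same : ∀ {a b} → nz a ≡ nz b → xor a b ≡ 0
  xor-same {zero} {zero} _ = refl
  xor-same {suc a} {suc b} _ = refl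

  piece : (ℕ → ℕ) → (ℕ → ℕ) → ℕ → ℕ
  piece D a n = and (D n) (a n)

  nz-and-true : ∀ {d} a → d ≢ 0 → nz (and d a) ≡ nz a
  nz-and-true {zero} a p = ⊥-elim (p refl)
  nz-and-true {suc d} a _ = refl

  nz-and-false : ∀ {d} a → d ≡ 0 → nz (and d a) ≡ false
  nz-and-false a refl = refl

  nz-and-cong : ∀ {d d′ a a′} → nz d ≡ nz d′ → nz a ≡ nz a′ → nz (and d a) ≡ nz (and d′ a′)
  nz-and-cong {zero} {zero} _ _ = refl
  nz-and-cong {suc d} {suc d′} _ q = q

  nz-not-cong : ∀ {a b} → nz a ≡ nz b → nz (not a) ≡ nz (not b)
  nz-not-cong {zero} {zero} _ = refl
  nz-not-cong {suc a} {suc b} _ = refl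

  nz-≢0 : ∀ {a b} → nz a ≡ nz b → a ≢ 0 → b ≢ 0
  nz-≢0 {suc a} {suc b} _ _ ()
  nz-≢0 {zero} _ p = ⊥-elim (p refl)

  -- The shift puts the choice before the bit it selects: `hist (suc n)` contains `bit n` and so
  -- determines `c n`, whereas `h (c n)` is fixed at stage `suc (c n)`, which lies beyond that
  -- history.
  h : ℕ → ℕ
  h n = bit (suc n)

  hAt : ℕ → ℕ → ℕ
  hAt k n = bitAt k (suc n)

  record Link : Set where
    field
      nx : ℕ → ℕ
      nxᴾ : PR₁ nx
      nx-≥ : ∀ n → n ≤ nx n

  open Link

  idᴸ : Link
  idᴸ = record { nx = id ; nxᴾ = PR₁-id ; nx-≥ = λ _ → ≤-refl }

  module _ (L : Link) where

    -- The hidden choice between n and its successor.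
    c : ℕ → ℕ
    c n = ifz (bit n) n (nx L n)

    cAt : ℕ → ℕ → ℕ
    cAt k n = ifz (bitAt k n) n (nx L n)

    q : ℕ → ℕ
    q n = h (c n)

    -- The second conjunct removes `hist 0`, which is 0; the locations are the histories
    -- `hist (suc n)`.
    is-loc : ℕ → ℕ
    is-loc l = and (valid l) l

    r : ℕ → ℕ
    r l = and (is-loc l) (q (pred (len l)))

    ifz-≥ : ∀ b n → n ≤ ifz b n (nx L n)
    ifz-≥ zero n = ≤-refl
    ifz-≥ (suc b) n = nx-≥ L n

    c-≥ : ∀ n → n ≤ c n
    c-≥ n = ifz-≥ (bit n) n

    -- Holds for every `k`, even one too short to contain `bit n`. In this way a small value of
    -- `cAt` certifies that its argument lay within the history.
    cAt-≥ : ∀ k n → n ≤ cAt k n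
    cAt-≥ k n = ifz-≥ (bitAt k n) n

    ifz-≤ : ∀ b n → ifz b n (nx L n) ≤ nx L n
    ifz-≤ zero n = nx-≥ L n
    ifz-≤ (suc b) n = ≤-refl

    cAt-hist : ∀ {n N} → n < N → cAt (hist N) n ≡ c n
    cAt-hist {n} n<N = cong (λ b → ifz b n (nx L n)) (bitAt-hist n<N)

    hAt-hist : ∀ {n N} → suc n < N → hAt (hist N) n ≡ h n
    hAt-hist = bitAt-hist

    PR₁-cAt : ∀ {k n} → PR₁ k → PR₁ n → PR₁ (λ x → cAt (k x) (n x))
    PR₁-cAt K N = PR₁-ifz (PR₁-bitAt K N) N (PR₁-∘ (nxᴾ L) N)

    PR₁-hAt : ∀ {k n} → PR₁ k → PR₁ n → PR₁ (λ x → hAt (k x) (n x))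
    PR₁-hAt K N = PR₁-bitAt K (PR₁-suc N)

    PR₁-is-loc : ∀ {f} → PR₁ f → PR₁ (λ x → is-loc (f x))
    PR₁-is-loc F = PR₁-and (PR₁-valid F) F

    abstract
      Rec₁-q : Rec₁ q
      -- Since `c n` is at most `nx n`, a history of length `nx n + 2` contains the bit `suc (c n)`.
      Rec₁-q = Rec₁-ext (Rec₁-PR₂ {λ k n → hAt k (cAt k n)} (PR₁-hAt fstᴾ (PR₁-cAt fstᴾ sndᴾ))
          (Rec₁-∘ Rec₁-hist (Rec₁-PR (PR₁-suc (PR₁-suc (nxᴾ L))))) (Rec₁-PR PR₁-id)) ok
        where
        ok : ∀ n → hAt (hist (suc (suc (nx L n)))) (cAt (hist (suc (suc (nx L n)))) n) ≡ q n
        ok n rewrite cAt-hist {n} {suc (suc (nx L n))} (s≤s (m≤n⇒m≤1+n (nx-≥ L n))) =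
          hAt-hist (s≤s (s≤s (ifz-≤ (bit n) n)))

      Rec₁-r : Rec₁ r
      Rec₁-r = Rec₁-PR₂ {and} (PR₁-and fstᴾ sndᴾ) (Rec₁-PR (PR₁-is-loc PR₁-id))
        (Rec₁-∘ Rec₁-q (Rec₁-PR (PR₁-pred (PR₁-len PR₁-id))))

    loc-sound : ∀ l → is-loc l ≢ 0 → Σ ℕ λ n → l ≡ hist (suc n)
    loc-sound l p with and-true {valid l} p
    ... | v , l≢0 with valid-sound l v
    ... | zero , eq = ⊥-elim (l≢0 (trans eq hist-0))
    ... | suc n , eq = n , eq

    loc-hist : ∀ n → is-loc (hist (suc n)) ≢ 0
    loc-hist n = and-intro (valid-hist (suc n)) (hist≢0 n)

    -- A primitive recursive procedure that decides r on the locations in N has only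
    -- finitely many of them to deal with: it predicts h m from hist (suc m).
    r-hard : ∀ {N f} → PR₁ N → PR₁ f →
             (∀ n → N (hist (suc n)) ≢ 0 → nz (f (hist (suc n))) ≡ nz (q n)) →
             ¬ ¬ (Σ ℕ λ B → ∀ n → B ≤ n → N (hist (suc n)) ≡ 0)
    r-hard {N} {f} Nᴾ fᴾ correct = silent Fᴾ wrong >>= λ { (B , quiet) → return (B , λ n B≤n →
        eventually n (quiet (suc (c n)) (≤-trans B≤n (m≤n⇒m≤1+n (c-≥ n))))) }
      where
      cond : ℕ → ℕ → ℕ
      -- At stage `m` the next bit is `h (pred m)`, so it equals `q n` exactly when `c n` is
      -- `pred m`.
      cond n k = and (eq (cAt k n) (pred (len k))) (N (histAt k (suc n)))
      hit : ℕ → ℕ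
      hit k = search (λ n → cond n k) (len k)
      F : ℕ → ℕ
      -- `hit k` is `suc n` for the `n` found, hence already the length of its location. The answer
      -- of `f` is negated: if `f` is correct, the prediction fails.
      F k = ifz (hit k) 0 (suc (not (f (histAt k (hit k)))))
      hitᴾ : PR₁ hit
      hitᴾ = PR₁-search {f = cond} (PR₁-len PR₁-id) (PR₁-and (PR₁-eq (PR₁-cAt sndᴾ fstᴾ) (PR₁-pred (PR₁-len sndᴾ)))
        (PR₁-∘ Nᴾ (PR₁-histAt sndᴾ (PR₁-suc fstᴾ))))
      Fᴾ : PR₁ F
      Fᴾ = PR₁-ifz hitᴾ (PR₁-const 0) (PR₁-suc (PR₁-not (PR₁-∘ fᴾ (PR₁-histAt PR₁-id hitᴾ))))
      cond-hist : ∀ {n} m → n < m → cond n (hist m) ≡ and (eq (c n) (pred m)) (N (hist (suc n)))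
      cond-hist {n} m n<m rewrite cAt-hist n<m | len-hist m | histAt-hist n<m = refl
      wrong : ∀ m → F (hist m) ≢ 0 → bit m ≢ pred (F (hist m))
      wrong m F≢0 confirmed with hit (hist m) in s
      ... | zero = F≢0 refl
      ... | suc n with search-some (λ n → cond n (hist m)) (len (hist m)) s
      ... | n<len , ok , _ with subst (n <_) (len-hist m) n<len
      ... | n<m with and-true {eq (c n) (pred m)} (subst (_≢ 0) (cond-hist m n<m) ok)
      ... | e , Nn = not-nz (f (hist (suc n))) (begin
            nz (not (f (hist (suc n))))             ≡⟨ cong (λ k → nz (not (f k))) (sym (histAt-hist n<m)) ⟩
            nz (not (f (histAt (hist m) (suc n))))  ≡⟨ cong nz (sym confirmed) ⟩
            nz (bit m)                              ≡⟨ cong (nz ∘ bit) (sym (suc-pred-c n<m)) ⟩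
            nz (q n)                                ≡⟨ sym (correct n Nn) ⟩
            nz (f (hist (suc n)))                   ∎)
        where
        open ≡-Reasoning
        suc-pred-c : n < m → suc (c n) ≡ m
        suc-pred-c n<m = trans (cong suc (eq-true e)) (suc-pred m {{≢-nonZero λ { refl → n≮0 n<m }}})
      eventually : ∀ n → F (hist (suc (c n))) ≡ 0 → N (hist (suc n)) ≡ 0
      eventually n z with zero? (N (hist (suc n)))
      ... | inj₁ done = done
      ... | inj₂ Nn = ⊥-elim (F≢0 (search-hit (λ n → cond n k) (len k) (subst (n <_) (sym (len-hist (suc (c n)))) n<)
            (subst (_≢ 0) (sym (cond-hist (suc (c n)) n<)) (and-intro (λ z → 1+n≢0 (trans (sym (eq-refl (c n))) z)) Nn))) z)
        where
        k = hist (suc (c n))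
        n< : n < suc (c n)
        n< = s≤s (c-≥ n)
        F≢0 : ∀ {s g} → s ≢ 0 → ifz s 0 (suc g) ≢ 0
        F≢0 {zero} p _ = p refl
        F≢0 {suc s} _ ()

    -- If `D` separates `n` from its successor, then `D′ n` betrays which of the two was chosen,
    -- that is whether `bit n` is zero. Predicting the opposite is always wrong, so this happens
    -- finitely often; `B ∸ n` mutes the stages before `B`.
    linked : ∀ {D D′} → PR₁ D → PR₁ D′ → ∀ B → (∀ n → B ≤ n → nz (D (c n)) ≡ nz (D′ n)) →
             ¬ ¬ (Σ ℕ λ B′ → ∀ n → B′ ≤ n → nz (D n) ≡ nz (D (nx L n)))
    linked {D} {D′} Dᴾ D′ᴾ B agree = silent Fᴾ wrong >>= λ { (B′ , quiet) →
        return (B + B′ , λ n le → eventually n (m+n≤o⇒m≤o B le) (quiet n (m+n≤o⇒n≤o B le))) }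
      where
      G : ℕ → ℕ
      G n = ifz (xor (D n) (D (nx L n))) 0 (ifz (B ∸ n) (suc (xor (D (nx L n)) (D′ n))) 0)
      Gᴾ : PR₁ G
      Gᴾ = PR₁-ifz (PR₁-xor Dᴾ Dn) (PR₁-const 0)
             (PR₁-ifz (PR₁-∸ (PR₁-const B) PR₁-id) (PR₁-suc (PR₁-xor Dn D′ᴾ)) (PR₁-const 0))
        where
        Dn : PR₁ (λ n → D (nx L n))
        Dn = PR₁-∘ Dᴾ (nxᴾ L)
      F : ℕ → ℕ
      F k = G (len k)
      Fᴾ : PR₁ F
      Fᴾ = PR₁-∘ Gᴾ (PR₁-len PR₁-id)
      wrong′ : ∀ n → G n ≢ 0 → bit n ≢ pred (G n)
      wrong′ n G≢0 e with xor (D n) (D (nx L n)) in x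
      ... | zero = G≢0 refl
      ... | suc _ with B ∸ n in m
      ... | suc _ = G≢0 refl
      ... | zero = 1+n≢0 (trans (sym x) (xor-same (same (bit n) refl)))
        where
        choice : nz (D (ifz (bit n) n (nx L n))) ≡ nz (D′ n)
        choice = agree n (m∸n≡0⇒m≤n m)
        same : ∀ b → bit n ≡ b → nz (D n) ≡ nz (D (nx L n))
        same zero b0 = trans (trans (cong (λ b → nz (D (ifz b n (nx L n)))) (sym b0)) choice)
                             (sym (xor-zero (trans (sym e) b0)))
        same (suc b) b1 = ⊥-elim (1+n≢0 (trans (sym b1) (trans e (xor-same
          (trans (cong (λ b → nz (D (ifz b n (nx L n)))) (sym b1)) choice)))))
      wrong : ∀ n → F (hist n) ≢ 0 → bit n ≢ pred (F (hist n))
      wrong n rewrite len-hist n = wrong′ n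
      eventually : ∀ n → B ≤ n → F (hist n) ≡ 0 → nz (D n) ≡ nz (D (nx L n))
      eventually n B≤n z rewrite len-hist n | m≤n⇒m∸n≡0 B≤n with xor (D n) (D (nx L n)) in x
      ... | zero = xor-zero x
      eventually n B≤n () | suc _

-- Complementary pieces of q are disjoint.

module Disjointness where

  open PrimitiveRecursion
  open Machine
  open Histories
  open Elements

  open Link

  mx mn : ℕ → ℕ → ℕ
  mx a b = ifz (a ∸ b) b a
  mn a b = ifz (a ∸ b) a b

  PR₁-mx : ∀ {f g} → PR₁ f → PR₁ g → PR₁ (λ x → mx (f x) (g x))
  PR₁-mx F G = PR₁-ifz (PR₁-∸ F G) G F

  PR₁-mn : ∀ {f g} → PR₁ f → PR₁ g → PR₁ (λ x → mn (f x) (g x))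
  PR₁-mn F G = PR₁-ifz (PR₁-∸ F G) F G

  data Ordered (a b : ℕ) : ℕ → ℕ → Set where
    ascending  : a ≤ b → Ordered a b b a
    descending : b < a → Ordered a b a b

  ordered : ∀ a b → Ordered a b (mx a b) (mn a b)
  ordered a b with a ∸ b in e
  ... | zero = ascending (m∸n≡0⇒m≤n e)
  ... | suc d = descending (≰⇒> λ a≤b → 1+n≢0 (trans (sym e) (m≤n⇒m∸n≡0 a≤b)))

  mx-≥ˡ : ∀ a b → a ≤ mx a b
  mx-≥ˡ a b with mx a b | mn a b | ordered a b
  ... | _ | _ | ascending le = le
  ... | _ | _ | descending _ = ≤-refl

  mx-≥ʳ : ∀ a b → b ≤ mx a b
  mx-≥ʳ a b with mx a b | mn a b | ordered a b
  ... | _ | _ | ascending _ = ≤-refl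
  ... | _ | _ | descending lt = <⇒≤ lt

  mn<mx : ∀ {a b} → a ≢ b → mn a b < mx a b
  mn<mx {a} {b} a≢b with mx a b | mn a b | ordered a b
  ... | _ | _ | ascending le = ≤∧≢⇒< le a≢b
  ... | _ | _ | descending lt = lt

  both : ∀ {P : ℕ → Set} a b → P a → P b → P (mx a b) × P (mn a b)
  both a b p q with mx a b | mn a b | ordered a b
  ... | _ | _ | ascending _ = q , p
  ... | _ | _ | descending _ = p , q

  ⁺-large : ∀ a m → pred m ≢ 0 → (a ⁺) m ≡ nz (a (pred (pred m)))
  ⁺-large a zero p = ⊥-elim (p refl)
  ⁺-large a (suc zero) p = ⊥-elim (p refl)
  ⁺-large a (suc (suc m)) _ = refl

  nz-apart : ∀ {a b} → a ≢ 0 → not b ≢ 0 → nz a ≢ nz b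
  nz-apart {zero} p _ _ = p refl
  nz-apart {suc a} {zero} _ _ ()
  nz-apart {suc a} {suc b} _ p _ = p refl

  -- Two complementary pieces of q have only trivial common lower bounds: if f and g
  -- reduce Z to the two pieces, then x compares two different bits, and unless x itself
  -- is large enough to compute the earlier one, the earlier bit predicts the later one.
  module _ (L : Link) {D : ℕ → ℕ} (Dᴾ : PR₁ D) (closed : ∀ n → nz (D (nx L n)) ≡ nz (D n)) where

    closed-c : ∀ n → nz (D (c L n)) ≡ nz (D n)
    closed-c n with bit n
    ... | zero = refl
    ... | suc _ = closed n

    private
      A A′ : ℕ → Bool
      A = piece D (q L) ⁺
      A′ = piece (λ n → not (D n)) (q L) ⁺

    pieces-disjoint : ∀ Z → Z ≤ᵖʳₘ A → Z ≤ᵖʳₘ A′ → ¬ ¬ (Z ≤ᵖʳₘ (const 0 ⁺))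
    pieces-disjoint Z Z≤A Z≤A′ with reduction Z A Z≤A | reduction Z A′ Z≤A′
    ... | f , fᴾ , fok | g , gᴾ , gok = silent Fᴾ wrong >>= λ { (B , quiet) → return
          (decidable Z (dᴾ B) (d-ok B quiet)) }
      where
      α β : ℕ → ℕ
      α x = pred (pred (f x))
      β x = pred (pred (g x))
      αᴾ : PR₁ α
      αᴾ = PR₁-pred (PR₁-pred fᴾ)
      βᴾ : PR₁ β
      βᴾ = PR₁-pred (PR₁-pred gᴾ)
      crit : ℕ → ℕ
      crit x = and (pred (f x)) (and (pred (g x)) (and (D (α x)) (not (D (β x)))))
      critᴾ : PR₁ crit
      critᴾ = PR₁-and (PR₁-pred fᴾ) (PR₁-and (PR₁-pred gᴾ) (PR₁-and (PR₁-∘ Dᴾ αᴾ) (PR₁-not (PR₁-∘ Dᴾ βᴾ))))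
      crit-spec : ∀ x → crit x ≢ 0 →
                  Z x ≡ nz (h (c L (α x))) × Z x ≡ nz (h (c L (β x))) × c L (α x) ≢ c L (β x)
      crit-spec x cr with and-true {pred (f x)} cr
      ... | f2 , cr₁ with and-true {pred (g x)} cr₁
      ... | g2 , cr₂ with and-true {D (α x)} cr₂
      ... | Dα , Dβ =
        trans (fok x) (trans (⁺-large (piece D (q L)) (f x) f2) (nz-and-true (q L (α x)) Dα)) ,
        trans (gok x) (trans (⁺-large (piece (λ n → not (D n)) (q L)) (g x) g2) (nz-and-true (q L (β x)) Dβ)) ,
        -- `c` never leaves a side of `D`, so equal choices would put `α x` and `β x` on the same
        -- side.
        λ e → nz-apart Dα Dβ (trans (sym (closed-c (α x))) (trans (cong (nz ∘ D) e) (closed-c (β x))))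
      easy : ℕ → ℕ
      easy x = ifz (f x) 1 (ifz (g x) 1 0)
      easy-ok′ : ∀ a b {z} → z ≡ A a → z ≡ A′ b →
        and (pred a) (and (pred b) (and (D (pred (pred a))) (not (D (pred (pred b)))))) ≡ 0 →
        z ≡ nz (ifz a 1 (ifz b 1 0))
      easy-ok′ zero b p p′ _ = p
      easy-ok′ (suc zero) zero p p′ _ = p′
      easy-ok′ (suc zero) (suc b) p p′ _ = p
      easy-ok′ (suc (suc n)) zero p p′ _ = p′
      easy-ok′ (suc (suc n)) (suc zero) p p′ _ = p′
      easy-ok′ (suc (suc n)) (suc (suc n′)) p p′ cr with zero? (D n)
      ... | inj₁ z = trans p (nz-and-false (q L n) z)
      ... | inj₂ z with zero? (not (D n′))
      ... | inj₁ z′ = trans p′ (nz-and-false (q L n′) z′)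
      ... | inj₂ z′ = ⊥-elim (and-intro z z′ cr)
      cα cβ : ℕ → ℕ → ℕ
      cα k x = cAt L k (α x)
      cβ k x = cAt L k (β x)
      guess : ℕ → ℕ → ℕ
      guess k x = hAt k (mn (cα k x) (cβ k x))
      guessᴾ : ∀ {k x} → PR₁ k → PR₁ x → PR₁ (λ y → guess (k y) (x y))
      guessᴾ K X = PR₁-hAt L K (PR₁-mn (PR₁-cAt L K (PR₁-∘ αᴾ X)) (PR₁-cAt L K (PR₁-∘ βᴾ X)))
      cond : ℕ → ℕ → ℕ
      cond x k = and (crit x) (eq (mx (cα k x) (cβ k x)) (pred (len k)))
      hit : ℕ → ℕ
      -- The search runs up to the history taken as a number. Whenever stage `suc m` is silent, a
      -- critical `x` with maximum `m` is at least `hist (suc m)`.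
      hit k = search (λ x → cond x k) k
      hitᴾ : PR₁ hit
      hitᴾ = PR₁-search {f = cond} PR₁-id (PR₁-and (PR₁-∘ critᴾ fstᴾ)
        (PR₁-eq (PR₁-mx (PR₁-cAt L sndᴾ (PR₁-∘ αᴾ fstᴾ)) (PR₁-cAt L sndᴾ (PR₁-∘ βᴾ fstᴾ))) (PR₁-pred (PR₁-len sndᴾ))))
      F : ℕ → ℕ
      F k = ifz (hit k) 0 (suc (not (guess k (pred (hit k)))))
      Fᴾ : PR₁ F
      Fᴾ = PR₁-ifz hitᴾ (PR₁-const 0) (PR₁-suc (PR₁-not (guessᴾ PR₁-id (PR₁-pred hitᴾ))))
      known : ∀ x k m → k ≡ hist (suc m) → α x ≤ m → β x ≤ m →
              cα k x ≡ c L (α x) × cβ k x ≡ c L (β x)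
      known x _ m refl a b = cAt-hist L (s≤s a) , cAt-hist L (s≤s b)
      guess-ok : ∀ x m {N} → crit x ≢ 0 → mx (c L (α x)) (c L (β x)) ≡ m → suc m ≤ N →
                 nz (guess (hist N) x) ≡ Z x × nz (h m) ≡ Z x
      guess-ok x m {suc N} cr e (s≤s m≤N) with crit-spec x cr
      ... | zα , zβ , c≢ with both {λ n → nz (h n) ≡ Z x} (c L (α x)) (c L (β x)) (sym zα) (sym zβ)
      ... | top , bot with known x (hist (suc N)) N refl
               (≤-trans (c-≥ L (α x)) (≤-trans (mx-≥ˡ (c L (α x)) (c L (β x))) (≤-trans (≤-reflexive e) m≤N)))
               (≤-trans (c-≥ L (β x)) (≤-trans (mx-≥ʳ (c L (α x)) (c L (β x))) (≤-trans (≤-reflexive e) m≤N)))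
      ... | kα , kβ = trans (cong nz (trans (cong (hAt (hist (suc N))) (cong₂ mn kα kβ))
                               (hAt-hist L (s≤s (≤-trans (mn<mx c≢) (≤-trans (≤-reflexive e) m≤N)))))) bot
                    , trans (cong (nz ∘ h) (sym e)) top
      -- Positions beyond the history may be misread, but by `cAt-≥` a maximum equal to `m` forces
      -- `α x` and `β x` to be at most `m`, where reading is reliable.
      cond-c : ∀ x m → crit x ≢ 0 → mx (cα (hist (suc m)) x) (cβ (hist (suc m)) x) ≡ m →
               mx (c L (α x)) (c L (β x)) ≡ m
      cond-c x m cr e with known x (hist (suc m)) m refl
               (≤-trans (cAt-≥ L (hist (suc m)) (α x)) (≤-trans (mx-≥ˡ (cα (hist (suc m)) x) (cβ (hist (suc m)) x)) (≤-reflexive e)))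
               (≤-trans (cAt-≥ L (hist (suc m)) (β x)) (≤-trans (mx-≥ʳ (cα (hist (suc m)) x) (cβ (hist (suc m)) x)) (≤-reflexive e)))
      ... | kα , kβ = trans (sym (cong₂ mx kα kβ)) e
      c-cond : ∀ x m → mx (c L (α x)) (c L (β x)) ≡ m →
               mx (cα (hist (suc m)) x) (cβ (hist (suc m)) x) ≡ m
      c-cond x m e with known x (hist (suc m)) m refl
               (≤-trans (c-≥ L (α x)) (≤-trans (mx-≥ˡ (c L (α x)) (c L (β x))) (≤-reflexive e)))
               (≤-trans (c-≥ L (β x)) (≤-trans (mx-≥ʳ (c L (α x)) (c L (β x))) (≤-reflexive e)))
      ... | kα , kβ = trans (cong₂ mx kα kβ) e
      wrong : ∀ m → F (hist m) ≢ 0 → bit m ≢ pred (F (hist m))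
      wrong m F≢0 e with hit (hist m) in s
      ... | zero = F≢0 refl
      ... | suc x with search-some (λ x → cond x (hist m)) (hist m) s
      wrong zero F≢0 e | suc x | x<k , _ = n≮0 (subst (x <_) hist-0 x<k)
      wrong (suc m) F≢0 e | suc x | x<k , ok , _ with and-true {crit x} ok
      ... | cr , e′ with guess-ok x m cr (cond-c x m cr (trans (eq-true e′) (cong pred (len-hist (suc m))))) ≤-refl
      ... | gz , hz = not-nz (guess (hist (suc m)) x) (trans (cong nz (sym e)) (trans hz (sym gz)))
      d : ℕ → ℕ → ℕ
      -- The summand `hist B` supplies the history for the finitely many stages before `B`, at which
      -- predictions may still occur.
      d B x = ifz (crit x) (easy x) (guess (latest (x + hist B)) x)
      dᴾ : ∀ B → PR₁ (d B)
      dᴾ B = PR₁-ifz critᴾ (PR₁-ifz fᴾ (PR₁-const 1) (PR₁-ifz gᴾ (PR₁-const 1) (PR₁-const 0)))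
        (guessᴾ (PR₁-latest (PR₁-+ PR₁-id (PR₁-const (hist B)))) PR₁-id)
      d-ok : ∀ B → (∀ m → B ≤ m → F (hist m) ≡ 0) → ∀ x → Z x ≡ nz (d B x)
      d-ok B quiet x with zero? (crit x)
      ... | inj₁ z = trans (easy-ok′ (f x) (g x) (fok x) (gok x) z) (cong nz (sym (ifz-zero _ _ z)))
      ... | inj₂ cr with latest-spec (x + hist B)
      ... | N , e , max = trans (sym (proj₁ (guess-ok x m cr refl (max (suc m) big))))
                                (cong nz (trans (cong (λ k → guess k x) (sym e)) (sym (ifz-nonzero _ _ cr))))
        where
        m = mx (c L (α x)) (c L (β x))
        F-hit : ∀ {s g} → s ≢ 0 → ifz s 0 (suc g) ≢ 0
        F-hit {zero} p _ = p refl
        F-hit {suc s} _ ()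
        big : hist (suc m) ≤ x + hist B
        big with B ≤? suc m
        ... | no B≰ = ≤-trans (hist-mono (<⇒≤ (≰⇒> B≰))) (m≤n+m (hist B) x)
        ... | yes B≤ = ≤-trans (≮⇒≥ λ x< → F-hit (search-hit (λ x → cond x (hist (suc m))) (hist (suc m)) x<
                (and-intro cr (λ z → 1+n≢0 (trans (sym (eq-refl m)) (trans (sym (cong₂ eq (c-cond x m refl)
                  (cong pred (len-hist (suc m))))) z))))) (quiet (suc m) B≤)) (m≤m+n x (hist B))

-- Inseparability, and successors within the classes of a partition.

module Links where

  open PrimitiveRecursion
  open Machine
  open Histories
  open Elements
  open Disjointness

  open Link

  module Relations {D : Set} (_⊑_ : D → D → Set) (_∨_ : D → D → D) where

    _⊴_ : D → D → Set
    a ⊴ b = ¬ ¬ (a ⊑ b)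

    Disjoint : D → D → D → Set
    Disjoint o u v = ∀ z → z ⊴ u → z ⊴ v → z ⊴ o

    -- The parts of r lie below the corresponding parts of p and of q. A location of r knows both
    -- the place `n` in q and the place `c n` in p, so it ties the two splittings together. The
    -- structure is arbitrary because the same notion interprets the formulas in all models.
    Inseparable : D → D → D → D → D → D → Set
    Inseparable p o q r x y = ∀ u u′ v v′ w w′ →
      p ⊴ (u ∨ u′) → q ⊴ (v ∨ v′) → r ⊴ (w ∨ w′) →
      w ⊴ u → w ⊴ v → w′ ⊴ u′ → w′ ⊴ v′ →
      Disjoint o u u′ → Disjoint o v v′ → x ⊴ u → y ⊴ u′ → ⊥

  open Relations _≤C_ _∨C_

  PR₁-par : ∀ {f} → PR₁ f → PR₁ (λ x → parᴺ (f x))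
  PR₁-par = PR₁-∘ {parᴺ} (PR₁-ext (PR₁-natrec {h = λ _ b _ → not b} (PR₁-const 0) PR₁-id
    (PR₁-not (PR₁-π₂ fstᴾ))) ok)
    where
    isZ : ∀ n → not n ≡ isZᴺ n
    isZ zero = refl
    isZ (suc n) = refl
    ok : ∀ n → natrec 0 (λ _ b → not b) n ≡ parᴺ n
    ok zero = refl
    ok (suc n) = trans (cong not (ok n)) (isZ (parᴺ n))

  PR₁-half : ∀ {f} → PR₁ f → PR₁ (λ x → halfᴺ (f x))
  PR₁-half = PR₁-∘ {halfᴺ} (PR₁-ext (PR₁-natrec {h = λ k b _ → parᴺ k + b} (PR₁-const 0) PR₁-id
    (PR₁-+ (PR₁-par (PR₁-π₁ fstᴾ)) (PR₁-π₂ fstᴾ))) ok)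
    where
    ok : ∀ n → natrec 0 (λ k b → parᴺ k + b) n ≡ halfᴺ n
    ok zero = refl
    ok (suc n) = cong (parᴺ n +_) (ok n)

  condB-left : ∀ {m} {b a : Bool} → m ≡ 0 → condB m b a ≡ a
  condB-left refl = refl

  condB-right : ∀ {m} {b a : Bool} → m ≢ 0 → condB m b a ≡ b
  condB-right {zero} p = ⊥-elim (p refl)
  condB-right {suc m} _ = refl

  module _ (a : ℕ → ℕ) {D : ℕ → ℕ} (Dᴾ : PR₁ D) where

    private
      U U′ : ℕ → Bool
      U = piece D a ⁺
      U′ = piece (λ n → not (D n)) a ⁺

    pieces-cover : (a ⁺) ≤ᵖʳₘ (U ⊕ U′)
    pieces-cover = reduce (a ⁺) (U ⊕ U′) (λ x → ifz (side x) (suc (2 * x)) (2 * x))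
        (PR₁-ifz (PR₁-cases 1 1 Dᴾ) (PR₁-suc Twice) Twice) ok
      where
      side : ℕ → ℕ
      side = cases 1 1 D
      Twice : PR₁ (λ x → 2 * x)
      Twice = PR₁-+ PR₁-id (PR₁-+ PR₁-id (PR₁-const 0))
      value : ∀ n → nz (a n) ≡ (U ⊕ U′) (ifz (D n) (suc (2 * suc (suc n))) (2 * suc (suc n)))
      value n with zero? (D n)
      ... | inj₁ z = trans (sym (nz-and-true {not (D n)} (a n) (not-zero z)))
        (trans (sym (⊕-odd U U′ (suc (suc n)))) (cong (U ⊕ U′) (sym (ifz-zero (suc (2 * suc (suc n))) (2 * suc (suc n)) z))))
      ... | inj₂ p = trans (sym (nz-and-true {D n} (a n) p))
        (trans (sym (⊕-even U U′ (suc (suc n)))) (cong (U ⊕ U′) (sym (ifz-nonzero (suc (2 * suc (suc n))) (2 * suc (suc n)) p))))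
      ok : ∀ x → (a ⁺) x ≡ (U ⊕ U′) (ifz (side x) (suc (2 * x)) (2 * x))
      ok 0 = sym (⊕-even U U′ 0)
      ok 1 = sym (⊕-even U U′ 1)
      ok (suc (suc n)) = value n

  module Classes (cls : ℕ → ℕ) (clsᴾ : PR₁ cls) (w : ℕ) (periodic : ∀ n → cls (suc w + n) ≡ cls n) where

    private
      same : ℕ → ℕ → ℕ
      same d n = eq (cls (suc (d + n))) (cls n)

    -- By periodicity the search succeeds at `d = w` at the latest.
    successor : ℕ → ℕ
    successor n = suc (pred (search (λ d → same d n) (suc w)) + n)

    private
      data Next (n : ℕ) : ℕ → Set where
        at : ∀ d → cls (suc (d + n)) ≡ cls n → (∀ d′ → d′ < d → cls (suc (d′ + n)) ≢ cls n) →
             Next n (suc (d + n))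

      next-spec : ∀ n → Next n (successor n)
      next-spec n with search (λ d → same d n) (suc w) | search-spec (λ d → same d n) (suc w)
      ... | _ | none p = ⊥-elim (1+n≢0 (trans (sym (trans (cong (λ m → eq m (cls n)) (periodic n)) (eq-refl (cls n))))
                                          (p w ≤-refl)))
      ... | _ | found d _ hit min = at d (eq-true hit) λ d′ d′<d e →
        1+n≢0 (trans (sym (trans (cong (λ m → eq m (cls n)) e) (eq-refl (cls n)))) (min d′ d′<d))

    link : Link
    link = record
      { nx = successor
      ; nxᴾ = PR₁-suc (PR₁-+ (PR₁-pred (PR₁-search {f = same} (PR₁-const (suc w))
                (PR₁-eq (PR₁-∘ clsᴾ (PR₁-suc (PR₁-+ fstᴾ sndᴾ))) (PR₁-∘ clsᴾ sndᴾ)))) PR₁-id)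
      ; nx-≥ = λ n → m≤n⇒m≤1+n (m≤n+m n _) }

    successor-class : ∀ n → cls (successor n) ≡ cls n
    successor-class n with successor n | next-spec n
    ... | _ | at d e _ = e

    successor-> : ∀ n → n < successor n
    successor-> n = s≤s (m≤n+m n _)

    successor-least : ∀ {n m} → n < m → cls m ≡ cls n → successor n ≤ m
    successor-least {n} {m} n<m e with successor n | next-spec n
    ... | _ | at d _ min = ≮⇒≥ λ m< → min (m ∸ suc n) (go m<)
          (trans (cong cls (trans (sym (+-suc _ n)) (m∸n+n≡m n<m))) e)
      where
      go : m < suc (d + n) → m ∸ suc n < d
      go m< = +-cancelʳ-< n _ _ (≤-trans (≤-reflexive (trans (sym (+-suc _ n)) (m∸n+n≡m n<m))) (≤-pred m<))

    private
      ascend : ∀ {D : ℕ → ℕ} B → (∀ n → B ≤ n → nz (D n) ≡ nz (D (successor n))) →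
               ∀ d {m n} → B ≤ m → m ≤ n → n ∸ m ≤ d → cls m ≡ cls n → nz (D m) ≡ nz (D n)
      ascend B step d {m} {n} B≤m m≤n le e with m≤n⇒m<n∨m≡n m≤n
      ascend B step d B≤m m≤n le e | inj₂ refl = refl
      ascend B step zero B≤m m≤n le e | inj₁ m<n = ⊥-elim (<⇒≱ m<n (m∸n≡0⇒m≤n (n≤0⇒n≡0 le)))
      ascend B step (suc d) {m} {n} B≤m m≤n le e | inj₁ m<n = trans (step m B≤m)
        (ascend B step d (≤-trans B≤m (<⇒≤ (successor-> m))) (successor-least m<n (sym e))
          (≤-pred (≤-trans (∸-monoʳ-< (successor-> m) (successor-least m<n (sym e))) le))
          (trans (successor-class m) e))

    class-constant : ∀ {D : ℕ → ℕ} B → (∀ n → B ≤ n → nz (D n) ≡ nz (D (successor n))) →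
                     ∀ {m n} → B ≤ m → B ≤ n → cls m ≡ cls n → nz (D m) ≡ nz (D n)
    class-constant B step {m} {n} B≤m B≤n e with ≤-total m n
    ... | inj₁ m≤n = ascend B step (n ∸ m) B≤m m≤n ≤-refl e
    ... | inj₂ n≤m = sym (ascend B step (m ∸ n) B≤n n≤m ≤-refl (sym e))

-- Splittings of p, q and r, and their agreement on locations.

module Splittings where

  open PrimitiveRecursion
  open Machine
  open Histories
  open Elements
  open Disjointness
  open Links

  open Link
  open Relations _≤C_ _∨C_

  -- With the identity link both options of the choice coincide, so this lists `h` itself; as an
  -- instance of `q` it inherits the lemmas on `q`.
  p : ℕ → ℕ
  p = q idᴸ

  c-id : ∀ n → c idᴸ n ≡ n
  c-id n with bit n
  ... | zero = refl
  ... | suc _ = refl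

  p≡h : ∀ n → p n ≡ h n
  p≡h n = cong h (c-id n)

  abstract
    Rec₁-piece : ∀ {D a} → PR₁ D → Rec₁ a → Rec₁ (piece D a)
    Rec₁-piece Dᴾ A = Rec₁-PR₂ {and} (PR₁-and fstᴾ sndᴾ) (Rec₁-PR Dᴾ) A

  Pᶜ : CElt
  Pᶜ = el p (Rec₁-q idᴸ)

  Qᶜ Rᶜ : Link → CElt
  Qᶜ L = el (q L) (Rec₁-q L)
  Rᶜ L = el (r L) (Rec₁-r L)

  Pieceᶜ : ∀ D → PR₁ D → CElt
  Pieceᶜ D Dᴾ = el (piece D p) (Rec₁-piece Dᴾ (Rec₁-q idᴸ))

  index : ℕ → ℕ
  index l = pred (len l)

  indexᴾ : PR₁ index
  indexᴾ = PR₁-pred (PR₁-len PR₁-id)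

  index-hist : ∀ n → index (hist (suc n)) ≡ n
  index-hist n = cong pred (len-hist (suc n))

  r-hist : ∀ L n → nz (r L (hist (suc n))) ≡ nz (q L n)
  r-hist L n = trans (nz-and-true {is-loc L (hist (suc n))} (q L (index (hist (suc n)))) (loc-hist L n))
                     (cong (nz ∘ q L) (index-hist n))

  r-off : ∀ L (D : ℕ → ℕ) l → is-loc L l ≡ 0 → nz (and (D l) (r L l)) ≡ false
  r-off L D l z with D l
  ... | zero = refl
  ... | suc _ = nz-and-false (q L (index l)) z

  -- A decision procedure for an infinite piece would decide the bits at infinitely many locations,
  -- against `r-hard`.
  piece-≢0 : ∀ D → PR₁ D → (∀ B → Σ ℕ λ n → B ≤ n × D n ≢ 0) → ¬ ((piece D p ⁺) ≤ᵖʳₘ (const 0 ⁺))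
  piece-≢0 D Dᴾ inf le with decide (piece D p ⁺) le
  ... | d , dᴾ , ok = r-hard idᴸ {N} {f} (PR₁-∘ Dᴾ indexᴾ) (PR₁-∘ dᴾ (PR₁-suc (PR₁-suc indexᴾ))) correct
      λ { (B , fin) → let n , B≤n , Dn = inf B in
          Dn (trans (cong D (sym (index-hist n))) (fin n B≤n)) }
    where
    N f : ℕ → ℕ
    N l = D (index l)
    f l = d (suc (suc (index l)))
    correct : ∀ n → N (hist (suc n)) ≢ 0 → nz (f (hist (suc n))) ≡ nz (p n)
    correct n Nn rewrite index-hist n = trans (sym (ok (suc (suc n)))) (nz-and-true (p n) Nn)

  module _ (L : Link) where

    piece-r-≤ : ∀ {E a t E′} → PR₁ t →
      (∀ n → nz (and (E n) (q L n)) ≡ nz (and (E′ (t (hist (suc n)))) (a (t (hist (suc n)))))) →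
      (piece (E ∘ index) (r L) ⁺) ≤ᵖʳₘ (piece E′ a ⁺)
    piece-r-≤ {E} {a} {t} {E′} tᴾ ok =
      ⁺-≤ (piece (E ∘ index) (r L)) (piece E′ a ⁺) {0} {1} refl refl
        (λ l → ifz (is-loc L l) 1 (suc (suc (t l))))
        (PR₁-ifz (PR₁-is-loc L PR₁-id) (PR₁-const 1) (PR₁-suc (PR₁-suc tᴾ))) value
      where
      value : ∀ l → nz (piece (E ∘ index) (r L) l) ≡ (piece E′ a ⁺) (ifz (is-loc L l) 1 (suc (suc (t l))))
      value l with zero? (is-loc L l)
      ... | inj₁ z = trans (r-off L (E ∘ index) l z) (cong (piece E′ a ⁺) (sym (ifz-zero 1 _ z)))
      ... | inj₂ loc with loc-sound L l loc
      ... | n , refl = trans (nz-and-cong {E (index l)} (cong (nz ∘ E) (index-hist n)) (r-hist L n))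
        (trans (ok n) (cong (piece E′ a ⁺) (sym (ifz-nonzero 1 (suc (suc (t l))) loc))))

    -- p and q are split by place, r by the index of the location. From `hist (suc n)` both `n` and
    -- `c n` can be computed, which sends the parts of r into those of q and p; the latter works
    -- because `c n` is on the side of `n`.
    separable : ∀ {D} → PR₁ D → (∀ n → nz (D (nx L n)) ≡ nz (D n)) → ∀ X Y →
      proj₁ X ≤ᵖʳₘ (piece D p ⁺) → proj₁ Y ≤ᵖʳₘ (piece (not ∘ D) p ⁺) →
      ¬ Inseparable Pᶜ 𝟘 (Qᶜ L) (Rᶜ L) X Y
    separable {D} Dᴾ closed X Y X≤ Y≤ ins = ins
      (Pieceᶜ D Dᴾ) (Pieceᶜ (not ∘ D) D′ᴾ)
      (el (piece D (q L)) (Rec₁-piece Dᴾ (Rec₁-q L))) (el (piece (not ∘ D) (q L)) (Rec₁-piece D′ᴾ (Rec₁-q L)))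
      (el (piece (D ∘ index) (r L)) (Rec₁-piece (PR₁-∘ Dᴾ indexᴾ) (Rec₁-r L)))
      (el (piece (not ∘ D ∘ index) (r L)) (Rec₁-piece (PR₁-∘ D′ᴾ indexᴾ) (Rec₁-r L)))
      (return (pieces-cover p Dᴾ)) (return (pieces-cover (q L) Dᴾ)) (return (pieces-cover (r L) (PR₁-∘ Dᴾ indexᴾ)))
      (return (piece-r-≤ {D} {p} {at-c} {D} at-cᴾ (λ n → to-p D n (sym (closed-c L Dᴾ closed n)))))
      (return (piece-r-≤ {D} {q L} {index} {D} indexᴾ (to-q D)))
      (return (piece-r-≤ {not ∘ D} {p} {at-c} {not ∘ D} at-cᴾ
        (λ n → to-p (not ∘ D) n (nz-not-cong (sym (closed-c L Dᴾ closed n))))))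
      (return (piece-r-≤ {not ∘ D} {q L} {index} {not ∘ D} indexᴾ (to-q (not ∘ D))))
      (λ z z≤u z≤v → z≤u >>= λ a → z≤v >>= λ b → pieces-disjoint idᴸ Dᴾ (λ _ → refl) (proj₁ z) a b)
      (λ z z≤u z≤v → z≤u >>= λ a → z≤v >>= λ b → pieces-disjoint L Dᴾ closed (proj₁ z) a b)
      (return X≤) (return Y≤)
      where
      D′ᴾ : PR₁ (not ∘ D)
      D′ᴾ = PR₁-not Dᴾ
      at-c : ℕ → ℕ
      at-c l = cAt L l (index l)
      at-cᴾ : PR₁ at-c
      at-cᴾ = PR₁-cAt L PR₁-id indexᴾ
      at-c-hist : ∀ n → at-c (hist (suc n)) ≡ c L n
      at-c-hist n = trans (cong (cAt L (hist (suc n))) (index-hist n)) (cAt-hist L ≤-refl)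
      to-p : ∀ E n → nz (E n) ≡ nz (E (c L n)) →
             nz (and (E n) (q L n)) ≡ nz (and (E (at-c (hist (suc n)))) (p (at-c (hist (suc n)))))
      to-p E n e = nz-and-cong {E n} (trans e (cong (nz ∘ E) (sym (at-c-hist n))))
        (cong nz (sym (trans (cong p (at-c-hist n)) (p≡h (c L n)))))
      to-q : ∀ E n → nz (and (E n) (q L n)) ≡ nz (and (E (index (hist (suc n)))) (q L (index (hist (suc n)))))
      to-q E n = cong (λ m → nz (and (E m) (q L m))) (sym (index-hist n))

    -- If r splits along w ∨ w′, below a split u ∨ u′ of a ≥ r into disjoint parts, then
    -- the two splits agree on almost all locations: the mismatches lie below both parts.
    splits-agree : ∀ (a t : ℕ → ℕ) → PR₁ t → (∀ n → nz (q L n) ≡ nz (a (t (hist (suc n))))) →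
      ∀ (U U′ W W′ : CElt) →
      ∀ f → PR₁ f → (∀ x → (a ⁺) x ≡ (proj₁ U ⊕ proj₁ U′) (f x)) →
      ∀ g → PR₁ g → (∀ x → (r L ⁺) x ≡ (proj₁ W ⊕ proj₁ W′) (g x)) →
      W ≤C U → W′ ≤C U′ → Disjoint 𝟘 U U′ →
      ¬ ¬ (Σ ℕ λ B → ∀ n → B ≤ n →
        nz (parᴺ (f (suc (suc (t (hist (suc n))))))) ≡ nz (parᴺ (g (suc (suc (hist (suc n)))))))
    splits-agree a t tᴾ ta U U′ W W′ f fᴾ fok g gᴾ gok W≤U W′≤U′ disj
      with reduction (proj₁ W) (proj₁ U) W≤U | reduction (proj₁ W′) (proj₁ U′) W′≤U′
    ... | e , eᴾ , eok | e′ , e′ᴾ , e′ok =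
      -- At a mismatch exactly one of two routes leads into `U`: through `W` by `g` and `e`, or
      -- directly by `f`. The other route then leads into `U′`.
      disj Z (below U {sgᵢ} (PR₁-not sgᴾ) (PR₁-∘ eᴾ (PR₁-half gxᴾ)) (PR₁-half fxᴾ)
               (λ l m loc s → trans (gok (suc (suc l))) (trans (condB-left (not-true s)) (eok _)))
               (λ l m loc s → trans (via-a l loc) (condB-left (left-a l m (zero-not s)))))
             (below U′ {sg} sgᴾ (PR₁-∘ e′ᴾ (PR₁-half gxᴾ)) (PR₁-half fxᴾ)
               (λ l m loc s → trans (gok (suc (suc l))) (trans (condB-right s) (e′ok _)))
               (λ l m loc s → trans (via-a l loc) (condB-right (right-a l m s))))
        >>= λ Z≤0 → let d , dᴾ , dok = decide (piece M (r L) ⁺) Z≤0 in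
          r-hard L Mᴾ (PR₁-∘ dᴾ (PR₁-suc (PR₁-suc PR₁-id)))
            (λ n m → trans (sym (dok (suc (suc (hist (suc n)))))) (trans (nz-and-true (r L (hist (suc n))) m) (r-hist L n)))
        >>= λ { (B , fin) → return (B , λ n B≤n → xor-zero (fin n B≤n)) }
      where
      fx gx sf sg sgᵢ M : ℕ → ℕ
      fx l = f (suc (suc (t l)))
      gx l = g (suc (suc l))
      sf l = parᴺ (fx l)
      sg l = parᴺ (gx l)
      sgᵢ l = not (sg l)
      M l = xor (sf l) (sg l)
      fxᴾ : PR₁ fx
      fxᴾ = PR₁-∘ fᴾ (PR₁-suc (PR₁-suc tᴾ))
      gxᴾ : PR₁ gx
      gxᴾ = PR₁-∘ gᴾ (PR₁-suc (PR₁-suc PR₁-id))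
      sgᴾ : PR₁ sg
      sgᴾ = PR₁-par gxᴾ
      Mᴾ : PR₁ M
      Mᴾ = PR₁-xor (PR₁-par fxᴾ) sgᴾ
      Z : CElt
      Z = el (piece M (r L)) (Rec₁-piece Mᴾ (Rec₁-r L))
      zero-not : ∀ {b} → not b ≡ 0 → b ≢ 0
      zero-not {zero} ()
      zero-not {suc b} _ ()
      left-a : ∀ l → M l ≢ 0 → sg l ≢ 0 → sf l ≡ 0
      left-a l m s with zero? (sf l)
      ... | inj₁ z = z
      ... | inj₂ z = ⊥-elim (m (xor-same (trans (true-nz z) (sym (true-nz s)))))
      right-a : ∀ l → M l ≢ 0 → sg l ≡ 0 → sf l ≢ 0
      right-a l m s z = m (xor-same (cong nz (trans z (sym s))))
      via-a : ∀ l → is-loc L l ≢ 0 → nz (r L l) ≡ (proj₁ U ⊕ proj₁ U′) (fx l)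
      via-a l loc with loc-sound L l loc
      ... | n , refl = trans (r-hist L n) (trans (ta n) (fok (suc (suc (t l)))))
      below : ∀ (T : CElt) {s g₁ g₂ : ℕ → ℕ} → PR₁ s → PR₁ g₁ → PR₁ g₂ →
        (∀ l → M l ≢ 0 → is-loc L l ≢ 0 → s l ≢ 0 → nz (r L l) ≡ proj₁ T (g₁ l)) →
        (∀ l → M l ≢ 0 → is-loc L l ≢ 0 → s l ≡ 0 → nz (r L l) ≡ proj₁ T (g₂ l)) → Z ⊴ T
      below T {s} {g₁} {g₂} sᴾ g₁ᴾ g₂ᴾ one two = inhabited T >>= λ { (yes′ , Ty) → coinhabited T >>= λ { (no′ , Tn) →
        return (⁺-≤ (piece M (r L)) (proj₁ T) Ty Tn (map no′)
          (PR₁-ifz (PR₁-and Mᴾ (PR₁-is-loc L PR₁-id)) (PR₁-const no′) (PR₁-ifz sᴾ g₂ᴾ g₁ᴾ)) (value no′ Tn)) } }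
        where
        map : ℕ → ℕ → ℕ
        map no′ l = ifz (and (M l) (is-loc L l)) no′ (ifz (s l) (g₂ l) (g₁ l))
        value : ∀ no′ → proj₁ T no′ ≡ false → ∀ l → nz (piece M (r L) l) ≡ proj₁ T (map no′ l)
        value no′ Tn l with zero? (M l) | zero? (is-loc L l)
        ... | inj₁ z | _ = trans (nz-and-false (r L l) z)
                (trans (sym Tn) (cong (proj₁ T) (sym (ifz-zero no′ _ (cong (λ b → and b (is-loc L l)) z)))))
        ... | inj₂ m | inj₁ z = trans (r-off L M l z)
                (trans (sym Tn) (cong (proj₁ T) (sym (ifz-zero no′ _ (and-zero (M l) z)))))
          where
          and-zero : ∀ a {b} → b ≡ 0 → and a b ≡ 0
          and-zero zero z = refl
          and-zero (suc a) z = z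
        ... | inj₂ m | inj₂ loc with zero? (s l)
        ...   | inj₁ z = trans (nz-and-true (r L l) m) (trans (two l m loc z)
                (cong (proj₁ T) (sym (trans (ifz-nonzero no′ _ (and-intro m loc)) (ifz-zero (g₂ l) (g₁ l) z)))))
        ...   | inj₂ z = trans (nz-and-true (r L l) m) (trans (one l m loc z)
                (cong (proj₁ T) (sym (trans (ifz-nonzero no′ _ (and-intro m loc)) (ifz-nonzero (g₂ l) (g₁ l) z)))))

-- Elements within one class cannot be separated.

module Inseparability where

  open PrimitiveRecursion
  open Machine
  open Histories
  open Elements
  open Disjointness
  open Links
  open Splittings

  open Link
  open Relations _≤C_ _∨C_

  -- The bits before `B` are read off the fixed history `K`, a constant of the procedure, so a
  -- reduction that is right from `B` on is enough.
  piece-tail : ∀ {E} → PR₁ E → ∀ (T : CElt) {f} → PR₁ f → ∀ B →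
    (∀ n → B ≤ n → E n ≢ 0 → nz (p n) ≡ proj₁ T (f n)) → ¬ ¬ ((piece E p ⁺) ≤ᵖʳₘ proj₁ T)
  piece-tail {E} Eᴾ T {f} fᴾ B ok = inhabited T >>= λ { (y , Ty) → coinhabited T >>= λ { (n , Tn) →
    return (⁺-≤ (piece E p) (proj₁ T) Ty Tn (map y n)
      (PR₁-ifz Eᴾ (PR₁-const n) (PR₁-ifz (PR₁-∸ (PR₁-const B) PR₁-id) fᴾ
        (PR₁-ifz (PR₁-hAt idᴸ (PR₁-const K) PR₁-id) (PR₁-const n) (PR₁-const y))))
      (value y n Ty Tn)) } }
    where
    K : ℕ
    K = hist (suc (suc B))
    map : ℕ → ℕ → ℕ → ℕ
    map y n m = ifz (E m) n (ifz (B ∸ m) (f m) (ifz (hAt K m) n y))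
    value : ∀ y n → proj₁ T y ≡ true → proj₁ T n ≡ false → ∀ m → nz (piece E p m) ≡ proj₁ T (map y n m)
    value y n Ty Tn m with zero? (E m)
    ... | inj₁ z = trans (nz-and-false (p m) z) (trans (sym Tn) (cong (proj₁ T) (sym (ifz-zero n _ z))))
    ... | inj₂ Em = trans (nz-and-true (p m) Em) (trans (go (zero? (B ∸ m))) (cong (proj₁ T) (sym (ifz-nonzero n _ Em))))
      where
      pick : ∀ b → nz b ≡ proj₁ T (ifz b n y)
      pick zero = sym Tn
      pick (suc b) = sym Ty
      go : B ∸ m ≡ 0 ⊎ B ∸ m ≢ 0 → nz (p m) ≡ proj₁ T (ifz (B ∸ m) (f m) (ifz (hAt K m) n y))
      go (inj₁ z) = trans (ok m (m∸n≡0⇒m≤n z) Em) (cong (proj₁ T) (sym (ifz-zero (f m) _ z)))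
      go (inj₂ z) = trans (trans (cong nz (trans (p≡h m) (sym (hAt-hist idᴸ {m} {suc (suc B)} (s≤s (s≤s (<⇒≤ (≰⇒> λ B≤m → z (m≤n⇒m∸n≡0 B≤m)))))))))
                                  (pick (hAt K m))) (cong (proj₁ T) (sym (ifz-nonzero (f m) _ z)))

  module _ (cls : ℕ → ℕ) (clsᴾ : PR₁ cls) (w : ℕ) (periodic : ∀ n → cls (suc w + n) ≡ cls n) where

    open Classes cls clsᴾ w periodic

    -- Both splittings agree with that of r at almost all locations, so the side of `c n` in p is
    -- the side of `n` in q. By `linked` and `class-constant` the side is eventually constant on the
    -- class κ. If κ goes right, `X` lies below both parts of p, otherwise `Y` does; either would be
    -- trivial.
    inseparable : ∀ {E E′ κ} → PR₁ E → PR₁ E′ →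
      (∀ n → E n ≢ 0 → cls n ≡ κ) → (∀ n → E′ n ≢ 0 → cls n ≡ κ) → ∀ X Y →
      proj₁ X ≤ᵖʳₘ (piece E p ⁺) → proj₁ Y ≤ᵖʳₘ (piece E′ p ⁺) → ¬ (X ≤C 𝟘) → ¬ (Y ≤C 𝟘) →
      Inseparable Pᶜ 𝟘 (Qᶜ link) (Rᶜ link) X Y
    inseparable {E} {E′} {κ} Eᴾ E′ᴾ inE inE′ X Y X≤E Y≤E′ X≢0 Y≢0
        U U′ V V′ W W′ P≤ Q≤ R≤ W≤U W≤V W′≤U′ W′≤V′ disjU disjV X≤U Y≤U′ =
      (P≤ >>= λ P≤ → Q≤ >>= λ Q≤ → R≤ >>= λ R≤ → W≤U >>= λ W≤U → W≤V >>= λ W≤V →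
        W′≤U′ >>= λ W′≤U′ → W′≤V′ >>= λ W′≤V′ → argue P≤ Q≤ R≤ W≤U W≤V W′≤U′ W′≤V′) id
      where
      argue : Pᶜ ≤C (U ∨C U′) → Qᶜ link ≤C (V ∨C V′) → Rᶜ link ≤C (W ∨C W′) →
              W ≤C U → W ≤C V → W′ ≤C U′ → W′ ≤C V′ → ¬ ¬ ⊥
      argue P≤ Q≤ R≤ W≤U W≤V W′≤U′ W′≤V′
        with reduction (p ⁺) (proj₁ U ⊕ proj₁ U′) P≤ | reduction (q link ⁺) (proj₁ V ⊕ proj₁ V′) Q≤
           | reduction (r link ⁺) (proj₁ W ⊕ proj₁ W′) R≤
      ... | f , fᴾ , fok | g , gᴾ , gok | d , dᴾ , dok =
        splits-agree link p at-c (PR₁-cAt link PR₁-id indexᴾ)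
          (λ n → cong nz (sym (trans (p≡h (at-c (hist (suc n)))) (cong h (at-c-hist n)))))
          U U′ W W′ f fᴾ fok d dᴾ dok W≤U W′≤U′ disjU >>= λ { (B₁ , agree₁) →
        splits-agree link (q link) index indexᴾ (λ n → cong (nz ∘ q link) (sym (index-hist n)))
          V V′ W W′ g gᴾ gok d dᴾ dok W≤V W′≤V′ disjV >>= λ { (B₂ , agree₂) →
        linked link {D} {D′} Dᴾ (PR₁-par (PR₁-∘ gᴾ (PR₁-suc (PR₁-suc PR₁-id)))) (B₁ + B₂)
          (λ n le → trans (cong (nz ∘ D) (sym (at-c-hist n))) (trans (agree₁ n (m+n≤o⇒m≤o B₁ le))
            (trans (sym (agree₂ n (m+n≤o⇒n≤o B₁ le))) (cong (nz ∘ D′) (index-hist n)))))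
          >>= λ { (B , const-on-links) →
        excluded-middle {A = Σ ℕ λ m → B ≤ m × cls m ≡ κ × D m ≢ 0} >>= λ
          { (inj₁ (m , B≤m , m∈κ , right)) → return (goes-right B const-on-links m B≤m m∈κ right)
          ; (inj₂ nowhere) → return (goes-left B nowhere) } } } }
        where
        at-c : ℕ → ℕ
        at-c l = cAt link l (index l)
        at-c-hist : ∀ n → at-c (hist (suc n)) ≡ c link n
        at-c-hist n = trans (cong (cAt link (hist (suc n))) (index-hist n)) (cAt-hist link ≤-refl)
        D D′ : ℕ → ℕ
        D n = parᴺ (f (suc (suc n)))
        D′ n = parᴺ (g (suc (suc n)))
        fxᴾ : PR₁ (λ n → f (suc (suc n)))
        fxᴾ = PR₁-∘ fᴾ (PR₁-suc (PR₁-suc PR₁-id))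
        Dᴾ : PR₁ D
        Dᴾ = PR₁-par fxᴾ
        goes-right : ∀ B → (∀ n → B ≤ n → nz (D n) ≡ nz (D (successor n))) →
          ∀ m → B ≤ m → cls m ≡ κ → D m ≢ 0 → ⊥
        goes-right B step m B≤m m∈κ right =
          disjU X X≤U ((piece-tail Eᴾ U′ (PR₁-half fxᴾ) B λ n B≤n En → trans (fok (suc (suc n)))
            (condB-right (nz-≢0 (class-constant {D} B step B≤m B≤n (trans m∈κ (sym (inE n En)))) right)))
            >>= λ E≤U′ → return (≤-transᵖʳ (proj₁ X) (piece E p ⁺) (proj₁ U′) X≤E E≤U′)) X≢0
        goes-left : ∀ B → ¬ (Σ ℕ λ m → B ≤ m × cls m ≡ κ × D m ≢ 0) → ⊥
        goes-left B nowhere =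
          disjU Y ((piece-tail E′ᴾ U (PR₁-half fxᴾ) B λ n B≤n En → trans (fok (suc (suc n)))
            (condB-left (left n B≤n (inE′ n En))))
            >>= λ E≤U → return (≤-transᵖʳ (proj₁ Y) (piece E′ p ⁺) (proj₁ U) Y≤E′ E≤U)) Y≤U′ Y≢0
          where
          left : ∀ n → B ≤ n → cls n ≡ κ → D n ≡ 0
          left n B≤n n∈κ with zero? (D n)
          ... | inj₁ z = z
          ... | inj₂ z = ⊥-elim (nowhere (n , B≤n , n∈κ , z))

-- The sentences, and their truth when the program outputs 0.

module Formulas where

  open Histories using (_>>=_; return; excluded-middle)
  open Links using (module Relations)

  -- Variables below 32 are bound by the formulas below; the others are the
  -- parameters: p, o, the values, zero, and from 36 on q s, r s and the types of facts.

  infixr 6 _⇛_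
  _⇛_ : Formula → Formula → Formula
  _⇛_ = _⇒_

  _⊑ᶠ_ : ℕ → ℕ → Formula
  x ⊑ᶠ y = var x ≼ var y

  ¬ᶠ : Formula → Formula
  ¬ᶠ φ = φ ⇒ ⊥ᶠ

  Some : ℕ → Formula → Formula
  Some x φ = ¬ᶠ (∀ᶠ x φ)

  Both Either : Formula → Formula → Formula
  Both φ ψ = ¬ᶠ (φ ⇛ ψ ⇛ ⊥ᶠ)
  Either φ ψ = ¬ᶠ φ ⇛ ¬ᶠ ψ ⇛ ⊥ᶠ

  All : ℕ → (ℕ → Formula) → Formula
  All zero f = ⊥ᶠ ⇛ ⊥ᶠ
  All (suc n) f = Both (f 0) (All n (f ∘ suc))

  qᵛ rᵛ tᵛ : ℕ → ℕ
  qᵛ s = 36 + s * 3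
  rᵛ s = 37 + s * 3
  tᵛ b = 38 + b * 3

  Disjointᶠ : ℕ → ℕ → Formula
  Disjointᶠ u v = ∀ᶠ 20 (20 ⊑ᶠ u ⇛ 20 ⊑ᶠ v ⇛ 20 ⊑ᶠ 33)

  Inseparableᶠ : ℕ → ℕ → ℕ → Formula
  Inseparableᶠ s x y = ∀ᶠ 21 (∀ᶠ 22 (∀ᶠ 23 (∀ᶠ 24 (∀ᶠ 25 (∀ᶠ 26
    ((var 32 ≼ (var 21 ∨ₜ var 22)) ⇛ (var (qᵛ s) ≼ (var 23 ∨ₜ var 24)) ⇛ (var (rᵛ s) ≼ (var 25 ∨ₜ var 26)) ⇛
     25 ⊑ᶠ 21 ⇛ 25 ⊑ᶠ 23 ⇛ 26 ⊑ᶠ 22 ⇛ 26 ⊑ᶠ 24 ⇛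
     Disjointᶠ 21 22 ⇛ Disjointᶠ 23 24 ⇛ x ⊑ᶠ 21 ⇛ y ⊑ᶠ 22 ⇛ ⊥ᶠ))))))

  -- In the intended model partition 0 separates all colours, so the points are the nontrivial
  -- elements carried by a single colour.
  Pointᶠ : ℕ → Formula
  Pointᶠ x = ¬ᶠ (x ⊑ᶠ 32 ⇛ ¬ᶠ (x ⊑ᶠ 33) ⇛
    ∀ᶠ 27 (∀ᶠ 28 (27 ⊑ᶠ x ⇛ 28 ⊑ᶠ x ⇛ ¬ᶠ (27 ⊑ᶠ 33) ⇛ ¬ᶠ (28 ⊑ᶠ 33) ⇛ Inseparableᶠ 0 27 28)) ⇛ ⊥ᶠ)

  Zeroᶠ : ℕ → Formula
  Zeroᶠ x = x ⊑ᶠ 35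

  Factᶠ : ℕ → ℕ → Formula
  Factᶠ b x = ¬ᶠ (Pointᶠ x ⇛ x ⊑ᶠ tᵛ b ⇛ ⊥ᶠ)

  -- Partition `suc s` is meant to put a fact into the class of the value in its slot `s`.
  Slotᶠ : ℕ → ℕ → ℕ → Formula
  Slotᶠ s x y = ¬ᶠ (Pointᶠ y ⇛ y ⊑ᶠ 34 ⇛ Inseparableᶠ (suc s) x y ⇛ ⊥ᶠ)

  -- An inclusion transports statements about all values of a slot, the only kind that is available
  -- in an arbitrary structure.
  Inᶠ : ℕ → ℕ → ℕ → ℕ → Formula
  Inᶠ s x s′ x′ = ∀ᶠ 29 (Slotᶠ s x 29 ⇛ Slotᶠ s′ x′ 29)

  Shiftᶠ : ℕ → ℕ → ℕ → ℕ → ℕ → Formula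
  Shiftᶠ n s x s′ x′ = All n λ i → Inᶠ (s + i) x (s′ + i) x′

  -- Each subterm of a program has an identifier (an unbounded search has two); the facts
  -- with that identifier are the nodes of a computation tree evaluating the subterm.
  -- Slot 0 of a fact is its output and slot suc i its i-th argument.  Facts with
  -- identifier 0 form the successor relation.
  mutual
    size : ∀ {n} → Rec n → ℕ
    size zeroʳ = 1
    size succʳ = 1
    size (projʳ i) = 1
    size (compʳ f gs) = suc (size f + sizes gs)
    size (precʳ g h) = suc (size g + size h)
    size (muʳ f) = suc (suc (size f))

    sizes : ∀ {n m} → Vec (Rec n) m → ℕ
    sizes [] = 0
    sizes (g ∷ gs) = size g + sizes gs

  argsᶠ : ∀ {n m} → Vec (Rec n) m → ℕ → ℕ → Formula
  argsᶠ [] b j = ⊥ᶠ ⇛ ⊥ᶠ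
  argsᶠ {n} (g ∷ gs) b j =
    Both (Some 2 (Factᶠ b 2 ⇛ Shiftᶠ n 1 2 1 0 ⇛ Inᶠ (suc j) 1 0 2 ⇛ ⊥ᶠ)) (argsᶠ gs (b + size g) (suc j))

  nodeᶠ : ∀ {n} → Rec n → ℕ → Formula
  nodeᶠ zeroʳ b = ∀ᶠ 5 (Slotᶠ 0 0 5 ⇛ Zeroᶠ 5)
  nodeᶠ succʳ b = Some 3 (Factᶠ 0 3 ⇛ Inᶠ 0 0 0 3 ⇛ Inᶠ 1 3 1 0 ⇛ ⊥ᶠ)
  nodeᶠ (projʳ i) b = Inᶠ 0 0 (suc (toℕ i)) 0
  nodeᶠ (compʳ f gs) b = Some 1 (Factᶠ (suc b) 1 ⇛ Inᶠ 0 0 0 1 ⇛ argsᶠ gs (suc b + size f) 0 ⇛ ⊥ᶠ)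
  nodeᶠ {suc n} (precʳ g h) b = Either
    (Some 5 (Slotᶠ 1 0 5 ⇛ Zeroᶠ 5 ⇛ ∀ᶠ 1 (Factᶠ (suc b) 1 ⇛ Inᶠ 0 0 0 1 ⇛ Shiftᶠ n 1 1 2 0 ⇛ ⊥ᶠ)))
    (Some 5 (∀ᶠ 3 (Factᶠ 0 3 ⇛ Slotᶠ 0 3 5 ⇛ Slotᶠ 1 0 5 ⇛
      ∀ᶠ 1 (Factᶠ b 1 ⇛ Inᶠ 1 1 1 3 ⇛ Shiftᶠ n 2 1 2 0 ⇛
        ∀ᶠ 2 (Factᶠ (suc b + size g) 2 ⇛ Inᶠ 0 0 0 2 ⇛ Inᶠ 1 2 1 3 ⇛ Inᶠ 2 2 0 1 ⇛ Shiftᶠ n 3 2 2 0 ⇛ ⊥ᶠ)))))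
  nodeᶠ {n} (muʳ f) b =
    Some 1 (Factᶠ (suc b) 1 ⇛ Inᶠ 0 0 0 1 ⇛ ∀ᶠ 5 (Slotᶠ 1 1 5 ⇛ Zeroᶠ 5) ⇛ Shiftᶠ n 2 1 1 0 ⇛ ⊥ᶠ)

  -- A fact of this kind records the result of the search begun at its first argument z: z itself if
  -- the function vanishes there, otherwise the result of the search begun at z + 1.
  seekᶠ : ℕ → ℕ → Formula
  seekᶠ n b = Some 2 (Factᶠ (suc b) 2 ⇛ Shiftᶠ (suc n) 1 2 1 0 ⇛ Either
    (Some 5 (Slotᶠ 0 2 5 ⇛ Zeroᶠ 5 ⇛ Inᶠ 0 0 1 0 ⇛ ⊥ᶠ))
    (Some 5 (Slotᶠ 0 2 5 ⇛ ¬ᶠ (Zeroᶠ 5) ⇛ ∀ᶠ 3 (∀ᶠ 1 (Factᶠ 0 3 ⇛ Factᶠ b 1 ⇛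
      Inᶠ 1 3 1 0 ⇛ Inᶠ 1 1 0 3 ⇛ Inᶠ 0 0 0 1 ⇛ Shiftᶠ n 2 1 2 0 ⇛ ⊥ᶠ)))) ⇛ ⊥ᶠ)

  nodesᶠ : ∀ {n} → Rec n → ℕ → Formula
  nodesᶠ t b = ∀ᶠ 0 (Factᶠ b 0 ⇛ nodeᶠ t b)

  mutual
    programᶠ : ∀ {n} → Rec n → ℕ → Formula
    programᶠ t b = Both (nodesᶠ t b) (subprogramsᶠ t b)

    subprogramsᶠ : ∀ {n} → Rec n → ℕ → Formula
    subprogramsᶠ (compʳ f gs) b = Both (programᶠ f (suc b)) (programsᶠ gs (suc b + size f))
    subprogramsᶠ (precʳ g h) b = Both (programᶠ g (suc b)) (programᶠ h (suc b + size g))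
    subprogramsᶠ {n} (muʳ f) b = Both (∀ᶠ 0 (Factᶠ (suc b) 0 ⇛ seekᶠ n (suc b))) (programᶠ f (suc (suc b)))
    subprogramsᶠ _ b = ⊥ᶠ ⇛ ⊥ᶠ

    programsᶠ : ∀ {n m} → Vec (Rec n) m → ℕ → Formula
    programsᶠ [] b = ⊥ᶠ ⇛ ⊥ᶠ
    programsᶠ (g ∷ gs) b = Both (programᶠ g b) (programsᶠ gs (b + size g))

  -- These two properties make the predecessor well determined; numbers are recognised by counting
  -- down to zero.
  positiveᶠ injectiveᶠ : Formula
  positiveᶠ = ∀ᶠ 3 (∀ᶠ 5 (Factᶠ 0 3 ⇛ Slotᶠ 0 3 5 ⇛ Zeroᶠ 5 ⇛ ⊥ᶠ))
  injectiveᶠ = ∀ᶠ 3 (∀ᶠ 4 (∀ᶠ 5 (Factᶠ 0 3 ⇛ Factᶠ 0 4 ⇛ Slotᶠ 0 3 5 ⇛ Slotᶠ 0 4 5 ⇛ Inᶠ 1 4 1 3)))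

  axiomsᶠ : Rec 1 → Formula
  axiomsᶠ g = Both positiveᶠ (Both injectiveᶠ (programᶠ g 1))

  outputsᶠ : Formula
  outputsᶠ = ∀ᶠ 1 (Factᶠ 1 1 ⇛ Inᶠ 1 1 0 0 ⇛ ∀ᶠ 5 (Slotᶠ 0 1 5 ⇛ Zeroᶠ 5))

  -- "The number of the fact x₀, increased by v, satisfies θ."
  shiftedᶠ : ℕ → Formula → Formula
  shiftedᶠ zero θ = θ
  -- The equation moves the new fact back into variable 0, so each step adds the same prefix and the
  -- code of the formula is an iterate in `v`.
  shiftedᶠ (suc v) θ = ∀ᶠ 6 (Factᶠ 0 6 ⇛ Inᶠ 1 6 0 0 ⇛ ∀ᶠ 0 ((var 0 ≐ var 6) ⇛ shiftedᶠ v θ))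

  matrixᶠ : Rec 1 → ℕ → Formula
  matrixᶠ g v = axiomsᶠ g ⇛ ∀ᶠ 0 (∀ᶠ 5 (Slotᶠ 0 0 5 ⇛ Zeroᶠ 5) ⇛ shiftedᶠ v outputsᶠ)

  closeᶠ : ℕ → Formula → Formula
  closeᶠ zero φ = φ
  closeᶠ (suc k) φ = ∀ᶠ k (closeᶠ k φ)

  module Truth {D : Set} (_≈_ _⊑_ : D → D → Set) (_∨_ : D → D → D) where

    open Semantics _≈_ _⊑_ _∨_ public
    open Relations _⊑_ _∨_ public

    -- Atoms are doubly negated, and ⊥, ⇒ and ∀ preserve stability; so satisfaction of any formula
    -- may be proved by contradiction.
    stable : ∀ φ ρ → ¬ ¬ Sat ρ φ → Sat ρ φ
    stable (t ≐ s) ρ k = λ n → k λ m → m n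
    stable (t ≼ s) ρ k = λ n → k λ m → m n
    stable ⊥ᶠ ρ k = k id
    stable (φ ⇒ ψ) ρ k = λ a → stable ψ ρ λ n → k λ f → n (f a)
    stable (∀ᶠ x φ) ρ k = λ a → stable φ (ρ [ x ↦ a ]) λ n → k λ f → n (f a)

    both : ∀ φ ψ ρ → Sat ρ (Both φ ψ) → Sat ρ φ × Sat ρ ψ
    both φ ψ ρ b = stable φ ρ (λ n → b λ x _ → n x) , stable ψ ρ (λ n → b λ _ y → n y)

    all : ∀ {n} f ρ → Sat ρ (All n f) → (i : Fin n) → Sat ρ (f (toℕ i))
    all {suc n} f ρ s fz = proj₁ (both (f 0) (All n (f ∘ suc)) ρ s)
    all {suc n} f ρ s (fs i) = all (f ∘ suc) ρ (proj₂ (both (f 0) (All n (f ∘ suc)) ρ s)) i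

    params : (ℕ → D) → ℕ → D
    params ρ m = ρ (32 + m)

    module At (κ : ℕ → D) where

      Insep : ℕ → D → D → Set
      Insep s = Inseparable (κ 0) (κ 1) (κ (4 + s * 3)) (κ (5 + s * 3))

      Point : D → Set
      Point x = ¬ (x ⊴ κ 0 → ¬ (x ⊴ κ 1) →
        (∀ y z → y ⊴ x → z ⊴ x → ¬ (y ⊴ κ 1) → ¬ (z ⊴ κ 1) → Insep 0 y z) → ⊥)

      Zero : D → Set
      Zero x = x ⊴ κ 3

      Fact : ℕ → D → Set
      Fact b x = ¬ (Point x → x ⊴ κ (6 + b * 3) → ⊥)

      Slot : ℕ → D → D → Set
      Slot s x y = ¬ (Point y → y ⊴ κ 2 → Insep (suc s) x y → ⊥)

      In : ℕ → D → ℕ → D → Set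
      In s x s′ x′ = ∀ y → Slot s x y → Slot s′ x′ y

      -- Defined downwards, through all predecessors that successor facts provide, so that it makes
      -- sense whether or not the structure contains such facts.
      Num : ℕ → D → Set
      Num zero y = Zero y
      Num (suc n) y = ¬ Zero y × (∀ σ x → Fact 0 σ → Slot 0 σ y → Slot 1 σ x → Num n x)

      Num-stable : ∀ n {y} → ¬ ¬ Num n y → Num n y
      Num-stable zero k = λ n → k λ m → m n
      Num-stable (suc n) k =
        (λ z → k λ m → proj₁ m z) , λ σ x a b c → Num-stable n λ refute → k λ m → refute (proj₂ m σ x a b c)

      Is : ℕ → D → ℕ → Set
      Is s x n = ∀ y → Slot s x y → Num n y

    module _ (ρ : ℕ → D) (positive : Sat ρ positiveᶠ) (injective : Sat ρ injectiveᶠ) where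

      open At (params ρ)

      succ-fact : ∀ {n} σ → Fact 0 σ → Is 1 σ n → Is 0 σ (suc n)
      succ-fact σ F is y s = positive σ y F s , λ σ′ x F′ s′ sx → is x (injective σ σ′ y F F′ s s′ x sx)

      mutual
        -- The structure is arbitrary, but the recursion is on the derivation of the true
        -- computation, which is finite: it controls every fact whose arguments are the true ones.
        correct : ∀ {n} (t : Rec n) b {xs y} → t [ xs ]⇓ y → Sat ρ (programᶠ t b) →
          ∀ x → Fact b x → (∀ i → Is (suc (toℕ i)) x (lookup xs i)) → Is 0 x y
        correct t b d prog = correct′ t b d (proj₁ parts) (proj₂ parts)
          where
          parts : Sat ρ (nodesᶠ t b) × Sat ρ (subprogramsᶠ t b)
          parts = both (nodesᶠ t b) (subprogramsᶠ t b) ρ prog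

        correct′ : ∀ {n} (t : Rec n) b {xs y} → t [ xs ]⇓ y → Sat ρ (nodesᶠ t b) → Sat ρ (subprogramsᶠ t b) →
          ∀ x → Fact b x → (∀ i → Is (suc (toℕ i)) x (lookup xs i)) → Is 0 x y
        correct′ zeroʳ b ⇓zero node sub x F args y s = node x F y s
        correct′ succʳ b {v ∷ []} ⇓succ node sub x F args y s = Num-stable (suc v) λ refute →
          node x F λ σ Fσ out arg → refute (succ-fact σ Fσ (λ z sz → args fz z (arg z sz)) y (out y s))
        correct′ (projʳ i) b (⇓proj .i) node sub x F args y s = args i y (node x F y s)
        correct′ (compʳ f gs) b {xs} {v} (⇓comp {ys = ys} ds d) node sub x F args y s = Num-stable v λ refute →
          node x F λ x₁ F₁ out rest → refute (correct f (suc b) d (proj₁ subs) x₁ F₁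
            (corrects gs (suc b + size f) 0 ds (proj₂ subs) x x₁ args rest) y (out y s))
          where
          subs : Sat ρ (programᶠ f (suc b)) × Sat ρ (programsᶠ gs (suc b + size f))
          subs = both (programᶠ f (suc b)) (programsᶠ gs (suc b + size f)) ρ sub
        correct′ (precʳ g h) b {k ∷ xs} d node sub = go k d
          where
          subs : Sat ρ (programᶠ g (suc b)) × Sat ρ (programᶠ h (suc b + size g))
          subs = both (programᶠ g (suc b)) (programᶠ h (suc b + size g)) ρ sub
          go : ∀ k {v} → precʳ g h [ k ∷ xs ]⇓ v → ∀ x → Fact b x →
               (∀ i → Is (suc (toℕ i)) x (lookup (k ∷ xs) i)) → Is 0 x v
          go zero {v} (⇓prec0 d) x F args y s = Num-stable v λ refute → node x F
            (λ case → case λ z s₁ _ x₁ F₁ out shift → refute (correct g (suc b) d (proj₁ subs) x₁ F₁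
              (λ i w sw → args (fs i) w (all (λ i → Inᶠ (1 + i) 1 (2 + i) 0) (((ρ [ 0 ↦ x ]) [ 5 ↦ z ]) [ 1 ↦ x₁ ]) shift i w sw)) y (out y s)))
            (λ case → case λ z σ Fσ s₀ s₁ → ⊥-elim (positive σ z Fσ s₀ (args fz z s₁)))
          go (suc k) {v} (⇓precS {r = r} d d′) x F args y s = Num-stable v λ refute → node x F
            (λ case → case λ z s₁ zero′ → ⊥-elim (proj₁ (args fz z s₁) zero′))
            (λ case → case λ z σ Fσ s₀ s₁ x₁ F₁ dec shift x₂ F₂ out arg₁ arg₂ shift₂ →
              let e₁ = (((ρ [ 0 ↦ x ]) [ 5 ↦ z ]) [ 3 ↦ σ ]) [ 1 ↦ x₁ ]
                  k-slot = λ w sw → proj₂ (args fz z s₁) σ w Fσ s₀ sw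
                  prev = go k d x₁ F₁ λ
                    { fz w sw → k-slot w (dec w sw)
                    ; (fs i) w sw → args (fs i) w (all (λ i → Inᶠ (2 + i) 1 (2 + i) 0) e₁ shift i w sw) }
              in refute (correct h (suc b + size g) d′ (proj₂ subs) x₂ F₂ (λ
                    { fz w sw → k-slot w (arg₁ w sw)
                    ; (fs fz) w sw → prev w (arg₂ w sw)
                    ; (fs (fs i)) w sw → args (fs i) w (all (λ i → Inᶠ (3 + i) 2 (2 + i) 0) (e₁ [ 2 ↦ x₂ ]) shift₂ i w sw) })
                    y (out y s)))
        correct′ {n} (muʳ f) b {xs} {v} (⇓mu d below) node sub x F args y s = Num-stable v λ refute →
          node x F λ x₁ F₁ out zero′ shift → refute (go v 0 (+-identityʳ v) x₁ F₁ zero′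
            (λ i w sw → args i w (all (λ i → Inᶠ (2 + i) 1 (1 + i) 0) ((ρ [ 0 ↦ x ]) [ 1 ↦ x₁ ]) shift i w sw)) y (out y s))
          where
          subs : Sat ρ (∀ᶠ 0 (Factᶠ (suc b) 0 ⇛ seekᶠ n (suc b))) × Sat ρ (programᶠ f (suc (suc b)))
          subs = both (∀ᶠ 0 (Factᶠ (suc b) 0 ⇛ seekᶠ n (suc b))) (programᶠ f (suc (suc b))) ρ sub
          -- `m` is the distance from the current argument `z` to the result `v` of the search.
          go : ∀ m z → m + z ≡ v → ∀ x → Fact (suc b) x → Is 1 x z →
               (∀ i → Is (suc (suc (toℕ i))) x (lookup xs i)) → Is 0 x v
          go m z eq x F is args y s = Num-stable v λ refute → proj₁ subs x F λ x₂ F₂ shift either →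
            let f-args : ∀ i → Is (suc (toℕ i)) x₂ (lookup (z ∷ xs) i)
                f-args = λ { i w sw → join i w (all (λ i → Inᶠ (1 + i) 2 (1 + i) 0) ((ρ [ 0 ↦ x ]) [ 2 ↦ x₂ ]) shift i w sw) }
            in step m eq x₂ F₂ f-args either refute
            where
            join : ∀ i → Is (suc (toℕ i)) x (lookup (z ∷ xs) i)
            join fz = is
            join (fs i) = args i
            step : ∀ m → m + z ≡ v → ∀ x₂ → Fact (suc (suc b)) x₂ →
              (∀ i → Is (suc (toℕ i)) x₂ (lookup (z ∷ xs) i)) →
              Sat ((ρ [ 0 ↦ x ]) [ 2 ↦ x₂ ]) (Either
                (Some 5 (Slotᶠ 0 2 5 ⇛ Zeroᶠ 5 ⇛ Inᶠ 0 0 1 0 ⇛ ⊥ᶠ))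
                (Some 5 (Slotᶠ 0 2 5 ⇛ ¬ᶠ (Zeroᶠ 5) ⇛ ∀ᶠ 3 (∀ᶠ 1 (Factᶠ 0 3 ⇛ Factᶠ (suc b) 1 ⇛
                  Inᶠ 1 3 1 0 ⇛ Inᶠ 1 1 0 3 ⇛ Inᶠ 0 0 0 1 ⇛ Shiftᶠ n 2 1 2 0 ⇛ ⊥ᶠ))))) → ¬ ¬ Num v y
            step zero refl x₂ F₂ f-args either refute = either
              (λ case → case λ w sw zw out → refute (is y (out y s)))
              (λ case → case λ w sw nz → ⊥-elim (nz (correct f (suc (suc b)) d (proj₂ subs) x₂ F₂ f-args w sw)))
            step (suc m) eq x₂ F₂ f-args either refute with below z (subst (suc z ≤_) eq (s≤s (m≤n+m z m)))
            ... | u , d′ = either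
              (λ case → case λ w sw zw → ⊥-elim (proj₁ (correct f (suc (suc b)) d′ (proj₂ subs) x₂ F₂ f-args w sw) zw))
              (λ case → case λ w sw _ σ x₁ Fσ F₁ in₁ in₂ out shift → refute (go m (suc z) (trans (+-suc m z) eq) x₁ F₁
                (λ q sq → succ-fact σ Fσ (λ q′ sq′ → is q′ (in₁ q′ sq′)) q (in₂ q sq))
                (λ i q sq → args i q (all (λ i → Inᶠ (2 + i) 1 (2 + i) 0) (((((ρ [ 0 ↦ x ]) [ 2 ↦ x₂ ]) [ 5 ↦ w ]) [ 3 ↦ σ ]) [ 1 ↦ x₁ ]) shift i q sq))
                y (out y s)))

        corrects : ∀ {n m} (gs : Vec (Rec n) m) b j {xs ys} → gs [ xs ]⇓* ys → Sat ρ (programsᶠ gs b) →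
          ∀ x x₁ → (∀ i → Is (suc (toℕ i)) x (lookup xs i)) →
          Sat ((ρ [ 0 ↦ x ]) [ 1 ↦ x₁ ]) (argsᶠ gs b j) →
          ∀ i → Is (suc (j + toℕ i)) x₁ (lookup ys i)
        corrects {n} (g ∷ gs) b j {xs} (⇓∷ {y = v} d ds) prog x x₁ args sat = λ
            { fz y s → Num-stable v λ refute → proj₁ now λ x₂ F₂ shift out → refute (correct g b d (proj₁ subs) x₂ F₂
                (λ i w sw → args i w (all (λ i → Inᶠ (1 + i) 2 (1 + i) 0) (e [ 2 ↦ x₂ ]) shift i w sw)) y
                (out y (subst (λ j → Slot (suc j) x₁ y) (+-identityʳ j) s)))
            ; (fs i) y s → corrects gs (b + size g) (suc j) ds (proj₂ subs) x x₁ args (proj₂ now) i y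
                (subst (λ j → Slot (suc j) x₁ y) (+-suc j (toℕ i)) s) }
          where
          e : ℕ → D
          e = (ρ [ 0 ↦ x ]) [ 1 ↦ x₁ ]
          subs : Sat ρ (programᶠ g b) × Sat ρ (programsᶠ gs (b + size g))
          subs = both (programᶠ g b) (programsᶠ gs (b + size g)) ρ prog
          now : Sat e (Some 2 (Factᶠ b 2 ⇛ Shiftᶠ n 1 2 1 0 ⇛ Inᶠ (suc j) 1 0 2 ⇛ ⊥ᶠ)) × Sat e (argsᶠ gs (b + size g) (suc j))
          now = both (Some 2 (Factᶠ b 2 ⇛ Shiftᶠ n 1 2 1 0 ⇛ Inᶠ (suc j) 1 0 2 ⇛ ⊥ᶠ)) (argsᶠ gs (b + size g) (suc j)) e sat

    -- Each shift passes from a fact to one equated with it; `≈⇒≡` carries the number of its output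
    -- across this equation.
    shifted-true : (∀ {a b} → a ≈ b → a ≡ b) → ∀ κ → let open At κ in
      (∀ {n} σ → Fact 0 σ → Is 1 σ n → Is 0 σ (suc n)) → ∀ v → (∀ x → Fact 1 x → Is 1 x v → Is 0 x 0) →
      ∀ n m ρ → params ρ ≡ κ → m + n ≡ v → Is 0 (ρ 0) m → Sat ρ (shiftedᶠ n outputsᶠ)
    shifted-true ≈⇒≡ κ succ-ok v ok zero m ρ refl eq is x F arg =
      ok x F λ z s → subst (λ m → At.Num κ m z) (trans (sym (+-identityʳ m)) eq) (is z (arg z s))
    shifted-true ≈⇒≡ κ succ-ok v ok (suc n) m ρ refl eq is x F arg x′ x′≈x =
      stable (shiftedᶠ n outputsᶠ) ((ρ [ 6 ↦ x ]) [ 0 ↦ x′ ]) λ refute → x′≈x λ e → refute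
        (shifted-true ≈⇒≡ κ succ-ok v ok n (suc m) ((ρ [ 6 ↦ x ]) [ 0 ↦ x′ ]) refl (trans (sym (+-suc m n)) eq)
          (subst (λ x → At.Is κ 0 x (suc m)) (sym (≈⇒≡ e)) (succ-ok x F λ z s → is z (arg z s))))

    matrix-true : (∀ {a b} → a ≈ b → a ≡ b) → ∀ g v → g [ v ∷ [] ]⇓ 0 → ∀ ρ → Sat ρ (matrixᶠ g v)
    matrix-true ≈⇒≡ g v halts ρ axioms x is-zero =
      shifted-true ≈⇒≡ (params ρ) (succ-fact ρ positive injective) v
        (λ y F arg → correct ρ positive injective g 1 halts program y F λ { fz → arg }) v 0 (ρ [ 0 ↦ x ]) refl refl is-zero
      where
      program : Sat ρ (programᶠ g 1)
      program = proj₂ (both injectiveᶠ (programᶠ g 1) ρ (proj₂ (both positiveᶠ (Both injectiveᶠ (programᶠ g 1)) ρ axioms)))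
      positive : Sat ρ positiveᶠ
      positive = proj₁ (both positiveᶠ (Both injectiveᶠ (programᶠ g 1)) ρ axioms)
      injective : Sat ρ injectiveᶠ
      injective = proj₁ (both injectiveᶠ (programᶠ g 1) ρ (proj₂ (both positiveᶠ (Both injectiveᶠ (programᶠ g 1)) ρ axioms)))

    close-true : ∀ k φ → (∀ ρ → Sat ρ φ) → ∀ ρ → Sat ρ (closeᶠ k φ)
    close-true zero φ t ρ = t ρ
    close-true (suc k) φ t ρ a = close-true k φ t (ρ [ k ↦ a ])

    all-intro : ∀ n f ρ → (∀ i → Sat ρ (f i)) → Sat ρ (All n f)
    all-intro zero f ρ s = id
    all-intro (suc n) f ρ s k = k (s 0) (all-intro n (f ∘ suc) ρ (λ i → s (suc i)))

    -- `R m a` is to mean that `a` holds the number `m`. The universal quantifiers are instantiated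
    -- with actual successor facts until `v` is reached, where the final claim fails.
    shifted-false : (∀ a → a ≈ a) → ∀ κ → let open At κ in ∀ v (R : ℕ → D → Set) →
      (∀ m → m < v → ∀ a → R m a → Σ D λ x → Fact 0 x × In 1 x 0 a × R (suc m) x) →
      (∀ a → R v a → ¬ (∀ x → Fact 1 x → In 1 x 0 a → ∀ y → Slot 0 x y → Zero y)) →
      ∀ n m ρ → params ρ ≡ κ → m + n ≡ v → R m (ρ 0) → ¬ Sat ρ (shiftedᶠ n outputsᶠ)
    shifted-false ≈-refl κ v R step end zero m ρ refl eq r sat =
      end (ρ 0) (subst (λ m → R m (ρ 0)) (trans (sym (+-identityʳ m)) eq) r) sat
    shifted-false ≈-refl κ v R step end (suc n) m ρ refl eq r sat
      with step m (subst (suc m ≤_) eq (subst (_≤ m + suc n) (+-comm m 1) (+-monoʳ-≤ m (s≤s z≤n)))) (ρ 0) r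
    ... | x , F , arg , r′ = shifted-false ≈-refl κ v R step end n (suc m) ((ρ [ 6 ↦ x ]) [ 0 ↦ x ]) refl
            (trans (sym (+-suc m n)) eq) r′ (sat x F arg x (return (≈-refl x)))

    ext-↦ : ∀ {ρ σ : ℕ → D} x a → (∀ y → ρ y ≡ σ y) → ∀ y → (ρ [ x ↦ a ]) y ≡ (σ [ x ↦ a ]) y
    ext-↦ x a eq y with y ≡ᵇ x
    ... | true = refl
    ... | false = eq y

    ext-⟦⟧ : ∀ {ρ σ} → (∀ y → ρ y ≡ σ y) → ∀ t → ⟦ t ⟧ₜ ρ ≡ ⟦ t ⟧ₜ σ
    ext-⟦⟧ eq (var x) = eq x
    ext-⟦⟧ eq (t ∨ₜ s) = cong₂ _∨_ (ext-⟦⟧ eq t) (ext-⟦⟧ eq s)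

    ext : ∀ φ {ρ σ} → (∀ y → ρ y ≡ σ y) → Sat ρ φ → Sat σ φ
    ext (t ≐ s) eq = subst₂ (λ a b → ¬ ¬ (a ≈ b)) (ext-⟦⟧ eq t) (ext-⟦⟧ eq s)
    ext (t ≼ s) eq = subst₂ _⊴_ (ext-⟦⟧ eq t) (ext-⟦⟧ eq s)
    ext ⊥ᶠ eq = id
    ext (φ ⇒ ψ) eq f a = ext ψ eq (f (ext φ (λ y → sym (eq y)) a))
    ext (∀ᶠ x φ) eq f a = ext φ (ext-↦ x a eq) (f a)

    open-true : ∀ k φ → (∀ ρ → Sat ρ (closeᶠ k φ)) → ∀ ρ → Sat ρ φ
    open-true zero φ t = t
    open-true (suc k) φ t = open-true k φ λ ρ → ext (closeᶠ k φ) (λ y → same ρ y) (t ρ (ρ k))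
      where
      same : ∀ ρ y → (ρ [ k ↦ ρ k ]) y ≡ ρ y
      same ρ y with y ≡ᵇ k in e
      ... | true = cong ρ (sym (≡ᵇ⇒≡ y k (subst True (sym e) tt)))
      ... | false = refl

-- Finite computation trees as lists of facts.

module Computations where

  open Formulas using (size; sizes)

  -- A fact is an identifier with the list of the values in its slots.
  FactData : Set
  FactData = ℕ × List ℕ

  nth : List ℕ → ℕ → ℕ
  nth [] i = 0
  nth (x ∷ xs) zero = x
  nth (x ∷ xs) (suc i) = nth xs i

  nth-lookup : ∀ {n} (xs : Vec ℕ n) i → nth (toList xs) (toℕ i) ≡ lookup xs i
  nth-lookup (x ∷ xs) fz = refl
  nth-lookup (x ∷ xs) (fs i) = nth-lookup xs i

  -- The index is unbounded: past the ends of both lists `nth` yields 0 on either side.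
  Shift : ℕ → List ℕ → ℕ → List ℕ → Set
  Shift s u s′ v = ∀ i → nth u (s + i) ≡ nth v (s′ + i)

  Args : ∀ {n m} → Vec (Rec n) m → ℕ → ℕ → List ℕ → List ℕ → List FactData → Set
  Args [] b j v u K = ⊤
  Args {n} (g ∷ gs) b j v u K =
    (Σ (List ℕ) λ w → (b , w) ∈ K × Shift 1 w 1 v × nth u (suc j) ≡ nth w 0)
    × Args gs (b + size g) (suc j) v u K

  Node : ∀ {n} → Rec n → ℕ → List ℕ → List FactData → Set
  Node zeroʳ b v K = nth v 0 ≡ 0
  Node succʳ b v K = nth v 0 ≡ suc (nth v 1)
  Node (projʳ i) b v K = nth v 0 ≡ nth v (suc (toℕ i))
  Node (compʳ f gs) b v K = Σ (List ℕ) λ u →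
    (suc b , u) ∈ K × nth v 0 ≡ nth u 0 × Args gs (suc b + size f) 0 v u K
  Node {suc n} (precʳ g h) b v K =
    (nth v 1 ≡ 0 × Σ (List ℕ) λ u → (suc b , u) ∈ K × nth v 0 ≡ nth u 0 × Shift 1 u 2 v)
    ⊎ (Σ ℕ λ k → nth v 1 ≡ suc k × Σ (List ℕ) λ u → (b , u) ∈ K × nth u 1 ≡ k × Shift 2 u 2 v ×
        Σ (List ℕ) λ w → (suc b + size g , w) ∈ K × nth v 0 ≡ nth w 0 × nth w 1 ≡ k ×
          nth w 2 ≡ nth u 0 × Shift 3 w 2 v)
  Node {n} (muʳ f) b v K =
    Σ (List ℕ) λ u → (suc b , u) ∈ K × nth v 0 ≡ nth u 0 × nth u 1 ≡ 0 × Shift 2 u 1 v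

  Seek : ℕ → ℕ → List ℕ → List FactData → Set
  Seek n b v K = Σ (List ℕ) λ u → (suc b , u) ∈ K × Shift 1 u 1 v ×
    ((nth u 0 ≡ 0 × nth v 0 ≡ nth v 1)
     ⊎ (nth u 0 ≢ 0 × Σ (List ℕ) λ w → (b , w) ∈ K × nth w 1 ≡ suc (nth v 1) × nth v 0 ≡ nth w 0 × Shift 2 w 2 v))

  mutual
    -- If c identifies a part of t, then (c , v) has the facts it depends on in K.
    Good : ∀ {n} → Rec n → ℕ → List FactData → FactData → Set
    Good t b K (c , v) = (c ≡ b → Node t b v K) × Goodˢ t b K (c , v)

    Goodˢ : ∀ {n} → Rec n → ℕ → List FactData → FactData → Set
    Goodˢ (compʳ f gs) b K x = Good f (suc b) K x × Goods gs (suc b + size f) K x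
    Goodˢ (precʳ g h) b K x = Good g (suc b) K x × Good h (suc b + size g) K x
    Goodˢ {n} (muʳ f) b K (c , v) = (c ≡ suc b → Seek n (suc b) v K) × Good f (suc (suc b)) K (c , v)
    Goodˢ _ b K x = ⊤

    Goods : ∀ {n m} → Vec (Rec n) m → ℕ → List FactData → FactData → Set
    Goods [] b K x = ⊤
    Goods (g ∷ gs) b K x = Good g b K x × Goods gs (b + size g) K x

  Outside : ℕ → ℕ → ℕ → Set
  Outside b s c = c < b ⊎ b + s ≤ c

  size-pos : ∀ {n} (t : Rec n) → 1 ≤ size t
  size-pos zeroʳ = s≤s z≤n
  size-pos succʳ = s≤s z≤n
  size-pos (projʳ i) = s≤s z≤n
  size-pos (compʳ f gs) = s≤s z≤n
  size-pos (precʳ g h) = s≤s z≤n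
  size-pos (muʳ f) = s≤s z≤n

  outside-≢ : ∀ {b s c} → 1 ≤ s → Outside b s c → c ≢ b
  outside-≢ 1≤s (inj₁ lt) refl = <-irrefl refl lt
  outside-≢ {b} {suc s} 1≤s (inj₂ le) refl = <-irrefl refl (≤-trans (s≤s (m≤m+n b s)) (subst (_≤ b) (+-suc b s) le))

  outside-head : ∀ {b s s′ c} → Outside b (suc (s + s′)) c → Outside (suc b) s c
  outside-head (inj₁ lt) = inj₁ (m≤n⇒m≤1+n lt)
  outside-head {b} {s} {s′} (inj₂ le) = inj₂ (≤-trans (s≤s (+-monoʳ-≤ b (m≤m+n s s′))) (≤-trans (≤-reflexive (sym (+-suc b (s + s′)))) le))

  outside-tail : ∀ {b s s′ c} → Outside b (suc (s + s′)) c → Outside (suc b + s) s′ c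
  outside-tail {b} {s} (inj₁ lt) = inj₁ (≤-trans lt (m≤n⇒m≤1+n (m≤m+n b s)))
  outside-tail {b} {s} {s′} (inj₂ le) = inj₂ (≤-trans (≤-reflexive (trans (cong suc (+-assoc b s s′)) (sym (+-suc b (s + s′))))) le)

  mutual
    -- Disjoint subterms have disjoint intervals of identifiers, so a fact of one makes no demand on
    -- the axioms of the other.
    vacuous : ∀ {n} (t : Rec n) b K {c v} → Outside b (size t) c → Good t b K (c , v)
    vacuous t b K o = (λ e → ⊥-elim (outside-≢ (size-pos t) o e)) , vacuousˢ t b K o

    vacuousˢ : ∀ {n} (t : Rec n) b K {c v} → Outside b (size t) c → Goodˢ t b K (c , v)
    vacuousˢ zeroʳ b K o = tt
    vacuousˢ succʳ b K o = tt
    vacuousˢ (projʳ i) b K o = tt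
    vacuousˢ (compʳ f gs) b K o = vacuous f (suc b) K (outside-head o) , vacuouss gs (suc b + size f) K (outside-tail {b} {size f} o)
    vacuousˢ (precʳ g h) b K o = vacuous g (suc b) K (outside-head o) , vacuous h (suc b + size g) K (outside-tail {b} {size g} o)
    vacuousˢ (muʳ f) b K {c} o =
      (λ e → ⊥-elim (outside-≢ {suc b} {suc (size f)} (s≤s z≤n)
        (subst (λ b → Outside b (suc (size f)) c) (cong suc (+-identityʳ b)) (outside-tail {b} {0} o)) e)) ,
      vacuous f (suc (suc b)) K (subst (λ b → Outside b (size f) c) (trans (+-suc b 1 ) (cong suc (+-comm b 1)))
        (outside-tail′ o))
      where
      outside-tail′ : Outside b (suc (suc (size f))) c → Outside (b + 2) (size f) c
      outside-tail′ (inj₁ lt) = inj₁ (≤-trans lt (m≤m+n b 2))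
      outside-tail′ (inj₂ le) = inj₂ (≤-trans (≤-reflexive (+-assoc b 2 (size f))) le)

    vacuouss : ∀ {n m} (gs : Vec (Rec n) m) b K {c v} → Outside b (sizes gs) c → Goods gs b K (c , v)
    vacuouss [] b K o = tt
    vacuouss (g ∷ gs) b K {c} o = vacuous g b K (first o) , vacuouss gs (b + size g) K (rest o)
      where
      first : Outside b (size g + sizes gs) c → Outside b (size g) c
      first (inj₁ lt) = inj₁ lt
      first (inj₂ le) = inj₂ (≤-trans (+-monoʳ-≤ b (m≤m+n (size g) (sizes gs))) le)
      rest : Outside b (size g + sizes gs) c → Outside (b + size g) (sizes gs) c
      rest (inj₁ lt) = inj₁ (≤-trans lt (m≤m+n b (size g)))
      rest (inj₂ le) = inj₂ (≤-trans (≤-reflexive (+-assoc b (size g) (sizes gs))) le)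

  _⊆_ : List FactData → List FactData → Set
  K ⊆ K′ = ∀ {x} → x ∈ K → x ∈ K′

  Args-mono : ∀ {n m} (gs : Vec (Rec n) m) b j v u {K K′} → K ⊆ K′ → Args gs b j v u K → Args gs b j v u K′
  Args-mono [] b j v u inc a = tt
  Args-mono (g ∷ gs) b j v u inc ((w , w∈ , eqs) , a) = (w , inc w∈ , eqs) , Args-mono gs (b + size g) (suc j) v u inc a

  Node-mono : ∀ {n} (t : Rec n) b v {K K′} → K ⊆ K′ → Node t b v K → Node t b v K′
  Node-mono zeroʳ b v inc a = a
  Node-mono succʳ b v inc a = a
  Node-mono (projʳ i) b v inc a = a
  Node-mono (compʳ f gs) b v inc (u , u∈ , e , a) = u , inc u∈ , e , Args-mono gs (suc b + size f) 0 v u inc a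
  Node-mono (precʳ g h) b v inc (inj₁ (z , u , u∈ , e)) = inj₁ (z , u , inc u∈ , e)
  Node-mono (precʳ g h) b v inc (inj₂ (k , e , u , u∈ , e₁ , sh , w , w∈ , e₂)) =
    inj₂ (k , e , u , inc u∈ , e₁ , sh , w , inc w∈ , e₂)
  Node-mono (muʳ f) b v inc (u , u∈ , e) = u , inc u∈ , e

  Seek-mono : ∀ n b v {K K′} → K ⊆ K′ → Seek n b v K → Seek n b v K′
  Seek-mono n b v inc (u , u∈ , sh , inj₁ e) = u , inc u∈ , sh , inj₁ e
  Seek-mono n b v inc (u , u∈ , sh , inj₂ (nz , w , w∈ , e)) = u , inc u∈ , sh , inj₂ (nz , w , inc w∈ , e)

  mutual
    Good-mono : ∀ {n} (t : Rec n) b {K K′} x → K ⊆ K′ → Good t b K x → Good t b K′ x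
    Good-mono t b (c , v) inc (own , sub) = (λ e → Node-mono t b v inc (own e)) , Goodˢ-mono t b (c , v) inc sub

    Goodˢ-mono : ∀ {n} (t : Rec n) b {K K′} x → K ⊆ K′ → Goodˢ t b K x → Goodˢ t b K′ x
    Goodˢ-mono zeroʳ b x inc a = tt
    Goodˢ-mono succʳ b x inc a = tt
    Goodˢ-mono (projʳ i) b x inc a = tt
    Goodˢ-mono (compʳ f gs) b x inc (a , as) = Good-mono f (suc b) x inc a , Goods-mono gs (suc b + size f) x inc as
    Goodˢ-mono (precʳ g h) b x inc (a , a′) = Good-mono g (suc b) x inc a , Good-mono h (suc b + size g) x inc a′
    Goodˢ-mono {n} (muʳ f) b (c , v) inc (s , a) =
      (λ e → Seek-mono n (suc b) v inc (s e)) , Good-mono f (suc (suc b)) (c , v) inc a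

    Goods-mono : ∀ {n m} (gs : Vec (Rec n) m) b {K K′} x → K ⊆ K′ → Goods gs b K x → Goods gs b K′ x
    Goods-mono [] b x inc a = tt
    Goods-mono (g ∷ gs) b x inc (a , as) = Good-mono g b x inc a , Goods-mono gs (b + size g) x inc as

  Within : ℕ → ℕ → List FactData → Set
  Within b s K = ∀ {x} → x ∈ K → b ≤ proj₁ x × proj₁ x < b + s

  Treeᵗ : ∀ {n} → Rec n → ℕ → FactData → Set
  Treeᵗ t b x = Σ (List FactData) λ K → x ∈ K × Within b (size t) K × (∀ {y} → y ∈ K → Good t b K y)

  above : ∀ {b s K x} → Within (suc b) s K → x ∈ K → proj₁ x ≢ b
  above win x∈ refl = <-irrefl refl (proj₁ (win x∈))

  mutual
    -- The lists of the subcomputations are joined under a new root. Their facts stay good because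
    -- goodness is monotone in the list and is vacuous for identifiers of other subterms.
    tree : ∀ {n} (t : Rec n) b {xs y} → t [ xs ]⇓ y → Treeᵗ t b (b , y ∷ toList xs)
    tree {n} zeroʳ b ⇓zero = leaf (zeroʳ {n}) b refl tt ≤-refl
    tree succʳ b ⇓succ = leaf succʳ b refl tt ≤-refl
    tree (projʳ i) b {xs} (⇓proj .i) = leaf (projʳ i) b (sym (nth-lookup xs i)) tt ≤-refl
    tree (compʳ f gs) b {xs} {y} (⇓comp {ys = ys} ds d)
      with tree f (suc b) d | trees gs (suc b + size f) ds
    ... | K , x∈ , win , good | Ks , args , wins , goods = L , here refl , within , λ { (here refl) →
          (λ _ → y ∷ toList ys , inK x∈ , refl , Args-mono gs (suc b + size f) 0 (y ∷ toList xs) (y ∷ toList ys) inKs (args 0 (y ∷ toList ys) λ _ → refl))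
          , vacuous f (suc b) L (inj₁ ≤-refl) , vacuouss gs (suc b + size f) L (inj₁ (s≤s (m≤m+n b (size f))))
        ; (there y∈) → split (∈-++⁻ K y∈) }
      where
      L : List FactData
      L = (b , y ∷ toList xs) ∷ K ++ Ks
      inK : K ⊆ L
      inK x∈ = there (∈-++⁺ˡ x∈)
      inKs : Ks ⊆ L
      inKs x∈ = there (∈-++⁺ʳ K x∈)
      split : ∀ {x} → x ∈ K ⊎ x ∈ Ks → Good (compʳ f gs) b L x
      split (inj₁ x∈) = (λ e → ⊥-elim (above win x∈ e)) , Good-mono f (suc b) _ inK (good x∈) ,
        vacuouss gs (suc b + size f) L (inj₁ (proj₂ (win x∈)))
      split (inj₂ x∈) = (λ e → ⊥-elim (<⇒≢ (≤-trans (s≤s (m≤m+n b (size f))) (proj₁ (wins x∈))) (sym e))) ,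
        vacuous f (suc b) L (inj₂ (proj₁ (wins x∈))) , Goods-mono gs (suc b + size f) _ inKs (goods x∈)
      within : Within b (suc (size f + sizes gs)) L
      within = within-node b (size f) (sizes gs) K Ks win wins
    tree (precʳ g h) b {k ∷ xs} d = go k d
      where
      go : ∀ k {y} → precʳ g h [ k ∷ xs ]⇓ y → Treeᵗ (precʳ g h) b (b , y ∷ k ∷ toList xs)
      go zero {y} (⇓prec0 d) with tree g (suc b) d
      ... | K , x∈ , win , good = (b , y ∷ 0 ∷ toList xs) ∷ K , here refl ,
        (λ { (here refl) → ≤-refl , ≤-trans (s≤s (m≤m+n b (size g + size h))) (≤-reflexive (sym (+-suc b (size g + size h))))
           ; (there x∈) → <⇒≤ (proj₁ (win x∈)) , ≤-trans (proj₂ (win x∈))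
               (≤-trans (s≤s (+-monoʳ-≤ b (m≤m+n (size g) (size h)))) (≤-reflexive (sym (+-suc b (size g + size h))))) }) ,
        λ { (here refl) → (λ _ → inj₁ (refl , y ∷ toList xs , there x∈ , refl , λ _ → refl)) ,
              vacuous g (suc b) _ (inj₁ ≤-refl) , vacuous h (suc b + size g) _ (inj₁ (s≤s (m≤m+n b (size g))))
          ; (there y∈) → (λ e → ⊥-elim (above win y∈ e)) , Good-mono g (suc b) _ there (good y∈) ,
              vacuous h (suc b + size g) _ (inj₁ (proj₂ (win y∈))) }
      go (suc k) {y} (⇓precS {r = r} d d′) with go k d | tree h (suc b + size g) d′
      ... | K , x∈ , win , good | K′ , x′∈ , win′ , good′ = L , here refl ,
        (λ { (here refl) → ≤-refl , ≤-trans (s≤s (m≤m+n b (size g + size h))) (≤-reflexive (sym (+-suc b (size g + size h))))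
           ; (there z∈) → within (∈-++⁻ K z∈) }) ,
        λ { (here refl) → (λ _ → inj₂ (k , refl , r ∷ k ∷ toList xs , inK x∈ , refl , (λ _ → refl) ,
                y ∷ k ∷ r ∷ toList xs , inK′ x′∈ , refl , refl , refl , λ _ → refl)) ,
              vacuous g (suc b) L (inj₁ ≤-refl) , vacuous h (suc b + size g) L (inj₁ (s≤s (m≤m+n b (size g))))
          ; (there z∈) → split (∈-++⁻ K z∈) }
        where
        L : List FactData
        L = (b , y ∷ suc k ∷ toList xs) ∷ K ++ K′
        inK : K ⊆ L
        inK x∈ = there (∈-++⁺ˡ x∈)
        inK′ : K′ ⊆ L
        inK′ x∈ = there (∈-++⁺ʳ K x∈)
        within : ∀ {x} → x ∈ K ⊎ x ∈ K′ → b ≤ proj₁ x × proj₁ x < b + suc (size g + size h)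
        within (inj₁ x∈) = win x∈
        within (inj₂ x∈) = ≤-trans (m≤n⇒m≤1+n (m≤m+n b (size g))) (proj₁ (win′ x∈)) ,
          ≤-trans (proj₂ (win′ x∈)) (≤-reflexive (trans (cong suc (+-assoc b (size g) (size h))) (sym (+-suc b (size g + size h)))))
        split : ∀ {x} → x ∈ K ⊎ x ∈ K′ → Good (precʳ g h) b L x
        split (inj₁ x∈) = Good-mono (precʳ g h) b _ inK (good x∈)
        split (inj₂ x∈) = (λ e → ⊥-elim (<⇒≢ (≤-trans (s≤s (m≤m+n b (size g))) (proj₁ (win′ x∈))) (sym e))) ,
          vacuous g (suc b) L (inj₂ (proj₁ (win′ x∈))) , Good-mono h (suc b + size g) _ inK′ (good′ x∈)
    tree {n} (muʳ f) b {xs} {y} (⇓mu d below) with go y 0 (+-identityʳ y)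
      where
      b₂ : ℕ
      b₂ = suc (suc b)
      -- Only the search facts, with identifier `suc b`, and the evaluations of `f` are collected
      -- here; the node with identifier `b` is added at the end.
      go : ∀ m z → m + z ≡ y → Σ (List FactData) λ K → (suc b , y ∷ z ∷ toList xs) ∈ K ×
           Within (suc b) (suc (size f)) K × (∀ {x} → x ∈ K → Goodˢ (muʳ f) b K x)
      go zero z refl with tree f b₂ d
      ... | K , x∈ , win , good = (suc b , y ∷ z ∷ toList xs) ∷ K , here refl , within-root (suc b) (size f) K win ,
        λ { (here refl) → (λ _ → 0 ∷ z ∷ toList xs , there x∈ , (λ _ → refl) , inj₁ (refl , refl)) , vacuous f b₂ _ (inj₁ ≤-refl)
          ; (there x∈) → (λ e → ⊥-elim (above win x∈ e)) , Good-mono f b₂ _ there (good x∈) }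
      go (suc m) z eq with below z (subst (suc z ≤_) eq (s≤s (m≤n+m z m)))
      ... | w , d′ with tree f b₂ d′ | go m (suc z) (trans (+-suc m z) eq)
      ... | K , x∈ , win , good | K′ , x′∈ , win′ , good′ = L , here refl ,
        (λ { (here refl) → within-root (suc b) (size f) K win (here {x = suc b , y ∷ z ∷ toList xs} refl)
           ; (there v∈) → within (∈-++⁻ K v∈) }) ,
        λ { (here refl) → (λ _ → suc w ∷ z ∷ toList xs , inK x∈ , (λ _ → refl) ,
               inj₂ ((λ ()) , y ∷ suc z ∷ toList xs , inK′ x′∈ , refl , refl , λ _ → refl)) , vacuous f b₂ L (inj₁ ≤-refl)
          ; (there v∈) → split (∈-++⁻ K v∈) }
        where
        L : List FactData
        L = (suc b , y ∷ z ∷ toList xs) ∷ K ++ K′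
        inK : K ⊆ L
        inK x∈ = there (∈-++⁺ˡ x∈)
        inK′ : K′ ⊆ L
        inK′ x∈ = there (∈-++⁺ʳ K x∈)
        within : ∀ {x} → x ∈ K ⊎ x ∈ K′ → suc b ≤ proj₁ x × proj₁ x < suc b + suc (size f)
        within (inj₁ x∈) = <⇒≤ (proj₁ (win x∈)) , ≤-trans (proj₂ (win x∈)) (≤-reflexive (sym (+-suc (suc b) (size f))))
        within (inj₂ x∈) = win′ x∈
        split : ∀ {x} → x ∈ K ⊎ x ∈ K′ → Goodˢ (muʳ f) b L x
        split (inj₁ x∈) = (λ e → ⊥-elim (above win x∈ e)) , Good-mono f b₂ _ inK (good x∈)
        split (inj₂ x∈) = Goodˢ-mono (muʳ f) b _ inK′ (good′ x∈)
    ... | K , x∈ , win , good = (b , y ∷ toList xs) ∷ K , here refl , within-root b (suc (size f)) K win ,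
        λ { (here refl) → (λ _ → y ∷ 0 ∷ toList xs , there x∈ , refl , refl , λ _ → refl) ,
              (λ ()) , vacuous f (suc (suc b)) _ (inj₁ (m≤n⇒m≤1+n ≤-refl))
          ; (there x∈) → (λ e → ⊥-elim (above win x∈ e)) , Goodˢ-mono (muʳ f) b _ there (good x∈) }

    leaf : ∀ {n} (t : Rec n) b {v} → Node t b v ((b , v) ∷ []) → Goodˢ t b ((b , v) ∷ []) (b , v) → 1 ≤ size t →
           Treeᵗ t b (b , v)
    leaf t b {v} node sub 1≤ = (b , v) ∷ [] , here refl ,
      (λ { (here refl) → ≤-refl , ≤-trans (≤-reflexive (+-comm 1 b)) (+-monoʳ-≤ b 1≤) }) ,
      λ { (here refl) → (λ _ → node) , sub }

    within-root : ∀ b s K {v} → Within (suc b) s K → Within b (suc s) ((b , v) ∷ K)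
    within-root b s K win (here refl) = ≤-refl , ≤-trans (s≤s (m≤m+n b s)) (≤-reflexive (sym (+-suc b s)))
    within-root b s K win (there x∈) = <⇒≤ (proj₁ (win x∈)) , ≤-trans (proj₂ (win x∈)) (≤-reflexive (sym (+-suc b s)))

    within-node : ∀ b s s′ K K′ {v} → Within (suc b) s K → Within (suc b + s) s′ K′ →
                  Within b (suc (s + s′)) ((b , v) ∷ K ++ K′)
    within-node b s s′ K K′ win win′ (here refl) = ≤-refl , ≤-trans (s≤s (m≤m+n b (s + s′))) (≤-reflexive (sym (+-suc b (s + s′))))
    within-node b s s′ K K′ win win′ (there x∈) with ∈-++⁻ K x∈
    ... | inj₁ x∈ = <⇒≤ (proj₁ (win x∈)) , ≤-trans (proj₂ (win x∈))
          (≤-trans (s≤s (+-monoʳ-≤ b (m≤m+n s s′))) (≤-reflexive (sym (+-suc b (s + s′)))))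
    ... | inj₂ x∈ = ≤-trans (m≤n⇒m≤1+n (m≤m+n b s)) (proj₁ (win′ x∈)) ,
          ≤-trans (proj₂ (win′ x∈)) (≤-reflexive (trans (cong suc (+-assoc b s s′)) (sym (+-suc b (s + s′)))))

    trees : ∀ {n m} (gs : Vec (Rec n) m) b {xs ys} → gs [ xs ]⇓* ys → Σ (List FactData) λ K →
      (∀ j u → (∀ i → nth u (suc (j + i)) ≡ nth (toList ys) i) → ∀ {y} → Args gs b j (y ∷ toList xs) u K)
      × Within b (sizes gs) K × (∀ {x} → x ∈ K → Goods gs b K x)
    trees [] b ⇓[] = [] , (λ j u e → tt) , (λ ()) , λ ()
    trees (g ∷ gs) b {xs} {y ∷ ys} (⇓∷ d ds) with tree g b d | trees gs (b + size g) ds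
    ... | K , x∈ , win , good | Ks , args , wins , goods = K ++ Ks ,
        (λ j u e {z} → (y ∷ toList xs , ∈-++⁺ˡ x∈ , (λ _ → refl) , trans (cong (nth u ∘ suc) (sym (+-identityʳ j))) (e 0)) ,
          Args-mono gs (b + size g) (suc j) (z ∷ toList xs) u (∈-++⁺ʳ K)
            (args (suc j) u (λ i → trans (cong (nth u ∘ suc) (sym (+-suc j i))) (e (suc i))))) ,
        (λ x∈ → within (∈-++⁻ K x∈)) , λ x∈ → split (∈-++⁻ K x∈)
      where
      within : ∀ {x} → x ∈ K ⊎ x ∈ Ks → b ≤ proj₁ x × proj₁ x < b + (size g + sizes gs)
      within (inj₁ x∈) = proj₁ (win x∈) , ≤-trans (proj₂ (win x∈)) (+-monoʳ-≤ b (m≤m+n (size g) (sizes gs)))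
      within (inj₂ x∈) = ≤-trans (m≤m+n b (size g)) (proj₁ (wins x∈)) ,
        ≤-trans (proj₂ (wins x∈)) (≤-reflexive (+-assoc b (size g) (sizes gs)))
      split : ∀ {x} → x ∈ K ⊎ x ∈ Ks → Goods (g ∷ gs) b (K ++ Ks) x
      split (inj₁ x∈) = Good-mono g b _ ∈-++⁺ˡ (good x∈) , vacuouss gs (b + size g) (K ++ Ks) (inj₁ (proj₂ (win x∈)))
      split (inj₂ x∈) = vacuous g b (K ++ Ks) (inj₂ (proj₁ (wins x∈))) , Goods-mono gs (b + size g) _ (∈-++⁺ʳ K) (goods x∈)

-- Points, colours and definable partitions in the semilattice.

module Colouring where

  open PrimitiveRecursion
  open Machine
  open Histories
  open Elements
  open Disjointness
  open Links
  open Splittings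
  open Inseparability
  open Formulas using (module Truth)

  open Link
  open Truth _≈C_ _≤C_ _∨C_

  module Modulus (w : ℕ) where

    abstract
      turn : ℕ → ℕ
      turn c = ifz (eq (suc c) (suc w)) (suc c) 0

      -- The residue modulo `suc w`. Each colour recurs infinitely often, which makes its point
      -- nontrivial.
      col : ℕ → ℕ
      col = natrec 0 λ _ → turn

      colᴾ : PR₁ col
      colᴾ = PR₁-natrec {h = λ _ c _ → turn c} (PR₁-const 0) PR₁-id
        (PR₁-ifz (PR₁-eq (PR₁-suc C) (PR₁-const (suc w))) (PR₁-suc C) (PR₁-const 0))
        where
        C : PR₁ (λ z → π₂ (π₁ z))
        C = PR₁-π₂ fstᴾ

      turn-≤ : ∀ {c} → c ≤ w → turn c ≤ w
      turn-≤ {c} c≤w with c ≟ w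
      ... | yes refl rewrite eq-refl (suc w) = z≤n
      ... | no c≢w rewrite eq-false {suc c} {suc w} (λ e → c≢w (suc-injective e)) = ≤∧≢⇒< c≤w c≢w

      col-≤ : ∀ n → col n ≤ w
      col-≤ zero = z≤n
      col-≤ (suc n) = turn-≤ (col-≤ n)

      col-small : ∀ {i} → i ≤ w → col i ≡ i
      col-small {zero} _ = refl
      col-small {suc i} i<w rewrite col-small {i} (<⇒≤ i<w) | eq-false {suc i} {suc w} (λ e → <-irrefl (suc-injective e) i<w) = refl

      col-periodic : ∀ n → col (suc w + n) ≡ col n
      col-periodic zero rewrite +-identityʳ w | col-small {w} ≤-refl | eq-refl (suc w) = refl
      col-periodic (suc n) rewrite +-suc w n = cong turn (col-periodic n)

      col-infinite : ∀ {i} → i ≤ w → ∀ B → Σ ℕ λ n → B ≤ n × col n ≡ i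
      col-infinite {i} i≤w zero = i , z≤n , col-small i≤w
      col-infinite i≤w (suc B) with col-infinite i≤w B
      ... | n , B≤n , e = suc w + n , s≤s (≤-trans B≤n (m≤n+m n w)) , trans (col-periodic n) e

      -- The function of the colour given by t, which matters below suc w only.
      painted : (ℕ → ℕ) → ℕ → ℕ
      painted t n = table (suc w) t (col n)

      paintedᴾ : ∀ t → PR₁ (painted t)
      paintedᴾ t = PR₁-∘ (PR₁-table (suc w) t) colᴾ

      painted-col : ∀ t n → painted t n ≡ t (col n)
      painted-col t n = table-< (suc w) t (s≤s (col-≤ n))

      painted-periodic : ∀ t n → painted t (suc w + n) ≡ painted t n
      painted-periodic t n = cong (table (suc w) t) (col-periodic n)

  interleave : ∀ {A : Set} → (ℕ → A) → (ℕ → A) → (ℕ → A) → ℕ → A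
  interleave f g h 0 = f 0
  interleave f g h 1 = g 0
  interleave f g h 2 = h 0
  interleave f g h (suc (suc (suc m))) = interleave (f ∘ suc) (g ∘ suc) (h ∘ suc) m

  module _ {A : Set} where

    interleave-0 : ∀ (f g h : ℕ → A) s → interleave f g h (s * 3) ≡ f s
    interleave-0 f g h zero = refl
    interleave-0 f g h (suc s) = interleave-0 (f ∘ suc) (g ∘ suc) (h ∘ suc) s

    interleave-1 : ∀ (f g h : ℕ → A) s → interleave f g h (1 + s * 3) ≡ g s
    interleave-1 f g h zero = refl
    interleave-1 f g h (suc s) = interleave-1 (f ∘ suc) (g ∘ suc) (h ∘ suc) s

    interleave-2 : ∀ (f g h : ℕ → A) s → interleave f g h (2 + s * 3) ≡ h s
    interleave-2 f g h zero = refl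
    interleave-2 f g h (suc s) = interleave-2 (f ∘ suc) (g ∘ suc) (h ∘ suc) s

  piece-mono : ∀ {E D} → PR₁ E → (∀ n → E n ≢ 0 → D n ≢ 0) → (piece E p ⁺) ≤ᵖʳₘ (piece D p ⁺)
  piece-mono {E} {D} Eᴾ inc = ⁺-≤ (piece E p) (piece D p ⁺) {0} {1} refl refl (λ n → ifz (E n) 1 (suc (suc n)))
    (PR₁-ifz Eᴾ (PR₁-const 1) (PR₁-suc (PR₁-suc PR₁-id))) value
    where
    value : ∀ n → nz (piece E p n) ≡ (piece D p ⁺) (ifz (E n) 1 (suc (suc n)))
    value n with zero? (E n)
    ... | inj₁ z = trans (nz-and-false (p n) z) (cong (piece D p ⁺) (sym (ifz-zero 1 (suc (suc n)) z)))
    ... | inj₂ e = trans (trans (nz-and-true (p n) e) (sym (nz-and-true (p n) (inc n e))))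
                         (cong (piece D p ⁺) (sym (ifz-nonzero 1 (suc (suc n)) e)))

  piece-≤-p : ∀ {E} → PR₁ E → (piece E p ⁺) ≤ᵖʳₘ (p ⁺)
  piece-≤-p {E} Eᴾ = ⁺-≤ (piece E p) (p ⁺) {0} {1} refl refl (λ n → ifz (E n) 1 (suc (suc n)))
    (PR₁-ifz Eᴾ (PR₁-const 1) (PR₁-suc (PR₁-suc PR₁-id))) value
    where
    value : ∀ n → nz (piece E p n) ≡ (p ⁺) (ifz (E n) 1 (suc (suc n)))
    value n with zero? (E n)
    ... | inj₁ z = trans (nz-and-false (p n) z) (cong (p ⁺) (sym (ifz-zero 1 (suc (suc n)) z)))
    ... | inj₂ e = trans (nz-and-true (p n) e) (cong (p ⁺) (sym (ifz-nonzero 1 (suc (suc n)) e)))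

  χ-nz : ∀ b → nz (χ b) ≡ b
  χ-nz true = refl
  χ-nz false = refl

  Part : (X : CElt) → ∀ {E} → PR₁ E → CElt
  Part X {E} Eᴾ = el (piece E (χ ∘ proj₁ X)) (Rec₁-piece Eᴾ (proj₁ (proj₂ X)))

  part-≤ : ∀ X {E} (Eᴾ : PR₁ E) (T : ℕ → Bool) {n y} → T y ≡ true → T n ≡ false → ∀ {f} → PR₁ f →
           (∀ x → E x ≢ 0 → proj₁ X x ≡ T (f x)) → proj₁ (Part X Eᴾ) ≤ᵖʳₘ T
  part-≤ X {E} Eᴾ T {n} Ty Tn {f} fᴾ ok = ⁺-≤ (piece E (χ ∘ proj₁ X)) T Ty Tn (λ x → ifz (E x) n (f x))
    (PR₁-ifz Eᴾ (PR₁-const n) fᴾ) value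
    where
    value : ∀ x → nz (and (E x) (χ (proj₁ X x))) ≡ T (ifz (E x) n (f x))
    value x with zero? (E x)
    ... | inj₁ z = trans (nz-and-false (χ (proj₁ X x)) z) (trans (sym Tn) (cong T (sym (ifz-zero n (f x) z))))
    ... | inj₂ e = trans (nz-and-true (χ (proj₁ X x)) e) (trans (χ-nz (proj₁ X x)) (trans (ok x e) (cong T (sym (ifz-nonzero n (f x) e)))))

  part-below : ∀ X {E} (Eᴾ : PR₁ E) → Part X Eᴾ ⊴ X
  part-below X Eᴾ = inhabited X >>= λ { (y , Xy) → coinhabited X >>= λ { (n , Xn) →
    return (part-≤ X Eᴾ (proj₁ X) Xy Xn PR₁-id (λ _ _ → refl)) } }

  module Colours (w : ℕ) (class : ℕ → ℕ → ℕ) (class-0 : ∀ i → class 0 i ≡ i)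
                 (value zeroᵗ : ℕ → ℕ) (type : ℕ → ℕ → ℕ) where

    open Modulus w public

    cls : ℕ → ℕ → ℕ
    cls s = painted (class s)

    module C (s : ℕ) = Classes (cls s) (paintedᴾ (class s)) w (painted-periodic (class s))

    Paintᶜ : (ℕ → ℕ) → CElt
    Paintᶜ t = Pieceᶜ (painted t) (paintedᴾ t)

    -- The order is that of the variables from 32 on: p, o, the values, zero, then triples of q, r
    -- and a type of facts.
    κ : ℕ → CElt
    κ 0 = Pᶜ
    κ 1 = 𝟘
    κ 2 = Paintᶜ value
    κ 3 = Paintᶜ zeroᵗ
    κ (suc (suc (suc (suc m)))) = interleave (λ s → Qᶜ (C.link s)) (λ s → Rᶜ (C.link s)) (λ b → Paintᶜ (type b)) m

    open At κ public

    is : ℕ → ℕ → ℕ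
    is i j = eq j i

    painted-is : ∀ i n → painted (is i) n ≢ 0 → col n ≡ i
    painted-is i n p = eq-true (subst (_≢ 0) (painted-col (is i) n) p)

    is-painted : ∀ i n → col n ≡ i → painted (is i) n ≢ 0
    is-painted i n e z = 1+n≢0 (trans (sym (eq-refl i)) (trans (cong (λ j → eq j i) (sym e)) (trans (sym (painted-col (is i) n)) z)))

    HasColour : CElt → ℕ → Set
    HasColour X i = (proj₁ X ≤ᵖʳₘ (piece (painted (is i)) p ⁺)) × ¬ (X ≤C 𝟘)

    insep-≡ : ∀ s → Insep s ≡ Inseparable Pᶜ 𝟘 (Qᶜ (C.link s)) (Rᶜ (C.link s))
    insep-≡ s = cong₂ (Inseparable Pᶜ 𝟘) (interleave-0 _ _ _ s) (interleave-1 _ (λ s → Rᶜ (C.link s)) (λ b → Paintᶜ (type b)) s)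

    insep : ∀ s {X Y i j} → HasColour X i → HasColour Y j → class s i ≡ class s j → Insep s X Y
    insep s {X} {Y} {i} {j} (X≤ , X≢0) (Y≤ , Y≢0) e = subst (λ R → R X Y) (sym (insep-≡ s))
      (inseparable (cls s) (paintedᴾ (class s)) w (painted-periodic (class s))
        (paintedᴾ (is i)) (paintedᴾ (is j))
        (λ n c → trans (painted-col (class s) n) (cong (class s) (painted-is i n c)))
        (λ n c → trans (painted-col (class s) n) (trans (cong (class s) (painted-is j n c)) (sym e)))
        X Y X≤ Y≤ X≢0 Y≢0)

    sep : ∀ s t → (∀ i j → class s i ≡ class s j → t i ≡ t j) → ∀ X Y →
          proj₁ X ≤ᵖʳₘ (piece (painted t) p ⁺) → proj₁ Y ≤ᵖʳₘ (piece (not ∘ painted t) p ⁺) → ¬ Insep s X Y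
    sep s t closed X Y X≤ Y≤ ins = separable (C.link s) (paintedᴾ t) closed′ X Y X≤ Y≤
        (subst (λ R → R X Y) (insep-≡ s) ins)
      where
      closed′ : ∀ n → nz (painted t (nx (C.link s) n)) ≡ nz (painted t n)
      closed′ n = cong nz (trans (painted-col t m) (trans (closed (col m) (col n)
        (trans (sym (painted-col (class s) m)) (trans (C.successor-class s n) (painted-col (class s) n))))
        (sym (painted-col t n))))
        where
        m : ℕ
        m = C.successor s n

    -- If the classes differed, the union of the colours in the class of `i` would be closed under
    -- partition `s` and separate `X` from `Y`.
    sep-colours : ∀ s {X Y i j} → HasColour X i → HasColour Y j → Insep s X Y → class s i ≡ class s j
    sep-colours s {X} {Y} {i} {j} (X≤ , _) (Y≤ , _) ins with class s j ≟ class s i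
    ... | yes e = sym e
    ... | no ≢ = ⊥-elim (sep s t (λ a b e → cong (λ c → eq c (class s i)) e) X Y
        (≤-transᵖʳ (proj₁ X) (piece (painted (is i)) p ⁺) (piece (painted t) p ⁺) X≤
          (piece-mono (paintedᴾ (is i)) λ n c z → 1+n≢0 (trans (sym (eq-refl (class s i)))
            (trans (cong (λ m → eq (class s m) (class s i)) (sym (painted-is i n c))) (trans (sym (painted-col t n)) z)))))
        (≤-transᵖʳ (proj₁ Y) (piece (painted (is j)) p ⁺) (piece (not ∘ painted t) p ⁺) Y≤
          (piece-mono (paintedᴾ (is j)) λ n c → not-zero (trans (painted-col t n)
            (trans (cong (λ m → eq (class s m) (class s i)) (painted-is j n c)) (eq-false ≢)))))
        ins)
      where
      t : ℕ → ℕ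
      t m = eq (class s m) (class s i)

    paint : ∀ t {X i} → HasColour X i → t i ≢ 0 → X ⊴ Paintᶜ t
    paint t {X} {i} (X≤ , _) ti = return (≤-transᵖʳ (proj₁ X) (piece (painted (is i)) p ⁺) (piece (painted t) p ⁺) X≤
      (piece-mono (paintedᴾ (is i)) λ n c z → ti (trans (cong t (sym (painted-is i n c))) (trans (sym (painted-col t n)) z))))

    -- Otherwise `X` would lie below two complementary pieces of p and be trivial.
    unpaint : ∀ t {X i} → HasColour X i → X ⊴ Paintᶜ t → t i ≢ 0
    unpaint t {X} {i} (X≤ , X≢0) X⊴ ti = X⊴ λ X≤t → pieces-disjoint idᴸ (paintedᴾ (is i)) (λ _ → refl) (proj₁ X) X≤
      (≤-transᵖʳ (proj₁ X) (piece (painted t) p ⁺) (piece (not ∘ painted (is i)) p ⁺) X≤t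
        (piece-mono (paintedᴾ t) λ n c → not-zero (off n c))) X≢0
      where
      off : ∀ n → painted t n ≢ 0 → painted (is i) n ≡ 0
      off n c = trans (painted-col (is i) n) (eq-false λ e → c (trans (painted-col t n) (trans (cong t e) ti)))

    point : ℕ → CElt
    point i = Paintᶜ (is i)

    point-colour : ∀ {i} → i ≤ w → HasColour (point i) i
    point-colour {i} i≤w = ≤-reflᵖʳ (piece (painted (is i)) p ⁺) ,
      piece-≢0 (painted (is i)) (paintedᴾ (is i)) λ B → let n , B≤n , e = col-infinite i≤w B in n , B≤n , is-painted i n e

    below-colour : ∀ {X Y i} → Y ≤C X → ¬ (Y ≤C 𝟘) → HasColour X i → HasColour Y i
    below-colour {X} {Y} {i} Y≤X Y≢0 (X≤ , _) = ≤-transᵖʳ (proj₁ Y) (proj₁ X) (piece (painted (is i)) p ⁺) Y≤X X≤ , Y≢0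

    colour⇒point : ∀ {X i} → HasColour X i → Point X
    colour⇒point {X} {i} c@(X≤ , X≢0) k = k
      (return (≤-transᵖʳ (proj₁ X) (piece (painted (is i)) p ⁺) (p ⁺) X≤ (piece-≤-p (paintedᴾ (is i)))))
      (λ X⊴0 → X⊴0 X≢0)
      λ Y Z Y⊴ Z⊴ Y≢0 Z≢0 u u′ v v′ a b P Q R h₁ h₂ h₃ h₄ d d′ Yu Zu → Y⊴ λ Y≤ → Z⊴ λ Z≤ →
        insep 0 {Y} {Z} {i} {i} (below-colour {X} {Y} Y≤ (λ z → Y≢0 (return z)) c) (below-colour {X} {Z} Z≤ (λ z → Z≢0 (return z)) c) refl
          u u′ v v′ a b P Q R h₁ h₂ h₃ h₄ d d′ Yu Zu

    -- For each colour, `X` falls into the part that `f` sends to that colour and the rest.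
    -- Partition 0 separates these, so for a point one of them is trivial. If the rest is, `X` has
    -- the colour; if no rest is, the finitely many trivial parts combine to decide `X`.
    point⇒colour : ∀ {X} → Point X → ¬ ¬ (Σ ℕ λ i → i ≤ w × HasColour X i)
    point⇒colour {X} pt colourless = pt λ X⊴p X≢0 mono → X⊴p λ X≤p → argue X≤p X≢0 mono
      where
      argue : proj₁ X ≤ᵖʳₘ (p ⁺) → ¬ (X ⊴ 𝟘) →
        (∀ y z → y ⊴ X → z ⊴ X → ¬ (y ⊴ 𝟘) → ¬ (z ⊴ 𝟘) → Insep 0 y z) → ⊥
      argue X≤p X≢0 mono with reduction (proj₁ X) (p ⁺) X≤p
      ... | f , fᴾ , fok = all-trivial (suc w) ≤-refl λ { (d , dᴾ , dok) → X≢0 (return (trivial d dᴾ dok)) }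
        where
        α : ℕ → ℕ
        α x = pred (pred (f x))
        αᴾ : PR₁ α
        αᴾ = PR₁-pred (PR₁-pred fᴾ)
        In? Out? : ℕ → ℕ → ℕ
        In? i x = and (pred (f x)) (painted (is i) (α x))
        Out? i x = and (pred (f x)) (not (painted (is i) (α x)))
        Inᴾ : ∀ i → PR₁ (In? i)
        Inᴾ i = PR₁-and (PR₁-pred fᴾ) (PR₁-∘ (paintedᴾ (is i)) αᴾ)
        Outᴾ : ∀ i → PR₁ (Out? i)
        Outᴾ i = PR₁-and (PR₁-pred fᴾ) (PR₁-not (PR₁-∘ (paintedᴾ (is i)) αᴾ))
        Xin Xout : ℕ → CElt
        Xin i = Part X (Inᴾ i)
        Xout i = Part X (Outᴾ i)
        big : ∀ x → pred (f x) ≢ 0 → ∀ D → D (α x) ≢ 0 → proj₁ X x ≡ (piece D p ⁺) (f x)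
        big x b D d = trans (fok x) (trans (⁺-large p (f x) b)
          (trans (sym (nz-and-true (p (α x)) d)) (sym (⁺-large (piece D p) (f x) b))))
        in-≤ : ∀ i → proj₁ (Xin i) ≤ᵖʳₘ (piece (painted (is i)) p ⁺)
        in-≤ i = part-≤ X (Inᴾ i) (piece (painted (is i)) p ⁺) {1} {0} refl refl fᴾ λ x e →
          let b , c = and-true {pred (f x)} e in big x b (painted (is i)) c
        out-≤ : ∀ i → proj₁ (Xout i) ≤ᵖʳₘ (piece (not ∘ painted (is i)) p ⁺)
        out-≤ i = part-≤ X (Outᴾ i) (piece (not ∘ painted (is i)) p ⁺) {1} {0} refl refl fᴾ λ x e →
          let b , c = and-true {pred (f x)} e in big x b (not ∘ painted (is i)) c
        coloured : ∀ i → i ≤ w → Xout i ≤C 𝟘 → ⊥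
        coloured i i≤w out≤0 with decide (proj₁ (Xout i)) out≤0
        ... | d , dᴾ , dok = colourless (i , i≤w , X≤ , λ z → X≢0 (return z))
          where
          g : ℕ → ℕ
          -- On the trivial part the decided answer is sent to the fixed member 0 or the fixed
          -- non-member 1.
          g x = ifz (Out? i x) (f x) (not (d (suc (suc x))))
          ok : ∀ x → proj₁ X x ≡ (piece (painted (is i)) p ⁺) (g x)
          ok x with zero? (Out? i x)
          ... | inj₂ o = trans (trans (sym (χ-nz (proj₁ X x))) (trans (sym (nz-and-true (χ (proj₁ X x)) o)) (dok (suc (suc x)))))
                (trans (small (d (suc (suc x)))) (cong (piece (painted (is i)) p ⁺) (sym (ifz-nonzero (f x) _ o))))
            where
            small : ∀ m → nz m ≡ (piece (painted (is i)) p ⁺) (not m)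
            small zero = refl
            small (suc m) = refl
          ... | inj₁ z = trans (go (zero? (pred (f x)))) (cong (piece (painted (is i)) p ⁺) (sym (ifz-zero (f x) _ z)))
            where
            tiny : ∀ m {a} → pred m ≡ 0 → (p ⁺) m ≡ (a ⁺) m
            tiny zero _ = refl
            tiny (suc zero) _ = refl
            go : pred (f x) ≡ 0 ⊎ pred (f x) ≢ 0 → proj₁ X x ≡ (piece (painted (is i)) p ⁺) (f x)
            go (inj₁ s) = trans (fok x) (tiny (f x) s)
            go (inj₂ b) = big x b (painted (is i)) λ c → and-intro b (not-zero c) z
          X≤ : proj₁ X ≤ᵖʳₘ (piece (painted (is i)) p ⁺)
          X≤ = reduce (proj₁ X) (piece (painted (is i)) p ⁺) g
            (PR₁-ifz (Outᴾ i) fᴾ (PR₁-not (PR₁-∘ dᴾ (PR₁-suc (PR₁-suc PR₁-id))))) ok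
        in-trivial : ∀ i → i ≤ w → Xin i ⊴ 𝟘
        in-trivial i i≤w in≢0 = sep 0 (is i)
          (λ a b e → cong (λ c → eq c i) (trans (sym (class-0 a)) (trans e (class-0 b))))
          (Xin i) (Xout i) (in-≤ i) (out-≤ i)
          (mono (Xin i) (Xout i) (part-below X (Inᴾ i)) (part-below X (Outᴾ i)) (λ t → t in≢0)
            (λ t → t (coloured i i≤w)))
        all-trivial : ∀ m → m ≤ suc w → ¬ ¬ (Σ (ℕ → ℕ) λ d → PR₁ d ×
          (∀ x → pred (f x) ≢ 0 → col (α x) < m → proj₁ X x ≡ nz (d x)))
        all-trivial zero _ = return (const 0 , PR₁-const 0 , λ _ _ ())
        all-trivial (suc m) m<w = all-trivial m (<⇒≤ m<w) >>= λ { (d , dᴾ , dok) → in-trivial m (≤-pred m<w) >>= λ t →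
          let e , eᴾ , eok = decide (proj₁ (Xin m)) t in
          return ((λ x → ifz (painted (is m) (α x)) (d x) (e (suc (suc x)))) ,
            PR₁-ifz (PR₁-∘ (paintedᴾ (is m)) αᴾ) dᴾ (PR₁-∘ eᴾ (PR₁-suc (PR₁-suc PR₁-id))) ,
            λ x b c<sm → pick x b c<sm d e dok eok (zero? (painted (is m) (α x)))) }
          where
          pick : ∀ x → pred (f x) ≢ 0 → col (α x) < suc m → ∀ d e →
            (∀ x → pred (f x) ≢ 0 → col (α x) < m → proj₁ X x ≡ nz (d x)) →
            (∀ x → proj₁ (Xin m) x ≡ nz (e x)) →
            painted (is m) (α x) ≡ 0 ⊎ painted (is m) (α x) ≢ 0 →
            proj₁ X x ≡ nz (ifz (painted (is m) (α x)) (d x) (e (suc (suc x))))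
          pick x b c<sm d e dok eok (inj₁ z) = trans
            (dok x b (≤∧≢⇒< (≤-pred c<sm) λ c → is-painted m (α x) c z)) (cong nz (sym (ifz-zero (d x) _ z)))
          pick x b c<sm d e dok eok (inj₂ c) = trans (trans (sym (χ-nz (proj₁ X x)))
              (trans (sym (nz-and-true (χ (proj₁ X x)) (and-intro b c))) (eok (suc (suc x)))))
            (cong nz (sym (ifz-nonzero (d x) _ c)))
        trivial : ∀ d → PR₁ d → (∀ x → pred (f x) ≢ 0 → col (α x) < suc w → proj₁ X x ≡ nz (d x)) → X ≤C 𝟘
        trivial d dᴾ dok = decidable (proj₁ X) (PR₁-ifz (PR₁-pred fᴾ) (PR₁-not fᴾ) dᴾ) λ x → go x (zero? (pred (f x)))
          where
          tiny : ∀ m → pred m ≡ 0 → (p ⁺) m ≡ nz (not m)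
          tiny zero _ = refl
          tiny (suc zero) _ = refl
          go : ∀ x → pred (f x) ≡ 0 ⊎ pred (f x) ≢ 0 → proj₁ X x ≡ nz (ifz (pred (f x)) (not (f x)) (d x))
          go x (inj₁ z) = trans (fok x) (trans (tiny (f x) z) (cong nz (sym (ifz-zero (not (f x)) (d x) z))))
          go x (inj₂ b) = trans (dok x b (s≤s (col-≤ (α x)))) (cong nz (sym (ifz-nonzero (not (f x)) (d x) b)))

-- The model of a true computation, and falsity of its sentence when the output is 1.

module Interpretation where

  open PrimitiveRecursion
  open Machine
  open Histories
  open Elements
  open Disjointness
  open Links
  open Splittings
  open Inseparability
  open Formulas
  open Computations
  open Colouring

  open Truth _≈C_ _≤C_ _∨C_

  factAt : List FactData → ℕ → FactData
  factAt [] i = 0 , []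
  factAt (x ∷ L) zero = x
  factAt (x ∷ L) (suc i) = factAt L i

  factAt-∈ : ∀ L {i} → i < length L → factAt L i ∈ L
  factAt-∈ (x ∷ L) {zero} _ = here refl
  factAt-∈ (x ∷ L) {suc i} (s≤s lt) = there (factAt-∈ L lt)

  ∈-factAt : ∀ {L x} → x ∈ L → Σ ℕ λ i → i < length L × factAt L i ≡ x
  ∈-factAt (here refl) = 0 , s≤s z≤n , refl
  ∈-factAt (there x∈) with ∈-factAt x∈
  ... | i , lt , e = suc i , s≤s lt , e

  total : List ℕ → ℕ
  total [] = 0
  total (x ∷ xs) = x + total xs

  nth-≤-total : ∀ u s → nth u s ≤ total u
  nth-≤-total [] s = z≤n
  nth-≤-total (x ∷ u) zero = m≤m+n x (total u)
  nth-≤-total (x ∷ u) (suc s) = ≤-trans (nth-≤-total u s) (m≤n+m (total u) x)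

  bound : List FactData → ℕ
  bound [] = 0
  bound ((_ , u) ∷ K) = total u + bound K

  nth-≤-bound : ∀ {K c u} → (c , u) ∈ K → ∀ s → nth u s ≤ bound K
  nth-≤-bound {K = (_ , u) ∷ K} (here refl) s = ≤-trans (nth-≤-total u s) (m≤m+n (total u) (bound K))
  nth-≤-bound {K = (_ , u) ∷ K} (there x∈) s = ≤-trans (nth-≤-bound x∈ s) (m≤n+m (bound K) (total u))

  succs : ℕ → List FactData
  succs zero = []
  succs (suc N) = (0 , suc N ∷ N ∷ []) ∷ succs N

  succs-complete : ∀ {m N} → m < N → (0 , suc m ∷ m ∷ []) ∈ succs N
  succs-complete {m} {suc N} m<sN with m≤n⇒m<n∨m≡n (≤-pred m<sN)
  ... | inj₁ m<N = there (succs-complete m<N)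
  ... | inj₂ refl = here refl

  succs-sound : ∀ {N c u} → (c , u) ∈ succs N → Σ ℕ λ m → m < N × c ≡ 0 × u ≡ suc m ∷ m ∷ []
  succs-sound {suc N} (here refl) = N , ≤-refl , refl , refl
  succs-sound {suc N} (there x∈) with succs-sound x∈
  ... | m , m<N , e = m , m≤n⇒m≤1+n m<N , e

  -- The colours 0 , … , N are the values, the later ones are the facts in L.
  module Model (N : ℕ) (K : List FactData) (bounded : ∀ {c u} → (c , u) ∈ K → ∀ s → nth u s ≤ N)
               (proper : ∀ {c u} → (c , u) ∈ K → c ≢ 0) where

    L : List FactData
    L = succs N ++ K

    w : ℕ
    w = N + length L

    fact : ℕ → FactData
    fact i = factAt L (i ∸ suc N)

    value zeroᵗ : ℕ → ℕ
    value i = not (i ∸ N)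
    zeroᵗ = not

    type : ℕ → ℕ → ℕ
    type b i = and (i ∸ N) (eq (proj₁ (fact i)) b)

    -- Partition 0 is discrete. In partition `suc s` a value is alone among the values, and the
    -- facts with that value in slot `s` join it.
    class : ℕ → ℕ → ℕ
    class zero i = i
    class (suc s) i = ifz (i ∸ N) i (nth (proj₂ (fact i)) s)

    open Colours w class (λ _ → refl) value zeroᵗ type

    bounded-L : ∀ {c u} → (c , u) ∈ L → ∀ s → nth u s ≤ N
    bounded-L x∈ s with ∈-++⁻ (succs N) x∈
    ... | inj₂ x∈ = bounded x∈ s
    ... | inj₁ x∈ with succs-sound x∈
    bounded-L x∈ zero | inj₁ _ | m , m<N , _ , refl = m<N
    bounded-L x∈ (suc zero) | inj₁ _ | m , m<N , _ , refl = <⇒≤ m<N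
    bounded-L x∈ (suc (suc s)) | inj₁ _ | m , m<N , _ , refl = z≤n

    successor-fact : ∀ {u} → (0 , u) ∈ L → nth u 0 ≡ suc (nth u 1)
    successor-fact x∈ with ∈-++⁻ (succs N) x∈
    ... | inj₂ x∈ = ⊥-elim (proper x∈ refl)
    ... | inj₁ x∈ with succs-sound x∈
    ... | m , _ , _ , refl = refl

    Rep : List ℕ → CElt → Set
    Rep u X = Σ ℕ λ i → HasColour X i × (∀ s → class (suc s) i ≡ nth u s)

    class-value : ∀ {s i} → i ≤ N → class (suc s) i ≡ i
    class-value i≤N = ifz-zero _ _ (m≤n⇒m∸n≡0 i≤N)

    class-fact : ∀ {s i} → N < i → class (suc s) i ≡ nth (proj₂ (fact i)) s
    class-fact N<i = ifz-nonzero _ _ (m>n⇒m∸n≢0 N<i)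

    value⇒≤ : ∀ {i} → value i ≢ 0 → i ≤ N
    value⇒≤ p = m∸n≡0⇒m≤n (not-true p)

    type-param : ∀ b → κ (6 + b * 3) ≡ Paintᶜ (type b)
    type-param b = interleave-2 (λ s → Qᶜ (C.link s)) (λ s → Rᶜ (C.link s)) (λ b → Paintᶜ (type b)) b

    -- The axioms quantify over all elements of the semilattice; this reduces them to the finitely
    -- many facts of `L`.
    fact-in : ∀ {b X} → Fact b X → ¬ ¬ (Σ (List ℕ) λ u → (b , u) ∈ L × Rep u X)
    fact-in {b} {X} F nowhere = F λ pt X⊴ → point⇒colour {X} pt λ { (i , i≤w , hc) → go i i≤w hc
        (unpaint (type b) {X} {i} hc (subst (X ⊴_) (type-param b) X⊴)) }
      where
      go : ∀ i → i ≤ w → HasColour X i → type b i ≢ 0 → ⊥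
      go i i≤w hc t with and-true {i ∸ N} t
      ... | t₁ , t₂ = nowhere (proj₂ (fact i) , subst (λ b → (b , proj₂ (fact i)) ∈ L) (eq-true t₂) (factAt-∈ L lt) ,
            i , hc , λ s → class-fact {s} N<i)
        where
        N<i : N < i
        N<i = ≰⇒> λ i≤N → t₁ (m≤n⇒m∸n≡0 i≤N)
        lt : i ∸ suc N < length L
        lt = +-cancelˡ-< (suc N) _ _ (subst (_< suc N + length L) (sym (m+[n∸m]≡n N<i)) (s≤s i≤w))

    fact-point : ∀ {b u} → (b , u) ∈ L → Σ CElt λ X → Rep u X × Fact b X
    fact-point {b} {u} x∈ with ∈-factAt x∈
    ... | j , j<L , e = point i , (i , hc , λ s → trans (class-fact {s} N<i) (cong (λ x → nth (proj₂ x) s) at-i)) ,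
          λ k → k (colour⇒point {point i} {i} hc) (subst (point i ⊴_) (sym (type-param b)) (paint (type b) {point i} {i} hc typed))
      where
      i : ℕ
      i = suc N + j
      N<i : N < i
      N<i = s≤s (m≤m+n N j)
      i≤w : i ≤ w
      i≤w = ≤-trans (≤-reflexive (sym (+-suc N j))) (+-monoʳ-≤ N j<L)
      hc : HasColour (point i) i
      hc = point-colour i≤w
      at-i : fact i ≡ (b , u)
      at-i = trans (cong (factAt L) (m+n∸m≡n N j)) e
      typed : type b i ≢ 0
      typed = and-intro (m>n⇒m∸n≢0 N<i) λ z → 1+n≢0 (trans (sym (eq-refl b)) (trans (cong (λ x → eq (proj₁ x) b) (sym at-i)) z))

    slot-colour : ∀ {s X Y i n} → HasColour X i → class (suc s) i ≡ n → Slot s X Y → ¬ ¬ (HasColour Y n)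
    slot-colour {s} {X} {Y} {i} {n} hX e sl nowhere = sl λ pt Y⊴ ins → point⇒colour {Y} pt λ { (j , j≤w , hY) →
      nowhere (subst (HasColour Y)
        (trans (sym (class-value {s} (value⇒≤ (unpaint value {Y} {j} hY Y⊴)))) (trans (sym (sep-colours (suc s) {X} {Y} {i} {j} hX hY ins)) e)) hY) }

    colour-slot : ∀ {s X Y i n} → HasColour X i → class (suc s) i ≡ n → n ≤ N → HasColour Y n → Slot s X Y
    colour-slot {s} {X} {Y} {i} {n} hX e n≤N hY k = k (colour⇒point {Y} {n} hY)
      (paint value {Y} {n} hY (not-zero (m≤n⇒m∸n≡0 n≤N)))
      (insep (suc s) {X} {Y} {i} {n} hX hY (trans e (sym (class-value {s} n≤N))))

    value-point : ∀ {s X u} → Rep u X → nth u s ≤ N → Slot s X (point (nth u s))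
    value-point {s} {X} {u} (i , hX , e) ≤N =
      colour-slot {s} {X} {point (nth u s)} {i} hX (e s) ≤N (point-colour (≤-trans ≤N (m≤m+n N (length L))))

    slot-in : ∀ {s s′ X X′ i i′} → HasColour X i → HasColour X′ i′ → class (suc s) i ≡ class (suc s′) i′ →
              class (suc s) i ≤ N → In s X s′ X′
    slot-in {s} {s′} {X} {X′} {i} {i′} hX hX′ e ≤N Y sl k =
      slot-colour {s} {X} {Y} {i} hX refl sl λ hY → colour-slot {s′} {X′} {Y} {i′} hX′ (sym e) ≤N hY k

    rep-in : ∀ {c s s′ u u′ X X′} → (c , u) ∈ L → Rep u X → Rep u′ X′ → nth u s ≡ nth u′ s′ → In s X s′ X′
    rep-in {c} {s} {s′} {u} {u′} {X} {X′} x∈ (i , hX , e) (i′ , hX′ , e′) eq =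
      slot-in {s} {s′} {X} {X′} {i} {i′} hX hX′ (trans (e s) (trans eq (sym (e′ s′))))
        (subst (_≤ N) (sym (e s)) (bounded-L x∈ s))

    zero-colour : ∀ {Y n} → HasColour Y n → Zero Y → n ≡ 0
    zero-colour {Y} {n} hY z = not-true (unpaint zeroᵗ {Y} {n} hY z)

    colour-zero : ∀ {Y n} → HasColour Y n → n ≡ 0 → Zero Y
    colour-zero {Y} {n} hY e = paint zeroᵗ {Y} {n} hY (not-zero e)

    slot-zero : ∀ {s u X} → Rep u X → nth u s ≡ 0 → ∀ Y → Slot s X Y → Zero Y
    slot-zero {s} {u} {X} (i , hX , e) z Y sl =
      slot-colour {s} {X} {Y} {i} hX (trans (e s) z) sl >>= λ hY → colour-zero {Y} hY refl

    slot-not-zero : ∀ {s u X Y} → Rep u X → Slot s X Y → Zero Y → nth u s ≡ 0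
    slot-not-zero {s} {u} {X} {Y} (i , hX , e) sl z with zero? (nth u s)
    ... | inj₁ q = q
    ... | inj₂ q = ⊥-elim (slot-colour {s} {X} {Y} {i} hX (e s) sl λ hY → q (zero-colour {Y} hY z))

    -- Below 32 truncated subtraction gives p as a dummy value; these variables are bound in the
    -- formulas.
    ρ : ℕ → CElt
    ρ n = κ (n ∸ 32)

    positive : Sat ρ positiveᶠ
    positive σ Y F sl z = fact-in {0} {σ} F λ { (u , u∈ , rep) →
      1+n≢0 (trans (sym (successor-fact u∈)) (slot-not-zero {0} {u} {σ} {Y} rep sl z)) }

    injective : Sat ρ injectiveᶠ
    injective σ σ′ Y F F′ sl sl′ Z slZ k =
      fact-in {0} {σ} F λ { (u , u∈ , rep) → fact-in {0} {σ′} F′ λ { (u′ , u′∈ , rep′) →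
        slot-colour {0} {σ} {Y} (proj₁ (proj₂ rep)) (proj₂ (proj₂ rep) 0) sl λ hY →
        slot-colour {0} {σ′} {Y} (proj₁ (proj₂ rep′)) (proj₂ (proj₂ rep′) 0) sl′ λ hY′ →
        rep-in {0} {1} {1} {u′} {u} {σ′} {σ} u′∈ rep′ rep
          (suc-injective (trans (sym (successor-fact u′∈)) (trans (same hY′ hY) (successor-fact u∈)))) Z slZ k } }
      where
      same : ∀ {m n} → HasColour Y m → HasColour Y n → m ≡ n
      -- Partition 0 is discrete, so an element inseparable from itself has only one colour.
      same {m} {n} hm hn = sep-colours 0 {Y} {Y} {m} {n} hm hn (insep 0 {Y} {Y} {m} {m} hm hm refl)

    value-colour : ∀ {c u} → (c , u) ∈ L → ∀ s → HasColour (point (nth u s)) (nth u s)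
    value-colour u∈ s = point-colour (≤-trans (bounded-L u∈ s) (m≤m+n N (length L)))

    successor-∈ : ∀ {m} → m < N → (0 , suc m ∷ m ∷ []) ∈ L
    successor-∈ m<N = ∈-++⁺ˡ (succs-complete m<N)

    module _ {X : CElt} {c : ℕ} {u : List ℕ} (u∈ : (c , u) ∈ L) (rep : Rep u X) where

      private
        e₀ : ℕ → CElt
        e₀ = ρ [ 0 ↦ X ]

        into : ∀ {s s′ u′ X′} → Rep u′ X′ → nth u s ≡ nth u′ s′ → In s X s′ X′
        into {s} {s′} {u′} {X′} rep′ = rep-in {c} {s} {s′} {u} {u′} {X} {X′} u∈ rep rep′

        from : ∀ {c′ s s′ u′ X′} → (c′ , u′) ∈ L → Rep u′ X′ → nth u′ s ≡ nth u s′ → In s X′ s′ X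
        from {c′} {s} {s′} {u′} {X′} u′∈ rep′ = rep-in {c′} {s} {s′} {u′} {u} {X′} {X} u′∈ rep′ rep

      args-true : ∀ {n m} (gs : Vec (Rec n) m) b j {X₁ c₁ u₁} → (c₁ , u₁) ∈ L → Rep u₁ X₁ → Args gs b j u u₁ L →
                  Sat (e₀ [ 1 ↦ X₁ ]) (argsᶠ gs b j)
      args-true [] b j _ _ _ = id
      args-true {n} (g ∷ gs) b j {X₁} {c₁} {u₁} u₁∈ rep₁ ((w , w∈ , sh , e) , args) k = k
        (λ some → let X₂ , rep₂ , F₂ = fact-point {b} {w} w∈ in some X₂ F₂
          (all-intro n (λ i → Inᶠ (1 + i) 2 (1 + i) 0) ((e₀ [ 1 ↦ X₁ ]) [ 2 ↦ X₂ ])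
            λ i → from {b} {1 + i} {1 + i} {w} {X₂} w∈ rep₂ (sh i))
          (rep-in {c₁} {suc j} {0} {u₁} {w} {X₁} {X₂} u₁∈ rep₁ rep₂ e))
        (args-true gs (b + size g) (suc j) u₁∈ rep₁ args)

      node-true : ∀ {n} (t : Rec n) b → Node t b u L → Sat e₀ (nodeᶠ t b)
      node-true zeroʳ b z = slot-zero {0} {u} {X} rep z
      node-true succʳ b e some =
        let m<N = subst (_≤ N) e (bounded-L u∈ 0)
            σ , repσ , Fσ = fact-point (successor-∈ m<N)
        in some σ Fσ (into {0} {0} {suc (nth u 1) ∷ nth u 1 ∷ []} {σ} repσ e)
             (from {0} {1} {1} {suc (nth u 1) ∷ nth u 1 ∷ []} {σ} (successor-∈ m<N) repσ refl)
      node-true (projʳ i) b e = into {0} {suc (toℕ i)} {u} {X} rep e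
      node-true (compʳ f gs) b (u₁ , u₁∈ , e , args) some =
        let X₁ , rep₁ , F₁ = fact-point {suc b} {u₁} u₁∈ in
        some X₁ F₁ (into {0} {0} {u₁} {X₁} rep₁ e) (args-true gs (suc b + size f) 0 u₁∈ rep₁ args)
      node-true {suc n} (precʳ g h) b (inj₁ (z , u₁ , u₁∈ , e , sh)) base step =
        let X₁ , rep₁ , F₁ = fact-point {suc b} {u₁} u₁∈
            y = point (nth u 1)
        in base λ some → some y (value-point {1} {X} {u} rep (bounded-L u∈ 1)) (colour-zero {y} (value-colour u∈ 1) z)
          X₁ F₁ (into {0} {0} {u₁} {X₁} rep₁ e)
          (all-intro n (λ i → Inᶠ (1 + i) 1 (2 + i) 0) ((e₀ [ 5 ↦ y ]) [ 1 ↦ X₁ ])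
            λ i → from {suc b} {1 + i} {2 + i} {u₁} {X₁} u₁∈ rep₁ (sh i))
      node-true {suc n} (precʳ g h) b (inj₂ (k , ek , u₁ , u₁∈ , e₁ , sh , w , w∈ , f₀ , f₁ , f₂ , sh′)) base step =
        let m<N = subst (_≤ N) ek (bounded-L u∈ 1)
            y = point (nth u 1)
            σ , repσ , Fσ = fact-point (successor-∈ m<N)
            i , hσ , eσ = repσ
            X₁ , rep₁ , F₁ = fact-point {b} {u₁} u₁∈
            X₂ , rep₂ , F₂ = fact-point {suc b + size g} {w} w∈
        in step λ some → some y σ Fσ
          (colour-slot {0} {σ} {y} {i} hσ (trans (eσ 0) (sym ek)) (bounded-L u∈ 1) (value-colour u∈ 1))
          (value-point {1} {X} {u} rep (bounded-L u∈ 1))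
          X₁ F₁ (rep-in {b} {1} {1} {u₁} {suc k ∷ k ∷ []} {X₁} {σ} u₁∈ rep₁ repσ e₁)
          (all-intro n (λ i → Inᶠ (2 + i) 1 (2 + i) 0) (((e₀ [ 5 ↦ y ]) [ 3 ↦ σ ]) [ 1 ↦ X₁ ])
            λ i → from {b} {2 + i} {2 + i} {u₁} {X₁} u₁∈ rep₁ (sh i))
          X₂ F₂ (into {0} {0} {w} {X₂} rep₂ f₀)
          (rep-in {suc b + size g} {1} {1} {w} {suc k ∷ k ∷ []} {X₂} {σ} w∈ rep₂ repσ f₁)
          (rep-in {suc b + size g} {2} {0} {w} {u₁} {X₂} {X₁} w∈ rep₂ rep₁ f₂)
          (all-intro n (λ i → Inᶠ (3 + i) 2 (2 + i) 0) ((((e₀ [ 5 ↦ y ]) [ 3 ↦ σ ]) [ 1 ↦ X₁ ]) [ 2 ↦ X₂ ])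
            λ i → from {suc b + size g} {3 + i} {2 + i} {w} {X₂} w∈ rep₂ (sh′ i))
      node-true {n} (muʳ f) b (u₁ , u₁∈ , e , z , sh) some =
        let X₁ , rep₁ , F₁ = fact-point {suc b} {u₁} u₁∈ in
        some X₁ F₁ (into {0} {0} {u₁} {X₁} rep₁ e) (slot-zero {1} {u₁} {X₁} rep₁ z)
          (all-intro n (λ i → Inᶠ (2 + i) 1 (1 + i) 0) (e₀ [ 1 ↦ X₁ ])
            λ i → from {suc b} {2 + i} {1 + i} {u₁} {X₁} u₁∈ rep₁ (sh i))

      seek-true : ∀ n b → Seek n b u L → Sat e₀ (seekᶠ n b)
      seek-true n b (u₂ , u₂∈ , sh , next) some =
        let X₂ , rep₂ , F₂ = fact-point {suc b} {u₂} u₂∈ in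
        some X₂ F₂ (all-intro (suc n) (λ i → Inᶠ (1 + i) 2 (1 + i) 0) (e₀ [ 2 ↦ X₂ ])
            λ i → from {suc b} {1 + i} {1 + i} {u₂} {X₂} u₂∈ rep₂ (sh i))
          (either X₂ rep₂ next)
        where
        either : ∀ X₂ → Rep u₂ X₂ →
          ((nth u₂ 0 ≡ 0 × nth u 0 ≡ nth u 1)
            ⊎ (nth u₂ 0 ≢ 0 × Σ (List ℕ) λ w → (b , w) ∈ L × nth w 1 ≡ suc (nth u 1) × nth u 0 ≡ nth w 0 × Shift 2 w 2 u)) →
          Sat (e₀ [ 2 ↦ X₂ ]) (Either
            (Some 5 (Slotᶠ 0 2 5 ⇛ Zeroᶠ 5 ⇛ Inᶠ 0 0 1 0 ⇛ ⊥ᶠ))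
            (Some 5 (Slotᶠ 0 2 5 ⇛ ¬ᶠ (Zeroᶠ 5) ⇛ ∀ᶠ 3 (∀ᶠ 1 (Factᶠ 0 3 ⇛ Factᶠ b 1 ⇛
              Inᶠ 1 3 1 0 ⇛ Inᶠ 1 1 0 3 ⇛ Inᶠ 0 0 0 1 ⇛ Shiftᶠ n 2 1 2 0 ⇛ ⊥ᶠ)))))
        either X₂ rep₂ (inj₁ (z , e)) stop continue = stop λ some →
          some (point (nth u₂ 0)) (value-point {0} {X₂} {u₂} rep₂ (bounded-L u₂∈ 0))
            (colour-zero {point (nth u₂ 0)} (value-colour u₂∈ 0) z) (into {0} {1} {u} {X} rep e)
        either X₂ rep₂ (inj₂ (nonzero , w , w∈ , e₁ , e₀′ , sh)) stop continue =
          let m<N = subst (_≤ N) e₁ (bounded-L w∈ 1)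
              y = point (nth u₂ 0)
              σ , repσ , Fσ = fact-point (successor-∈ m<N)
              X₁ , rep₁ , F₁ = fact-point {b} {w} w∈
          in continue λ some → some y (value-point {0} {X₂} {u₂} rep₂ (bounded-L u₂∈ 0))
            (λ z → nonzero (zero-colour {y} (value-colour u₂∈ 0) z))
            σ X₁ Fσ F₁
            (from {0} {1} {1} {suc (nth u 1) ∷ nth u 1 ∷ []} {σ} (successor-∈ m<N) repσ refl)
            (rep-in {b} {1} {0} {w} {suc (nth u 1) ∷ nth u 1 ∷ []} {X₁} {σ} w∈ rep₁ repσ e₁)
            (into {0} {0} {w} {X₁} rep₁ e₀′)
            (all-intro n (λ i → Inᶠ (2 + i) 1 (2 + i) 0) ((((e₀ [ 2 ↦ X₂ ]) [ 5 ↦ y ]) [ 3 ↦ σ ]) [ 1 ↦ X₁ ])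
              λ i → from {b} {2 + i} {2 + i} {w} {X₁} w∈ rep₁ (sh i))

    mutual
      program-true : ∀ {n} (t : Rec n) b → (∀ {x} → x ∈ L → Good t b L x) → Sat ρ (programᶠ t b)
      program-true t b good k = k
        (λ X F → stable (nodeᶠ t b) (ρ [ 0 ↦ X ]) (fact-in {b} {X} F >>= λ { (u , u∈ , rep) →
          return (node-true {X} {b} {u} u∈ rep t b (proj₁ (good u∈) refl)) }))
        (subprograms-true t b λ x∈ → proj₂ (good x∈))

      subprograms-true : ∀ {n} (t : Rec n) b → (∀ {x} → x ∈ L → Goodˢ t b L x) → Sat ρ (subprogramsᶠ t b)
      subprograms-true zeroʳ b good = id
      subprograms-true succʳ b good = id
      subprograms-true (projʳ i) b good = id
      subprograms-true (compʳ f gs) b good k = k (program-true f (suc b) λ x∈ → proj₁ (good x∈))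
        (programs-true gs (suc b + size f) λ x∈ → proj₂ (good x∈))
      subprograms-true (precʳ g h) b good k = k (program-true g (suc b) λ x∈ → proj₁ (good x∈))
        (program-true h (suc b + size g) λ x∈ → proj₂ (good x∈))
      subprograms-true {n} (muʳ f) b good k = k
        (λ X F → stable (seekᶠ n (suc b)) (ρ [ 0 ↦ X ]) (fact-in {suc b} {X} F >>= λ { (u , u∈ , rep) →
          return (seek-true {X} {suc b} {u} u∈ rep n (suc b) (proj₁ (good u∈) refl)) }))
        (program-true f (suc (suc b)) λ x∈ → proj₂ (good x∈))

      programs-true : ∀ {n m} (gs : Vec (Rec n) m) b → (∀ {x} → x ∈ L → Goods gs b L x) → Sat ρ (programsᶠ gs b)
      programs-true [] b good = id
      programs-true (g ∷ gs) b good k = k (program-true g b λ x∈ → proj₁ (good x∈))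
        (programs-true gs (b + size g) λ x∈ → proj₂ (good x∈))

    axioms-true : ∀ g → (∀ {x} → x ∈ L → Good g 1 L x) → Sat ρ (axiomsᶠ g)
    axioms-true g good k = k positive λ k′ → k′ injective (program-true g 1 good)

    matrix-false : ∀ g v → (∀ {x} → x ∈ L → Good g 1 L x) → (1 , 1 ∷ v ∷ []) ∈ L → ¬ Sat ρ (matrixᶠ g v)
    matrix-false g v good out∈ sat = shifted-false (λ a → ≤-reflᵖʳ (proj₁ a) , ≤-reflᵖʳ (proj₁ a)) κ v R advance end
        -- Counting starts at the value 0 in the place of a fact: its slot 0 contains 0, since a
        -- value lies in its own class.
        v 0 (ρ [ 0 ↦ point 0 ]) refl refl (0 , point-colour z≤n , class-value {0} z≤n)
        (sat (axioms-true g good) (point 0) λ Y sl →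
          slot-colour {0} {point 0} {Y} {0} (point-colour z≤n) (class-value {0} z≤n) sl >>= λ hY → colour-zero {Y} hY refl)
      where
      R : ℕ → CElt → Set
      R m a = Σ ℕ λ i → HasColour a i × class 1 i ≡ m
      advance : ∀ m → m < v → ∀ a → R m a → Σ CElt λ x → Fact 0 x × In 1 x 0 a × R (suc m) x
      advance m m<v a (i , ha , e) =
        let m<N = ≤-trans m<v (bounded-L out∈ 1)
            σ , (j , hσ , eσ) , Fσ = fact-point (successor-∈ m<N)
        in σ , Fσ , slot-in {1} {0} {σ} {a} {j} {i} hσ ha (trans (eσ 1) (sym e)) (subst (_≤ N) (sym (eσ 1)) (<⇒≤ m<N)) ,
           j , hσ , eσ 0
      end : ∀ a → R v a → ¬ (∀ x → Fact 1 x → In 1 x 0 a → ∀ y → Slot 0 x y → Zero y)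
      end a (i , ha , e) claim =
        let x , rep , F = fact-point out∈
            j , hx , ex = rep
        in 1+n≢0 (zero-colour {point 1} (value-colour out∈ 0)
          (claim x F (slot-in {1} {0} {x} {a} {j} {i} hx ha (trans (ex 1) (sym e)) (subst (_≤ N) (sym (ex 1)) (bounded-L out∈ 1)))
            (point 1) (value-point {0} {x} {1 ∷ v ∷ []} rep (bounded-L out∈ 0))))

  output-1-false : ∀ g v → g [ v ∷ [] ]⇓ 1 → ¬ (∀ ρ → Sat ρ (matrixᶠ g v))
  output-1-false g v d sat with tree g 1 d
  ... | K , out∈ , within , good = M.matrix-false g v good-L (∈-++⁺ʳ (succs (bound K)) out∈) (sat M.ρ)
    where
    -- Identifiers in the tree start at 1, so no fact of `K` is mistaken for a successor fact.
    module M = Model (bound K) K nth-≤-bound (λ x∈ e → n≮0 (subst (0 <_) e (proj₁ (within x∈))))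
    good-L : ∀ {x} → x ∈ M.L → Good g 1 M.L x
    good-L x∈ with ∈-++⁻ (succs (bound K)) x∈
    ... | inj₂ x∈ = Good-mono g 1 _ (∈-++⁺ʳ (succs (bound K))) (good x∈)
    ... | inj₁ x∈ with succs-sound x∈
    ... | _ , _ , refl , _ = vacuous g 1 M.L (inj₁ (s≤s z≤n))

-- Gödel numbers of the sentences and self-application.

open PrimitiveRecursion
open Machine
open Formulas
open Interpretation using (output-1-false)

pair-cantor : ∀ k a b → pair k (pair a b) ≡ cantor k (cantor a b)
pair-cantor k a b = sym (trans (cantor≡pair k (cantor a b)) (cong (pair k) (cantor≡pair a b)))

code-⇒ : ∀ φ ψ → code (φ ⇒ ψ) ≡ cantor 3 (cantor (code φ) (code ψ))
code-⇒ φ ψ = pair-cantor 3 (code φ) (code ψ)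

code-∀ : ∀ x φ → code (∀ᶠ x φ) ≡ cantor 4 (cantor x (code φ))
code-∀ x φ = pair-cantor 4 x (code φ)

wrap : ℕ → ℕ → ℕ → ℕ → ℕ
wrap a b e c = cantor 4 (cantor 6 (cantor 3 (cantor a (cantor 3 (cantor b
  (cantor 4 (cantor 0 (cantor 3 (cantor e c)))))))))

code-shift : ∀ A B E ψ →
  code (∀ᶠ 6 (A ⇒ (B ⇒ ∀ᶠ 0 (E ⇒ ψ)))) ≡ wrap (code A) (code B) (code E) (code ψ)
code-shift A B E ψ =
  trans (code-∀ 6 (A ⇒ (B ⇒ ∀ᶠ 0 (E ⇒ ψ)))) (cong (λ c → cantor 4 (cantor 6 c))
    (trans (code-⇒ A (B ⇒ ∀ᶠ 0 (E ⇒ ψ))) (cong (λ c → cantor 3 (cantor (code A) c))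
      (trans (code-⇒ B (∀ᶠ 0 (E ⇒ ψ))) (cong (λ c → cantor 3 (cantor (code B) c))
        (trans (code-∀ 0 (E ⇒ ψ)) (cong (λ c → cantor 4 (cantor 0 c)) (code-⇒ E ψ))))))))

quantify : ℕ → ℕ → ℕ
quantify k c = natrec c (λ j b → cantor 4 (cantor j b)) k

code-close : ∀ k φ → code (closeᶠ k φ) ≡ quantify k (code φ)
code-close zero φ = refl
code-close (suc k) φ = trans (code-∀ k (closeᶠ k φ)) (cong (λ b → cantor 4 (cantor k b)) (code-close k φ))

module Coding (K : ℕ) (A B E Z : Formula) (shifted : ℕ → Formula)
              (shifted-suc : ∀ v → shifted (suc v) ≡ ∀ᶠ 6 (A ⇒ (B ⇒ ∀ᶠ 0 (E ⇒ shifted v)))) where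

  abstract
    shift : ℕ → ℕ
    shift = wrap (code A) (code B) (code E)

    body sentence : ℕ → ℕ
    -- The number `m` is used as the code of the antecedent and as the count of shifts, and below in
    -- the count of quantifiers. At the code of the axioms of `g` this yields the code of a sentence
    -- about running `g` on that very number.
    body m = cantor 3 (cantor m (cantor 4 (cantor 0 (cantor 3 (cantor (code Z) (iter shift m (code (shifted 0))))))))
    sentence m = quantify (K + m) (body m)

    PR₁-sentence : PR₁ sentence
    PR₁-sentence = PR₁-natrec {h = λ j b _ → cantor 4 (cantor j b)}
      (node 3 (PR₁-cantor PR₁-id (node 4 (node 0 (node 3 (node (code Z) (PR₁-iter
        (node 4 (node 6 (node 3 (node (code A) (node 3 (node (code B) (node 4 (node 0 (node 3 (node (code E) PR₁-id))))))))))
        PR₁-id (PR₁-const (code (shifted 0))))))))))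
      (PR₁-+ (PR₁-const K) PR₁-id)
      (node 4 (PR₁-cantor (PR₁-π₁ fstᴾ) (PR₁-π₂ fstᴾ)))
      where
      node : ∀ k {f} → PR₁ f → PR₁ (λ x → cantor k (f x))
      node k = PR₁-cantor (PR₁-const k)

    code-shifted : ∀ v → code (shifted v) ≡ iter shift v (code (shifted 0))
    code-shifted zero = refl
    code-shifted (suc v) = trans (cong code (shifted-suc v))
      (trans (code-shift A B E (shifted v)) (cong shift (code-shifted v)))

    code-sentence : ∀ φ v → v ≡ code φ → code (closeᶠ (K + v) (φ ⇒ ∀ᶠ 0 (Z ⇒ shifted v))) ≡ sentence v
    code-sentence φ v e = trans (code-close (K + v) (φ ⇒ ∀ᶠ 0 (Z ⇒ shifted v))) (cong (quantify (K + v))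
      (trans (code-⇒ φ (∀ᶠ 0 (Z ⇒ shifted v))) (cong₂ (λ a c → cantor 3 (cantor a c)) (sym e)
        (trans (code-∀ 0 (Z ⇒ shifted v)) (cong (λ c → cantor 4 (cantor 0 c))
          (trans (code-⇒ Z (shifted v)) (cong (λ c → cantor 3 (cantor (code Z) c)) (code-shifted v))))))))

≡ᵇ-false : ∀ {x y} → x ≢ y → (x ≡ᵇ y) ≡ false
≡ᵇ-false {x} {y} x≢y with x ≡ᵇ y in e
... | false = refl
... | true = ⊥-elim (x≢y (≡ᵇ⇒≡ x y (subst True (sym e) tt)))

||-false : ∀ {a b} → a ≡ false → b ≡ false → (a || b) ≡ false
||-false refl refl = refl

pairˡ : ∀ {a b x} → pair a b < x → a < x
pairˡ {a} {b} = ≤-<-trans (subst (a ≤_) (cantor≡pair a b) (pair-≥ˡ a b))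

pairʳ : ∀ {a b x} → pair a b < x → b < x
pairʳ {a} {b} = ≤-<-trans (m≤n+m b (tri (a + b)))

freeₜ-code : ∀ t {x} → codeₜ t < x → freeₜ x t ≡ false
freeₜ-code (var y) {x} lt = ≡ᵇ-false {x} {y} λ { refl → <-irrefl refl (pairʳ {0} {y} lt) }
freeₜ-code (t ∨ₜ s) lt = ||-false (freeₜ-code t (pairˡ (pairʳ {1} {pair (codeₜ t) (codeₜ s)} lt)))
  (freeₜ-code s (pairʳ {codeₜ t} (pairʳ {1} {pair (codeₜ t) (codeₜ s)} lt)))

-- A formula mentions only variables up to its code, so a quantifier prefix computed from the code
-- of the axioms closes them, whatever the program.
free-code : ∀ φ {x} → code φ < x → free x φ ≡ false
free-code (t ≐ s) lt = ||-false (freeₜ-code t (pairˡ (pairʳ {0} {pair (codeₜ t) (codeₜ s)} lt)))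
  (freeₜ-code s (pairʳ {codeₜ t} (pairʳ {0} {pair (codeₜ t) (codeₜ s)} lt)))
free-code (t ≼ s) lt = ||-false (freeₜ-code t (pairˡ (pairʳ {1} {pair (codeₜ t) (codeₜ s)} lt)))
  (freeₜ-code s (pairʳ {codeₜ t} (pairʳ {1} {pair (codeₜ t) (codeₜ s)} lt)))
free-code ⊥ᶠ lt = refl
free-code (φ ⇒ ψ) lt = ||-false (free-code φ (pairˡ (pairʳ {3} {pair (code φ) (code ψ)} lt)))
  (free-code ψ (pairʳ {code φ} (pairʳ {3} {pair (code φ) (code ψ)} lt)))
free-code (∀ᶠ y φ) {x} lt with x ≡ᵇ y
... | true = refl
... | false = free-code φ (pairʳ {y} (pairʳ {4} {pair y (code φ)} lt))

free-close : ∀ k φ x → (k ≤ x → free x φ ≡ false) → free x (closeᶠ k φ) ≡ false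
free-close zero φ x f = f z≤n
free-close (suc k) φ x f with x ≡ᵇ k in e
... | true = refl
... | false = free-close k φ x λ k≤x → f (≤∧≢⇒< k≤x λ { refl → true≢false (trans (sym (≡ᵇ-refl k)) e) })
  where
  true≢false : true ≢ false
  true≢false ()
  ≡ᵇ-refl : ∀ n → (n ≡ᵇ n) ≡ true
  ≡ᵇ-refl zero = refl
  ≡ᵇ-refl (suc n) = ≡ᵇ-refl n

-- All variables of `outputsᶠ` and of the shifts are below 64, so freeness at `64 + y` is settled by
-- computation.
free-shifted : ∀ v y → free (64 + y) (shiftedᶠ v outputsᶠ) ≡ false
free-shifted zero y = refl
free-shifted (suc v) y = free-shifted v y

free-⇒ : ∀ φ ψ {x v} → v ≡ code φ → v < x → free x ψ ≡ false → free x (φ ⇒ ψ) ≡ false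
free-⇒ φ ψ refl lt f = ||-false (free-code φ lt) f

free-matrix : ∀ g v y → v ≡ code (axiomsᶠ g) → v ≤ y → free (64 + y) (matrixᶠ g v) ≡ false
free-matrix g v y e v≤y = free-⇒ (axiomsᶠ g) (∀ᶠ 0 (∀ᶠ 5 (Slotᶠ 0 0 5 ⇛ Zeroᶠ 5) ⇛ shiftedᶠ v outputsᶠ)) e
  (s≤s (≤-trans v≤y (m≤n+m y 63))) (free-shifted v y)

Sᶠ-closed : ∀ g v → v ≡ code (axiomsᶠ g) → Sentence (closeᶠ (64 + v) (matrixᶠ g v))
Sᶠ-closed g v e x = free-close (64 + v) (matrixᶠ g v) x λ le →
  subst (λ x → free x (matrixᶠ g v) ≡ false) (m+[n∸m]≡n (m+n≤o⇒m≤o 64 le))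
    (free-matrix g v (x ∸ 64) e (subst (_≤ x ∸ 64) (m+n∸m≡n 64 v) (∸-monoˡ-≤ 64 le)))

zero-hypᶠ : Formula
zero-hypᶠ = ∀ᶠ 5 (Slotᶠ 0 0 5 ⇛ Zeroᶠ 5)

module Sentences = Coding 64 (Factᶠ 0 6) (Inᶠ 1 6 0 0) (var 0 ≐ var 6) zero-hypᶠ (λ v → shiftedᶠ v outputsᶠ) (λ _ → refl)

Sᶠ : Rec 1 → ℕ → Formula
Sᶠ g v = closeᶠ (64 + v) (axiomsᶠ g ⇒ ∀ᶠ 0 (zero-hypᶠ ⇒ shiftedᶠ v outputsᶠ))

Sᶠ-true : ∀ g v → g [ v ∷ [] ]⇓ 0 → ∀ M → M ⊨ Sᶠ g v
Sᶠ-true g v run M = Truth.close-true _≡_ (Structure._≤ₛ_ M) (Structure._∨ₛ_ M) (64 + v) (matrixᶠ g v)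
  (Truth.matrix-true _≡_ (Structure._≤ₛ_ M) (Structure._∨ₛ_ M) id g v run)

Sᶠ-false : ∀ g v → g [ v ∷ [] ]⇓ 1 → ¬ (C⊨ Sᶠ g v)
Sᶠ-false g v run valid = output-1-false g v run (Truth.open-true _≈C_ _≤C_ _∨C_ (64 + v) (matrixᶠ g v) valid)

-- Opaque: unfolding the Gödel number of a concrete formula does not terminate in practice.
abstract
  gödel : ∀ φ → Σ ℕ λ v → v ≡ code φ
  gödel φ = code φ , refl

module _ {Th : Formula → Set} (theory : IsSubtheoryOfThC Th) {R : ℕ → Bool}
  (decides : ∀ φ → Sentence φ → (Th φ → R (code φ) ≡ true) × (R (code φ) ≡ true → Th φ)) where

  -- A program g that decides membership in the theory of the sentence coded by its
  -- argument is run on the code of its own axioms.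
  self-application : ∀ g v → v ≡ code (axiomsᶠ g) → ∀ b → R (Sentences.sentence v) ≡ b → ¬ (g [ v ∷ [] ]⇓ χ b)
  self-application g v e b r run = go b r run
    where
    S : Formula
    S = Sᶠ g v
    closed : Sentence S
    closed = Sᶠ-closed g v e
    coded : R (code S) ≡ R (Sentences.sentence v)
    coded = cong R (Sentences.code-sentence (axiomsᶠ g) v e)
    true≢false : true ≢ false
    true≢false ()
    go : ∀ b → R (Sentences.sentence v) ≡ b → ¬ (g [ v ∷ [] ]⇓ χ b)
    -- Acceptance puts the sentence into the theory, so it holds in the semilattice, where output 1
    -- refutes it. Rejection makes it true in all structures, so closure under consequence puts it
    -- into the theory.
    go true r run = Sᶠ-false g v run (proj₂ (proj₁ theory S (proj₂ (decides S closed) (trans coded r))))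
    go false r run = true≢false (trans (sym (proj₁ (decides S closed)
      (proj₂ theory S closed λ M _ → Sᶠ-true g v run M))) (trans coded r))

  no-decider : ∀ g → ¬ (∀ v → g [ v ∷ [] ]⇓ χ (R (Sentences.sentence v)))
  no-decider g run = self-application g (proj₁ s) (proj₂ s) (R (Sentences.sentence (proj₁ s))) refl (run (proj₁ s))
    where
    s : Σ ℕ λ v → v ≡ code (axiomsᶠ g)
    s = gödel (axiomsᶠ g)

theorem1p2 : HereditarilyUndecidableThC
theorem1p2 Th theory (R , computable , decides) = no-decider theory {R} decides (proj₁ solver) (proj₂ solver)
  where
  solver : Rec₁ (λ m → χ (R (Sentences.sentence m)))
  solver = Rec₁-∘ {χ ∘ R} {Sentences.sentence} computable (Rec₁-PR Sentences.PR₁-sentence)
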